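{- Let $q\ge5$ be a prime power. If $q\not\equiv0\pmod3$, no $2_{\mathcal C}$-plane contains a real axis or an imaginary axis (so $\Lambda_{\mathrm{RA},2_{\mathcal C}}=\Pi_{2_{\mathcal C},\mathrm{RA}}=\Lambda_{\mathrm{IA},2_{\mathcal C}}=\Pi_{2_{\mathcal C},\mathrm{IA}}=0$). For every $q\ge5$, $\Lambda_{\mathrm{En}\Gamma,2_{\mathcal C}}=(q-1)^2$ and $\Pi_{2_{\mathcal C},\mathrm{En}\Gamma}=1$.
   Context: Let $\mathrm{PG}(3,q)$ have points $\mathbf{P}(x_0,x_1,x_2,x_3)$; put $P(t)=\mathbf{P}(t^3,t^2,t,1)$ ($t\in\mathbb{F}_q$), $P(\infty)=\mathbf{P}(1,0,0,0)$, $\mathcal{C}=\{P(t):t\in\mathbb{F}_q\cup\{\infty\}\}$ the twisted cubic and $G_q$ the group of projectivities fixing $\mathcal C$. Write $\boldsymbol{\pi}(c_0,c_1,c_2,c_3)$ for the plane $c_0x_0+c_1x_1+c_2x_2+c_3x_3=0$. The $\Gamma$-planes are the osculating planes $\boldsymbol{\pi}(1,-3t,3t^2,-t^3)$ ($t\in\mathbb{F}_q$) and $\boldsymbol{\pi}(0,0,0,1)$. A $2_{\mathcal C}$-plane is a plane containing exactly $2$ points of $\mathcal C$ (for $q\ge 5$ these form a $G_q$-orbit). For $q\not\equiv0\pmod3$: a real axis is the intersection line of two distinct $\Gamma$-planes; an imaginary axis is the line of $\mathrm{PG}(3,q)$ obtained as intersection of $\boldsymbol{\pi}(1,-3s,3s^2,-s^3)$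 and $\boldsymbol{\pi}(1,-3s^q,3s^{2q},-s^{3q})$, $s\in\mathbb{F}_{q^2}\setminus\mathbb{F}_q$. An imaginary chord is the line joining $P(s),P(s^q)$, $s\in\mathbb{F}_{q^2}\setminus\mathbb{F}_q$. An En$\Gamma$-line is a line containing no point of $\mathcal C$, lying in no $\Gamma$-plane, which is neither an imaginary chord nor (for $q\not\equiv 0\pmod3$) an imaginary axis. Notation: $\Lambda_{\lambda,\pi}$ is the number of $\lambda$-lines in a $\pi$-plane; $\Pi_{\pi,\lambda}$ is the average, over all $\lambda$-lines, of the number of $\pi$-planes through the line. -}

module Defs where

open import Level using (0ℓ)
open import Data.Nat as ℕ using (ℕ; zero; suc)
open import Data.Nat.Primality using (Prime)
open import Data.Fin using (Fin)
open import Data.Vec using (Vec; lookup)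
open import Data.Maybe using (Maybe; just; nothing)
open import Data.Product using (Σ; ∃; ∃-syntax; _×_; _,_)
open import Data.Sum using (_⊎_)
open import Data.Unit using (⊤)
open import Relation.Nullary using (¬_)
open import Relation.Binary.PropositionalEquality using (_≡_)
open import Algebra.Structures using (IsCommutativeRing)

CountIs : {A : Set} → (A → A → Set) → (A → Set) → ℕ → Set
CountIs {A} _~_ P n =
  Σ (Vec A n) λ v →
    (∀ i → P (lookup v i)) ×
    (∀ i j → lookup v i ~ lookup v j → i ≡ j) ×
    (∀ a → P a → ∃[ i ] (a ~ lookup v i))

IsPrimePower : ℕ → Set
IsPrimePower q = ∃[ p ] ∃[ k ] (Prime p × 1 ℕ.≤ k × q ≡ p ℕ.^ k)

record FiniteField (q : ℕ) : Set₁ where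
  infixl 6 _+_
  infixl 7 _*_
  field
    Carrier : Set
    _+_ _*_ : Carrier → Carrier → Carrier
    -_      : Carrier → Carrier
    0# 1#   : Carrier
    isCommutativeRing : IsCommutativeRing (_≡_ {A = Carrier}) _+_ _*_ -_ 0# 1#
    0≢1     : ¬ (0# ≡ 1#)
    inverse : ∀ x → ¬ (x ≡ 0#) → ∃[ y ] (x * y ≡ 1#)
    order   : CountIs (_≡_ {A = Carrier}) (λ _ → ⊤) q

  _^_ : Carrier → ℕ → Carrier
  x ^ zero  = 1#
  x ^ suc n = x * (x ^ n)

  3# : Carrier
  3# = 1# + 1# + 1#

  -- vectors of F^4 (homogeneous coordinates in PG(3,q))
  V4 : Set
  V4 = Carrier × Carrier × Carrier × Carrier

  _·_ : V4 → V4 → Carrier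
  (a₀ , a₁ , a₂ , a₃) · (b₀ , b₁ , b₂ , b₃) =
    a₀ * b₀ + a₁ * b₁ + a₂ * b₂ + a₃ * b₃

  _⊕_ : V4 → V4 → V4
  (a₀ , a₁ , a₂ , a₃) ⊕ (b₀ , b₁ , b₂ , b₃) =
    (a₀ + b₀ , a₁ + b₁ , a₂ + b₂ , a₃ + b₃)

  _⊙_ : Carrier → V4 → V4
  c ⊙ (a₀ , a₁ , a₂ , a₃) = (c * a₀ , c * a₁ , c * a₂ , c * a₃)

  zeroV : V4
  zeroV = (0# , 0# , 0# , 0#)

  InSpan : V4 → V4 → V4 → Set
  InSpan x u v = ∃[ a ] ∃[ b ] (x ≡ (a ⊙ u) ⊕ (b ⊙ v))

  Indep : V4 → V4 → Set
  Indep u v = ∀ a b → (a ⊙ u) ⊕ (b ⊙ v) ≡ zeroV → (a ≡ 0#) × (b ≡ 0#)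

  -- Points of the twisted cubic: P(t) for t ∈ F, and P(∞) = nothing
  Pt : Maybe Carrier → V4
  Pt (just t) = (t ^ 3 , t ^ 2 , t , 1#)
  Pt nothing  = (1# , 0# , 0# , 0#)

  PlaneRep : Set
  PlaneRep = Σ V4 λ c → ¬ (c ≡ zeroV)

  coeff : PlaneRep → V4
  coeff (c , _) = c

  SamePlane : PlaneRep → PlaneRep → Set
  SamePlane π ρ = ∃[ l ] (¬ (l ≡ 0#) × coeff ρ ≡ l ⊙ coeff π)

  -- osculating plane π(1,-3t,3t²,-t³) and π(0,0,0,1)
  oscV : Carrier → V4
  oscV t = (1# , - (3# * t) , 3# * (t ^ 2) , - (t ^ 3))

  πinfV : V4
  πinfV = (0# , 0# , 0# , 1#)

  IsΓPlane : PlaneRep → Set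
  IsΓPlane π = (∃[ t ] (coeff π ≡ oscV t)) ⊎ (coeff π ≡ πinfV)
  -- (up to proportionality this is exactly the set of Γ-planes)

  ΓPlaneOf : PlaneRep → Set
  ΓPlaneOf π = ∃[ ρ ] (IsΓPlane ρ × SamePlane ρ π)

  -- 2_C-plane: contains exactly two points of the twisted cubic
  -- (points counted via their parameters in F ∪ {∞}; t ↦ P(t) is injective)
  Is2CPlane : PlaneRep → Set
  Is2CPlane π = CountIs (_≡_ {A = Maybe Carrier}) (λ t → coeff π · Pt t ≡ 0#) 2

  LineRep : Set
  LineRep = Σ (V4 × V4) λ { (u , v) → Indep u v }

  gen₁ gen₂ : LineRep → V4
  gen₁ ((u , _) , _) = u
  gen₂ ((_ , v) , _) = v

  OnLine : V4 → LineRep → Set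
  OnLine x L = InSpan x (gen₁ L) (gen₂ L)

  SameLine : LineRep → LineRep → Set
  SameLine L M = OnLine (gen₁ M) L × OnLine (gen₂ M) L ×
                 OnLine (gen₁ L) M × OnLine (gen₂ L) M

  _⊆π_ : LineRep → PlaneRep → Set
  L ⊆π π = (coeff π · gen₁ L ≡ 0#) × (coeff π · gen₂ L ≡ 0#)

  SameFlag : LineRep × PlaneRep → LineRep × PlaneRep → Set
  SameFlag (L , π) (M , ρ) = SameLine L M × SamePlane π ρ

  IsRealAxis : LineRep → Set
  IsRealAxis L = ∃[ π ] ∃[ ρ ]
    (IsΓPlane π × IsΓPlane ρ × ¬ SamePlane π ρ × L ⊆π π × L ⊆π ρ)

record QuadExt {q : ℕ} (F : FiniteField q) : Set₁ where
  field
    K : FiniteField (q ℕ.* q)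
  module F = FiniteField F
  module K = FiniteField K
  field
    ι      : F.Carrier → K.Carrier
    ι-+    : ∀ a b → ι (a F.+ b) ≡ ι a K.+ ι b
    ι-*    : ∀ a b → ι (a F.* b) ≡ ι a K.* ι b
    ι-1    : ι F.1# ≡ K.1#
    ι-inj  : ∀ a b → ι a ≡ ι b → a ≡ b

  ιV : F.V4 → K.V4
  ιV (a₀ , a₁ , a₂ , a₃) = (ι a₀ , ι a₁ , ι a₂ , ι a₃)

  Irrational : K.Carrier → Set
  Irrational s = ¬ (∃[ a ] (ι a ≡ s))

  -- imaginary axis: the F_q-line whose extension to F_{q²} is the
  -- intersection of the osculating planes at s and s^q
  IsImagAxis : F.LineRep → Set
  IsImagAxis L = ∃[ s ] (Irrational s ×
    (K.oscV s K.· ιV (F.gen₁ L) ≡ K.0#) × (K.oscV s K.· ιV (F.gen₂ L) ≡ K.0#) ×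
    (K.oscV (s K.^ q) K.· ιV (F.gen₁ L) ≡ K.0#) ×
    (K.oscV (s K.^ q) K.· ιV (F.gen₂ L) ≡ K.0#))

  -- imaginary chord: the F_q-line whose extension joins P(s), P(s^q)
  IsImagChord : F.LineRep → Set
  IsImagChord L = ∃[ s ] (Irrational s ×
    K.InSpan (K.Pt (just s)) (ιV (F.gen₁ L)) (ιV (F.gen₂ L)) ×
    K.InSpan (K.Pt (just (s K.^ q))) (ιV (F.gen₁ L)) (ιV (F.gen₂ L)))

  IsEnΓ : F.LineRep → Set
  IsEnΓ L =
    (∀ t → ¬ F.OnLine (F.Pt t) L) ×
    (∀ π → F.ΓPlaneOf π → ¬ (L F.⊆π π)) ×
    ¬ IsImagChord L ×
    (¬ (q ℕ.% 3 ≡ 0) → ¬ IsImagAxis L)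

  EnΓ2CFlag : F.LineRep × F.PlaneRep → Set
  EnΓ2CFlag (L , π) = IsEnΓ L × F.Is2CPlane π × L F.⊆π π

-- A plane is a binary cubic form, and it is a 2_C-plane exactly when the form is (·×s)²(·×t) up to a scalar with s ≠ t.
-- Such a form is not a combination λ(·×σ)³ + μ(·×τ)³ of two distinct cubes: compare values at s and t and the
-- derivative at s (in characteristic 3, cubing is injective). Hence no axis lies in a 2_C-plane, and the q - 1 planes
-- osculating away from s and t cut the plane in distinct lines, which are removed from the q(q - 1) lines of the plane
-- avoiding its two points of C.
--
-- For the number of all EnΓ-lines, a line off P(∞) and not in the osculating plane at ∞ is the pencil spanned by a monic
-- form g of degree 1 or 2 and a monic cubic. It misses C and is no imaginary chord if and only if the resultant of
-- g and the cubic is nonzero, which leaves q²(q² - 1) pencils. Pairs of a cube (x - t)³ and a coprime g number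
-- q(q² - 1), and each of these pairs spans a pencil in Γ. In characteristic 3 a pencil off ∞ contains at most one cube;
-- otherwise the pencils with two cubes (real axes) are as many as the imaginary axes, since real axes correspond
-- to unordered pairs of elements and imaginary axes to irreducible monic quadratics. Either way
-- q²(q² - 1) - q(q² - 1) = (q + 1) q (q - 1)² lines remain, as many as flags.
module Submission where

open import Level using (0ℓ)
open import Algebra.Bundles using (CommutativeRing)
open import Data.Integer as ℤ using (ℤ; +_; -[1+_]; +[1+_]; _⊖_; _◃_; +-*-rawRing)
open import Data.Integer.Properties using ([1+m]⊖[1+n]≡m⊖n)
import Data.Integer.Properties as ℤₚ
open import Data.Nat as ℕ using (ℕ; zero; suc)
open import Data.Maybe using (Maybe; just; nothing)
import Data.Sign as Sign
open import Relation.Nullary using (yes; no)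
open import Relation.Binary.PropositionalEquality as ≡ using (_≡_)
open import Relation.Binary.Definitions using (WeaklyDecidable)
open import Algebra.Solver.Ring.AlmostCommutativeRing using (fromCommutativeRing; _-Raw-AlmostCommutative⟶_; Induced-equivalence)
import Algebra.Solver.Ring

-- An average over all EnΓ-lines needs their total number, and this number is q - 1 times the order
-- of PGL(2,q), so no single representative under the group would do. The lines are therefore put
-- into normal forms with field coordinates and counted by explicit bijections. The obstacle is the
-- imaginary axes, which live over a field K known only by its size q² and an embedding of F. To
-- match them with irreducible quadratics over F, every such quadratic must have a root in K, and
-- the q-th power of the root must be the other root. Both rest on one fact about domains: a
-- polynomial of degree n with n distinct roots is a scalar times the product of its linear factors.
-- It also replaces the binomial theorem modulo p in the study of x ↦ x^q. The number n of pencils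
-- with two cubes is never computed. It is q² minus the number of weakly decreasing pairs, which is
-- also the number of split monic quadratics, so n counts the irreducible ones as well and cancels
-- in (q (q² - 1) - n) + n. Hence there is no case distinction on the parity of q.

module IntegerSolver (R : CommutativeRing 0ℓ 0ℓ) where
  open CommutativeRing R
  open import Algebra.Properties.Ring ring
  open import Algebra.Properties.Semiring.Mult.TCOptimised semiring
  open import Relation.Binary.Reasoning.Setoid setoid

  -- The coefficients are integers, whose equality computes, so that numerals such as 3 normalize
  -- over an abstract field.
  ⟦_⟧ℤ : ℤ → Carrier
  ⟦ + n ⟧ℤ      = n × 1#
  ⟦ -[1+ n ] ⟧ℤ = - (suc n × 1#)

  -0≈0 : - 0# ≈ 0#
  -0≈0 = -0#≈0#

  ⊖-homo : ∀ m n → ⟦ m ⊖ n ⟧ℤ ≈ m × 1# - n × 1#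
  ⊖-homo m zero = sym (trans (+-congˡ -0≈0) (+-identityʳ _))
  ⊖-homo zero (suc n) = sym (+-identityˡ _)
  ⊖-homo (suc m) (suc n) = begin
    ⟦ suc m ⊖ suc n ⟧ℤ                   ≡⟨ ≡.cong ⟦_⟧ℤ ([1+m]⊖[1+n]≡m⊖n m n) ⟩
    ⟦ m ⊖ n ⟧ℤ                           ≈⟨ ⊖-homo m n ⟩
    m × 1# - n × 1#                      ≈⟨ +-congʳ (sym (+-identityʳ _)) ⟩
    (m × 1# + 0#) - n × 1#               ≈⟨ +-congʳ (+-congˡ (sym (-‿inverseʳ 1#))) ⟩
    (m × 1# + (1# - 1#)) - n × 1#        ≈⟨ +-congʳ (sym (+-assoc _ _ _)) ⟩
    ((m × 1# + 1#) - 1#) - n × 1#        ≈⟨ +-assoc _ _ _ ⟩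
    (m × 1# + 1#) + (- 1# - n × 1#)      ≈⟨ +-cong (+-comm _ _) (-‿+-comm 1# (n × 1#)) ⟩
    (1# + m × 1#) - (1# + n × 1#)        ≈⟨ +-cong (1+× m 1#) (-‿cong (1+× n 1#)) ⟨
    suc m × 1# - suc n × 1#              ∎

  ℤ-homo-+ : ∀ i j → ⟦ i ℤ.+ j ⟧ℤ ≈ ⟦ i ⟧ℤ + ⟦ j ⟧ℤ
  ℤ-homo-+ (+ m) (+ n) = ×-homo-+ 1# m n
  ℤ-homo-+ (+ m) -[1+ n ] = ⊖-homo m (suc n)
  ℤ-homo-+ -[1+ m ] (+ n) = trans (⊖-homo n (suc m)) (+-comm _ _)
  ℤ-homo-+ -[1+ m ] -[1+ n ] = begin
    - (suc (suc (m ℕ.+ n)) × 1#)       ≈⟨ -‿cong (≡.subst (λ k → k × 1# ≈ suc m × 1# + suc n × 1#) (≡.cong suc (+-suc m n)) (×-homo-+ 1# (suc m) (suc n))) ⟩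
    - (suc m × 1# + suc n × 1#)        ≈⟨ sym (-‿+-comm _ _) ⟩
    - (suc m × 1#) - suc n × 1#        ∎
    where open import Data.Nat.Properties using (+-suc)

  ℤ-homo-neg : ∀ i → ⟦ ℤ.- i ⟧ℤ ≈ - ⟦ i ⟧ℤ
  ℤ-homo-neg (+ zero)  = sym -0≈0
  ℤ-homo-neg +[1+ n ]  = refl
  ℤ-homo-neg -[1+ n ]  = sym (-‿involutive _)

  neg◃ : ∀ n → ⟦ Sign.- ◃ n ⟧ℤ ≈ - (n × 1#)
  neg◃ zero = sym -0≈0
  neg◃ (suc n) = refl

  pos◃ : ∀ n → ⟦ Sign.+ ◃ n ⟧ℤ ≈ n × 1#
  pos◃ zero = refl
  pos◃ (suc n) = refl

  ℤ-homo-* : ∀ i j → ⟦ i ℤ.* j ⟧ℤ ≈ ⟦ i ⟧ℤ * ⟦ j ⟧ℤ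
  ℤ-homo-* (+ m) (+ n) = trans (pos◃ (m ℕ.* n)) (×1-homo-* m n)
  ℤ-homo-* (+ m) -[1+ n ] = trans (neg◃ (m ℕ.* suc n)) (trans (-‿cong (×1-homo-* m (suc n))) (-‿distribʳ-* _ _))
  ℤ-homo-* -[1+ m ] (+ n) = trans (neg◃ (suc m ℕ.* n)) (trans (-‿cong (×1-homo-* (suc m) n)) (-‿distribˡ-* _ _))
  ℤ-homo-* -[1+ m ] -[1+ n ] = trans (pos◃ (suc m ℕ.* suc n)) (trans (×1-homo-* (suc m) (suc n)) (sym (trans (sym (-‿distribˡ-* _ _)) (trans (-‿cong (sym (-‿distribʳ-* _ _))) (-‿involutive _)))))

  ℤ-morphism : +-*-rawRing -Raw-AlmostCommutative⟶ fromCommutativeRing R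
  ℤ-morphism = record
    { ⟦_⟧ = ⟦_⟧ℤ ; +-homo = ℤ-homo-+ ; *-homo = ℤ-homo-* ; -‿homo = ℤ-homo-neg
    ; 0-homo = refl ; 1-homo = refl }

  -- Different integers can have the same image in positive characteristic, so a negative answer
  -- proves nothing. Identities special to characteristic 3 are therefore stated with an explicit
  -- multiple of 3, which is discarded afterwards.
  _coeff≟_ : WeaklyDecidable (Induced-equivalence ℤ-morphism)
  i coeff≟ j with i ℤₚ.≟ j
  ... | yes i≡j = just (reflexive (≡.cong ⟦_⟧ℤ i≡j))
  ... | no _    = nothing

  open Algebra.Solver.Ring +-*-rawRing (fromCommutativeRing R) ℤ-morphism _coeff≟_ public

open import Defs
open import Data.Nat as ℕ using (_∸_; s≤s; z≤n)
import Data.Nat.Properties as ℕₚ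
open import Data.Nat.Primality using (prime?; euclidsLemma; prime⇒irreducible)
open import Data.Nat.Divisibility using (_∣_; m%n≡0⇒n∣m; ∣1⇒≡1)
open import Data.Nat.DivMod using (m≡m%n+[m/n]*n; m%n<n)
open import Data.Nat.Solver using (module +-*-Solver)
open import Data.Fin as Fin using (Fin; zero; suc; toℕ; splitAt; join; remQuot; combine; punchIn; punchOut; _↑ˡ_; _↑ʳ_)
import Data.Fin.Properties as Finₚ
open import Data.Fin.Permutation using (permutation)
open import Data.Vec using (lookup; tabulate)
open import Data.Vec.Properties using (lookup∘tabulate)
import Data.Maybe as Maybe
open import Data.Maybe.Properties using (just-injective; ≡-dec)
open import Data.Product using (∃; ∃-syntax; _×_; _,_; proj₁; proj₂)
import Data.Product.Properties as Productₚ
open import Data.Sum using (_⊎_; inj₁; inj₂; [_,_])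
import Data.Sum.Properties as Sumₚ
open import Data.Unit using (⊤; tt)
open import Data.Empty using (⊥; ⊥-elim)
open import Relation.Nullary using (¬_; Dec)
open import Relation.Nullary.Decidable using (map′; _×-dec_; ¬?; decidable-stable; from-yes)
open import Relation.Binary.Definitions using (DecidableEquality)
open import Relation.Binary.PropositionalEquality using (_≢_; refl; sym; trans; cong; cong₂; subst; subst₂; isEquivalence; module ≡-Reasoning)
open import Algebra.Bundles using (CommutativeMonoid)
open import Algebra.Structures using (IsCommutativeRing)

-- Counting without repetition, up to an equivalence

module Counting where

  mkCount : {A : Set} (_~_ : A → A → Set) {P : A → Set} {n : ℕ} (f : Fin n → A) →
    (∀ i → P (f i)) → (∀ i j → f i ~ f j → i ≡ j) → (∀ a → P a → ∃[ i ] (a ~ f i)) → CountIs _~_ P n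
  mkCount _~_ {P} f Pf inj surj =
    tabulate f ,
    (λ i → subst P (sym (lookup∘tabulate f i)) (Pf i)) ,
    (λ i j p → inj i j (subst₂ _~_ (lookup∘tabulate f i) (lookup∘tabulate f j) p)) ,
    (λ a Pa → let i , p = surj a Pa in i , subst (a ~_) (sym (lookup∘tabulate f i)) p)

  module Count {A : Set} {_~_ : A → A → Set} {P : A → Set} {n : ℕ} (c : CountIs _~_ P n) where
    elem : Fin n → A
    elem = lookup (proj₁ c)
    valid : ∀ i → P (elem i)
    valid = proj₁ (proj₂ c)
    injective : ∀ i j → elem i ~ elem j → i ≡ j
    injective = proj₁ (proj₂ (proj₂ c))
    index : ∀ a → P a → Fin n
    index a Pa = proj₁ (proj₂ (proj₂ (proj₂ c)) a Pa)
    elem-index : ∀ a Pa → a ~ elem (index a Pa)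
    elem-index a Pa = proj₂ (proj₂ (proj₂ (proj₂ c)) a Pa)

  module Count≡ {A : Set} {P : A → Set} {n : ℕ} (c : CountIs _≡_ P n) = Count {_~_ = _≡_} {P} c

  count-map : {A B : Set} {P : A → Set} (_~_ : B → B → Set) {Q : B → Set} {n : ℕ} →
    CountIs _≡_ P n → (f : A → B) → (∀ a → P a → Q (f a)) →
    (∀ a a′ → P a → P a′ → f a ~ f a′ → a ≡ a′) →
    (∀ b → Q b → ∃[ a ] (P a × b ~ f a)) → CountIs _~_ Q n
  count-map _~_ c f f-valid f-inj f-surj =
    mkCount _~_ (λ i → f (elem i)) (λ i → f-valid _ (valid i))
      (λ i j p → injective i j (f-inj _ _ (valid i) (valid j) p))
      (λ b Qb → let a , Pa , b~fa = f-surj b Qb in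
        index a Pa , subst (λ a → b ~ f a) (elem-index a Pa) b~fa)
    where open Count≡ c

  count-cong : {A : Set} {P Q : A → Set} {n : ℕ} →
    CountIs _≡_ P n → (∀ a → P a → Q a) → (∀ a → Q a → P a) → CountIs _≡_ Q n
  count-cong (v , valid , inj , surj) P⇒Q Q⇒P =
    v , (λ i → P⇒Q _ (valid i)) , inj , λ a Qa → surj a (Q⇒P a Qa)

  count-⊎ : {A B : Set} {P : A → Set} {Q : B → Set} {m n : ℕ} →
    CountIs _≡_ P m → CountIs _≡_ Q n → CountIs _≡_ [ P , Q ] (m ℕ.+ n)
  count-⊎ {A} {B} {P} {Q} {m} {n} c d = mkCount _≡_ (λ k → f (splitAt m k)) (λ k → f-valid (splitAt m k))
    (λ i j p → splitAt-injective i j (f-inj _ _ p)) f-surj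
    where
    module C = Count≡ c
    module D = Count≡ d
    f : Fin m ⊎ Fin n → A ⊎ B
    f (inj₁ i) = inj₁ (C.elem i)
    f (inj₂ j) = inj₂ (D.elem j)
    f-valid : ∀ k → [ P , Q ] (f k)
    f-valid (inj₁ i) = C.valid i
    f-valid (inj₂ j) = D.valid j
    f-inj : ∀ k l → f k ≡ f l → k ≡ l
    f-inj (inj₁ i) (inj₁ j) p = cong inj₁ (C.injective i j (Sumₚ.inj₁-injective p))
    f-inj (inj₂ i) (inj₂ j) p = cong inj₂ (D.injective i j (Sumₚ.inj₂-injective p))
    splitAt-injective : ∀ i j → splitAt m i ≡ splitAt m j → i ≡ j
    splitAt-injective i j p = trans (sym (Finₚ.join-splitAt m n i)) (trans (cong (join m n) p) (Finₚ.join-splitAt m n j))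
    f-surj : ∀ a → [ P , Q ] a → ∃[ k ] (a ≡ f (splitAt m k))
    f-surj (inj₁ a) Pa = C.index a Pa ↑ˡ n ,
      trans (cong inj₁ (C.elem-index a Pa)) (cong f (sym (Finₚ.splitAt-↑ˡ m (C.index a Pa) n)))
    f-surj (inj₂ b) Qb = m ↑ʳ D.index b Qb ,
      trans (cong inj₂ (D.elem-index b Qb)) (cong f (sym (Finₚ.splitAt-↑ʳ m n (D.index b Qb))))

  -- The fibres may depend on the base point, as long as they only depend on it up to _≈_.
  count-Σ : {A B : Set} (_≈_ : A → A → Set) (_~_ : B → B → Set) {P : A → Set} {Q : A → B → Set} {m n : ℕ} →
    CountIs _≈_ P m → (∀ a → P a → CountIs _~_ (Q a) n) →
    (∀ a a′ b → a ≈ a′ → Q a b → Q a′ b) →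
    CountIs (λ x y → proj₁ x ≈ proj₁ y × proj₂ x ~ proj₂ y) (λ x → P (proj₁ x) × Q (proj₁ x) (proj₂ x)) (m ℕ.* n)
  count-Σ {A} {B} _≈_ _~_ {P} {Q} {m} {n} c d Q-resp =
    mkCount _≋_ (λ k → f (proj₁ (remQuot n k)) (proj₂ (remQuot {m} n k)))
      (λ k → C.valid _ , D.valid _ _)
      (λ k l p → let e , e′ = f-inj _ _ _ _ p in
        trans (sym (Finₚ.combine-remQuot {m} n k))
          (trans (cong₂ combine e e′) (Finₚ.combine-remQuot {m} n l)))
      f-surj
    where
    module C = Count {_~_ = _≈_} c
    module D (i : Fin m) = Count {_~_ = _~_} {P = Q (C.elem i)} (d (C.elem i) (C.valid i))
    f : Fin m → Fin n → A × B
    f i j = C.elem i , D.elem i j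
    _≋_ : A × B → A × B → Set
    x ≋ y = proj₁ x ≈ proj₁ y × proj₂ x ~ proj₂ y
    f-inj : ∀ i i′ j j′ → f i j ≋ f i′ j′ → i ≡ i′ × j ≡ j′
    f-inj i i′ j j′ (p , q) with C.injective i i′ p
    ... | refl = refl , D.injective i j j′ q
    f-surj : ∀ x → P (proj₁ x) × Q (proj₁ x) (proj₂ x) →
      ∃[ k ] (x ≋ f (proj₁ (remQuot {m} n k)) (proj₂ (remQuot {m} n k)))
    f-surj (a , b) (Pa , Qab) = combine i j ,
      subst (λ k → (a , b) ≋ f (proj₁ k) (proj₂ k)) (sym (Finₚ.remQuot-combine i j))
        (C.elem-index a Pa , D.elem-index i b Qib)
      where
      i = C.index a Pa
      Qib = Q-resp _ _ b (C.elem-index a Pa) Qab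
      j = D.index i b Qib

  count-× : {A B : Set} {P : A → Set} {Q : A → B → Set} {m n : ℕ} →
    CountIs _≡_ P m → (∀ a → P a → CountIs _≡_ (Q a) n) →
    CountIs _≡_ (λ x → P (proj₁ x) × Q (proj₁ x) (proj₂ x)) (m ℕ.* n)
  count-× {P = P} {Q} c d =
    mkCount _≡_ elem valid (λ i j p → injective i j (cong proj₁ p , cong proj₂ p))
      (λ x Px → index x Px , cong₂ _,_ (proj₁ (elem-index x Px)) (proj₂ (elem-index x Px)))
    where open Count {_~_ = λ x y → proj₁ x ≡ proj₁ y × proj₂ x ≡ proj₂ y} {P = λ x → P (proj₁ x) × Q (proj₁ x) (proj₂ x)} (count-Σ _≡_ _≡_ {P = P} {Q} c d (λ a a′ b p → subst (λ a → Q a b) p))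

  count-≤ : {A B : Set} {P : A → Set} {Q : B → Set} {m n : ℕ} → CountIs _≡_ P m → CountIs _≡_ Q n →
    (f : A → B) → (∀ a → P a → Q (f a)) → (∀ a a′ → P a → P a′ → f a ≡ f a′ → a ≡ a′) → m ℕ.≤ n
  count-≤ {m = m} {n} c d f f-valid f-inj = Finₚ.injective⇒≤ {f = g} g-inj
    where
    module C = Count≡ c
    module D = Count≡ d
    g : Fin m → Fin n
    g i = D.index (f (C.elem i)) (f-valid _ (C.valid i))
    g-inj : ∀ {i j} → g i ≡ g j → i ≡ j
    g-inj {i} {j} p = C.injective i j (f-inj _ _ (C.valid i) (C.valid j)
      (trans (D.elem-index _ _) (trans (cong D.elem p) (sym (D.elem-index _ _)))))

  count-singleton : {A : Set} (a : A) → CountIs _≡_ (_≡ a) 1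
  count-singleton a = mkCount _≡_ (λ _ → a) (λ _ → refl) (λ i j _ → only i j) (λ b p → zero , p)
    where
    only : (i j : Fin 1) → i ≡ j
    only zero zero = refl

  count-remove : {A : Set} {P : A → Set} {n : ℕ} → CountIs _≡_ P (suc n) → ∀ a → P a →
    CountIs _≡_ (λ b → P b × b ≢ a) n
  count-remove {n = n} c a Pa =
    mkCount _≡_ (λ j → elem (punchIn i j))
      (λ j → valid _ , λ p → Finₚ.punchInᵢ≢i i j (injective _ _ (trans p (elem-index a Pa))))
      (λ j k p → Finₚ.punchIn-injective i j k (injective _ _ p))
      (λ b (Pb , b≢a) → let i≢ = λ p → b≢a (trans (elem-index b Pb) (trans (cong elem (sym p)) (sym (elem-index a Pa)))) in
        punchOut {i = i} {j = index b Pb} i≢ ,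
        trans (elem-index b Pb) (cong elem (sym (Finₚ.punchIn-punchOut i≢))))
    where
    open Count≡ c
    i = index a Pa

  ⊤-≟ : {A : Set} {n : ℕ} → CountIs {A} _≡_ (λ _ → ⊤) n → DecidableEquality A
  ⊤-≟ c x y = map′ (λ p → trans (elem-index x tt) (trans (cong elem p) (sym (elem-index y tt))))
    (λ { refl → refl }) (index x tt Fin.≟ index y tt)
    where open Count≡ {P = λ _ → ⊤} c

  search : {A : Set} {n : ℕ} → CountIs {A} _≡_ (λ _ → ⊤) n → {R : A → Set} → (∀ a → Dec (R a)) → Dec (∃ R)
  search c {R} R? = map′ (λ (i , r) → elem i , r) (λ (a , r) → index a tt , subst R (elem-index a tt) r)
    (Finₚ.any? (λ i → R? (elem i)))
    where open Count≡ {P = λ _ → ⊤} c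

  module _ {A : Set} (_≟_ : DecidableEquality A) where

    -- Induction on the enumeration of `Q`, deleting its head from both sides. The inclusion keeps
    -- the truncated subtraction exact.
    count-∖ : {P Q : A → Set} {m n : ℕ} → CountIs _≡_ P m → CountIs _≡_ Q n → (∀ a → Q a → P a) →
      CountIs _≡_ (λ a → P a × ¬ Q a) (m ∸ n)
    count-∖ {P} {Q} {m} {zero} c d Q⇒P =
      count-cong c (λ a Pa → Pa , λ Qa → Finₚ.¬Fin0 (Count≡.index d a Qa)) (λ a → proj₁)
    count-∖ {P} {Q} {zero} {suc n} c d Q⇒P = ⊥-elim (Finₚ.¬Fin0 (Count≡.index c _ (Q⇒P _ (Count≡.valid d zero))))
    count-∖ {P} {Q} {suc m} {suc n} c d Q⇒P =
      count-cong (count-∖ (count-remove c a Pa) (count-remove d a Qa) (λ b (Qb , b≢a) → Q⇒P b Qb , b≢a))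
        (λ b ((Pb , b≢a) , ¬Q) → Pb , λ Qb → ¬Q (Qb , b≢a))
        (λ b (Pb , ¬Qb) → (Pb , λ { refl → ¬Qb Qa }) , λ (Qb , _) → ¬Qb Qb)
      where
      a  = Count≡.elem d zero
      Qa = Count≡.valid d zero
      Pa = Q⇒P a Qa

    count-∪ : {P Q : A → Set} {m n : ℕ} → CountIs _≡_ P m → CountIs _≡_ Q n → (∀ a → P a → ¬ Q a) →
      CountIs _≡_ (λ a → P a ⊎ Q a) (m ℕ.+ n)
    count-∪ {P} {Q} c d disjoint = count-map _≡_ (count-⊎ c d) f f-valid f-inj f-surj
      where
      f : A ⊎ A → A
      f = [ (λ a → a) , (λ a → a) ]
      f-valid : ∀ x → [ P , Q ] x → P (f x) ⊎ Q (f x)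
      f-valid (inj₁ a) p = inj₁ p
      f-valid (inj₂ a) p = inj₂ p
      f-inj : ∀ x y → [ P , Q ] x → [ P , Q ] y → f x ≡ f y → x ≡ y
      f-inj (inj₁ a) (inj₁ b) p q refl = refl
      f-inj (inj₁ a) (inj₂ b) p q refl = ⊥-elim (disjoint a p q)
      f-inj (inj₂ a) (inj₁ b) p q refl = ⊥-elim (disjoint a q p)
      f-inj (inj₂ a) (inj₂ b) p q refl = refl
      f-surj : ∀ a → P a ⊎ Q a → ∃[ x ] ([ P , Q ] x × a ≡ f x)
      f-surj a (inj₁ p) = inj₁ a , p , refl
      f-surj a (inj₂ q) = inj₂ a , q , refl

    -- The size stays existential: it is wanted only for the weakly decreasing pairs, whose number
    -- cancels in the end.
    count-filter : {P Q : A → Set} {n : ℕ} → CountIs _≡_ P n → (∀ a → Dec (Q a)) →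
      ∃[ k ] CountIs _≡_ (λ a → P a × Q a) k
    count-filter {n = zero} c Q? = 0 , count-cong c (λ a Pa → ⊥-elim (Finₚ.¬Fin0 (Count≡.index c a Pa))) (λ a → proj₁)
    count-filter {P} {Q} {suc n} c Q? with count-filter (count-remove c (Count≡.elem c zero) (Count≡.valid c zero)) Q? | Q? (Count≡.elem c zero)
    ... | k , d | no ¬q = k , count-cong d (λ a ((Pa , _) , Qa) → Pa , Qa)
          (λ a (Pa , Qa) → (Pa , λ { refl → ¬q Qa }) , Qa)
    ... | k , d | yes q = suc k , count-cong (count-∪ (count-singleton (Count≡.elem c zero)) d (λ { a p ((_ , a≢) , _) → a≢ p }))
          (λ { a (inj₁ refl) → Count≡.valid c zero , q ; a (inj₂ ((Pa , _) , Qa)) → Pa , Qa }) back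
      where
      back : ∀ a → P a × Q a → a ≡ Count≡.elem c zero ⊎ ((P a × a ≢ Count≡.elem c zero) × Q a)
      back a (Pa , Qa) with a ≟ Count≡.elem c zero
      ... | yes p = inj₁ p
      ... | no ¬p = inj₂ ((Pa , ¬p) , Qa)

open Counting

-- Polynomial functions over an integral domain

record IntegralDomain : Set₁ where
  infixl 6 _+_
  infixl 7 _*_
  field
    Carrier : Set
    _+_ _*_ : Carrier → Carrier → Carrier
    -_      : Carrier → Carrier
    0# 1#   : Carrier
    isCommutativeRing : IsCommutativeRing (_≡_ {A = Carrier}) _+_ _*_ -_ 0# 1#
    0≢1     : ¬ (0# ≡ 1#)
    noZeroDivisors : ∀ x y → x * y ≡ 0# → x ≡ 0# ⊎ y ≡ 0#

  commutativeRing : CommutativeRing 0ℓ 0ℓ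
  commutativeRing = record { isCommutativeRing = isCommutativeRing }

  infixr 8 _^_
  _^_ : Carrier → ℕ → Carrier
  x ^ zero  = 1#
  x ^ suc n = x * (x ^ n)

module DomainProperties (D : IntegralDomain) where
  open IntegralDomain D
  open CommutativeRing commutativeRing using (+-identityˡ; +-identityʳ; *-identityˡ; *-identityʳ; zeroˡ; zeroʳ; -‿inverseʳ; -‿inverseˡ; +-comm; *-comm; +-assoc; *-assoc)
  open IntegerSolver commutativeRing using (solve; _:=_; _:+_; _:*_; :-_; con; _:-_)

  x-y≡0⇒x≡y : ∀ {x y} → x + (- y) ≡ 0# → x ≡ y
  x-y≡0⇒x≡y {x} {y} p = trans (solve 2 (λ x y → x := (x :+ (:- y)) :+ y) refl x y) (trans (cong (_+ y) p) (+-identityˡ y))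

  x≡y⇒x-y≡0 : ∀ {x y} → x ≡ y → x + (- y) ≡ 0#
  x≡y⇒x-y≡0 {x} refl = -‿inverseʳ x

  *≢0 : ∀ {x y} → x ≢ 0# → y ≢ 0# → x * y ≢ 0#
  *≢0 {x} {y} x≢0 y≢0 p = [ x≢0 , y≢0 ] (noZeroDivisors x y p)

  *-cancelˡ : ∀ {x y z} → x ≢ 0# → x * y ≡ x * z → y ≡ z
  *-cancelˡ {x} {y} {z} x≢0 p with noZeroDivisors x (y + (- z))
    (trans (solve 3 (λ x y z → x :* (y :+ (:- z)) := x :* y :+ (:- (x :* z))) refl x y z) (x≡y⇒x-y≡0 p))
  ... | inj₁ q = ⊥-elim (x≢0 q)
  ... | inj₂ q = x-y≡0⇒x≡y q

  square≡0 : ∀ {x} → x * x ≡ 0# → x ≡ 0#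
  square≡0 {x} p = [ (λ q → q) , (λ q → q) ] (noZeroDivisors x x p)

  ^-distrib-* : ∀ x y n → (x * y) ^ n ≡ x ^ n * y ^ n
  ^-distrib-* x y zero = sym (*-identityˡ 1#)
  ^-distrib-* x y (suc n) = trans (cong ((x * y) *_) (^-distrib-* x y n))
    (solve 4 (λ x y a b → (x :* y) :* (a :* b) := (x :* a) :* (y :* b)) refl x y (x ^ n) (y ^ n))

  ^-+ : ∀ x m n → x ^ (m ℕ.+ n) ≡ x ^ m * x ^ n
  ^-+ x zero n = sym (*-identityˡ _)
  ^-+ x (suc m) n = trans (cong (x *_) (^-+ x m n)) (sym (*-assoc x _ _))

  1^ : ∀ n → 1# ^ n ≡ 1#
  1^ zero = refl
  1^ (suc n) = trans (*-identityˡ _) (1^ n)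

  ^-* : ∀ x m n → x ^ (m ℕ.* n) ≡ (x ^ m) ^ n
  ^-* x zero n = sym (1^ n)
  ^-* x (suc m) n = trans (^-+ x n (m ℕ.* n)) (trans (cong (x ^ n *_) (^-* x m n)) (sym (^-distrib-* x (x ^ m) n)))

  -- Poly n ℓ f: the function f is given by a polynomial ℓ xⁿ + (lower order terms).
  data Poly : ℕ → Carrier → (Carrier → Carrier) → Set where
    const  : ∀ {ℓ f} → (∀ x → f x ≡ ℓ) → Poly 0 ℓ f
    horner : ∀ {n ℓ f g} k → Poly n ℓ g → (∀ x → f x ≡ x * g x + k) → Poly (suc n) ℓ f

  poly-ext : ∀ {n ℓ f g} → Poly n ℓ f → (∀ x → g x ≡ f x) → Poly n ℓ g
  poly-ext (const p) e      = const (λ x → trans (e x) (p x))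
  poly-ext (horner k p h) e = horner k p (λ x → trans (e x) (h x))

  poly-+ : ∀ {n ℓ m f g} → Poly n ℓ f → Poly n m g → Poly n (ℓ + m) (λ x → f x + g x)
  poly-+ (const p) (const q) = const (λ x → cong₂ _+_ (p x) (q x))
  poly-+ (horner {g = f} k p h) (horner {g = g} l q i) = horner (k + l) (poly-+ p q) (λ x → trans (cong₂ _+_ (h x) (i x))
    (solve 5 (λ x a k b l → (x :* a :+ k) :+ (x :* b :+ l) := x :* (a :+ b) :+ (k :+ l)) refl x (f x) k (g x) l))

  poly-scale : ∀ {n ℓ f} c → Poly n ℓ f → Poly n (c * ℓ) (λ x → c * f x)
  poly-scale c (const p) = const (λ x → cong (c *_) (p x))
  poly-scale c (horner {g = f} k p h) = horner (c * k) (poly-scale c p) (λ x → trans (cong (c *_) (h x))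
    (solve 4 (λ c x a k → c :* (x :* a :+ k) := x :* (c :* a) :+ c :* k) refl c x (f x) k))

  poly-x* : ∀ {n ℓ f} → Poly n ℓ f → Poly (suc n) ℓ (λ x → x * f x)
  poly-x* p = horner 0# p (λ x → sym (+-identityʳ _))

  poly-raise : ∀ {n ℓ f} → Poly n ℓ f → Poly (suc n) 0# f
  poly-raise {ℓ = ℓ} (const p) = horner ℓ (const {f = λ _ → 0#} (λ _ → refl)) (λ x → trans (p x) (sym (trans (cong (_+ ℓ) (zeroʳ x)) (+-identityˡ ℓ))))
  poly-raise (horner k p h) = horner k (poly-raise p) h

  poly-const : ∀ n c → Poly (suc n) 0# (λ _ → c)
  poly-const zero c = poly-raise (const (λ _ → refl))
  poly-const (suc n) c = poly-raise (poly-const n c)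

  poly-lead : ∀ {n ℓ m f} → ℓ ≡ m → Poly n ℓ f → Poly n m f
  poly-lead refl p = p

  poly-shift^ : ∀ c n → Poly n 1# (λ x → (x + c) ^ n)
  poly-shift^ c zero = const (λ x → refl)
  poly-shift^ c (suc n) = poly-lead (+-identityʳ 1#)
    (poly-ext (poly-+ (poly-x* (poly-shift^ c n)) (poly-raise (poly-scale c (poly-shift^ c n))))
      (λ x → solve 3 (λ x c y → (x :+ c) :* y := x :* y :+ c :* y) refl x c ((x + c) ^ n)))

  poly-^ : ∀ n → Poly n 1# (_^ n)
  poly-^ zero    = const (λ x → refl)
  poly-^ (suc n) = poly-x* (poly-^ n)

  -- Synthetic division on the Horner form: the inner polynomial is divided first, and its value at
  -- r becomes the constant term of the quotient.
  poly-factor : ∀ {n ℓ f} → Poly (suc n) ℓ f → ∀ r →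
    ∃[ h ] (Poly n ℓ h × (∀ x → f x ≡ (x + (- r)) * h x + f r))
  poly-factor {ℓ = ℓ} (horner k (const p) e) r = (λ _ → ℓ) , const (λ _ → refl) ,
    λ x → trans (trans (e x) (cong (λ y → x * y + k) (p x)))
      (trans (solve 4 (λ x r ℓ k → x :* ℓ :+ k := (x :+ (:- r)) :* ℓ :+ (r :* ℓ :+ k)) refl x r ℓ k)
        (cong (λ y → (x + (- r)) * ℓ + y) (sym (trans (e r) (cong (λ y → r * y + k) (p r))))))
  poly-factor {f = f} (horner {g = g} k p@(horner _ _ _) e) r with poly-factor p r
  ... | h , q , i = (λ x → x * h x + g r) , horner (g r) q (λ _ → refl) ,
    λ x → trans (trans (e x) (cong (λ y → x * y + k) (i x)))
      (trans (solve 5 (λ x r h g k → x :* ((x :+ (:- r)) :* h :+ g) :+ k := (x :+ (:- r)) :* (x :* h :+ g) :+ (r :* g :+ k)) refl x r (h x) (g r) k)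
        (cong (λ y → (x + (- r)) * (x * h x + g r) + y) (sym (e r))))

  rootProduct : ∀ {n} → (Fin n → Carrier) → Carrier → Carrier
  rootProduct {zero}  r x = 1#
  rootProduct {suc n} r x = (x + (- r zero)) * rootProduct (λ i → r (suc i)) x

  -- The scalar ℓ may be `0#`, which gives two uses: with ℓ zero, n distinct roots force the
  -- function to vanish everywhere; with ℓ one, there are no further roots.
  poly-roots : ∀ {n ℓ f} → Poly n ℓ f → (r : Fin n → Carrier) → (∀ {i j} → r i ≡ r j → i ≡ j) →
    (∀ i → f (r i) ≡ 0#) → ∀ x → f x ≡ ℓ * rootProduct r x
  poly-roots {zero} (const p) r inj root x = trans (p x) (sym (*-identityʳ _))
  poly-roots {suc n} {ℓ} {f} p@(horner _ _ _) r inj root x with poly-factor p (r zero)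
  ... | h , q , e = trans (e′ x) (trans (cong ((x + (- r zero)) *_) (poly-roots q (λ i → r (suc i)) (λ s → Finₚ.suc-injective (inj s)) h-root x))
      (solve 3 (λ a ℓ b → a :* (ℓ :* b) := ℓ :* (a :* b)) refl (x + (- r zero)) ℓ (rootProduct (λ i → r (suc i)) x)))
    where
    e′ : ∀ x → f x ≡ (x + (- r zero)) * h x
    e′ x = trans (e x) (trans (cong (λ y → (x + (- r zero)) * h x + y) (root zero)) (+-identityʳ _))
    h-root : ∀ i → h (r (suc i)) ≡ 0#
    h-root i with noZeroDivisors _ _ (trans (sym (e′ (r (suc i)))) (root (suc i)))
    ... | inj₁ s = ⊥-elim (Finₚ.0≢1+n (sym (inj (x-y≡0⇒x≡y s))))
    ... | inj₂ s = s

  rootProduct≡0 : ∀ {n} (r : Fin n → Carrier) x → rootProduct r x ≡ 0# → ∃[ i ] (x ≡ r i)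
  rootProduct≡0 {zero} r x p = ⊥-elim (0≢1 (sym p))
  rootProduct≡0 {suc n} r x p with noZeroDivisors _ _ p
  ... | inj₁ q = zero , x-y≡0⇒x≡y q
  ... | inj₂ q = let i , s = rootProduct≡0 (λ i → r (suc i)) x q in suc i , s

-- Finite fields: Fermat's theorem and the multiples of 1

module PermutedSum (M : CommutativeMonoid 0ℓ 0ℓ) where
  open CommutativeMonoid M using (_≈_; reflexive) renaming (Carrier to C; trans to ≈-trans)
  open import Algebra.Properties.CommutativeMonoid.Sum M

  -- An enumeration without repetition turns σ into a permutation of the indices. It is applied to
  -- products of nonzero elements and to sums of all elements.
  sum-bijection : {A : Set} {P : A → Set} {n : ℕ} (c : CountIs _≡_ P n) (σ τ : A → A) →
    (∀ a → P a → P (σ a)) → (∀ a → P a → P (τ a)) → (∀ a → σ (τ a) ≡ a) → (∀ a → τ (σ a) ≡ a) → (h : A → C) →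
    sum (λ i → h (Count≡.elem c i)) ≈ sum (λ i → h (σ (Count≡.elem c i)))
  sum-bijection {n = n} c σ τ σP τP στ τσ h =
    ≈-trans (sum-permute (λ i → h (elem i)) π)
      (reflexive (sum-cong-≗ {n} (λ i → cong h (sym (elem-index (σ (elem i)) (σP _ (valid i)))))))
    where
    open Count≡ c
    π = permutation (λ i → index (σ (elem i)) (σP _ (valid i))) (λ i → index (τ (elem i)) (τP _ (valid i)))
      (λ i → injective _ _ (trans (sym (elem-index _ _)) (trans (cong σ (sym (elem-index _ _))) (στ _))))
      (λ i → injective _ _ (trans (sym (elem-index _ _)) (trans (cong τ (sym (elem-index _ _))) (τσ _))))

module FieldProperties {q : ℕ} (F : FiniteField q) where
  open FiniteField F

  commutativeRing : CommutativeRing 0ℓ 0ℓ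
  commutativeRing = record { isCommutativeRing = isCommutativeRing }

  open CommutativeRing commutativeRing public
    using (+-identityˡ; +-identityʳ; *-identityˡ; *-identityʳ; zeroˡ; zeroʳ; -‿inverseʳ; -‿inverseˡ; +-comm; *-comm; +-assoc; *-assoc; *-commutativeMonoid; +-commutativeMonoid)
  open IntegerSolver commutativeRing public using (solve; _:=_; _:+_; _:*_; :-_; con; _:-_; Polynomial)

  O I : ∀ {n} → Polynomial n
  O = con (+ 0)
  I = con (+ 1)

  infix 4 _≟_
  _≟_ : DecidableEquality Carrier
  _≟_ = ⊤-≟ order

  inv : ∀ {x} → x ≢ 0# → Carrier
  inv {x} x≢0 = proj₁ (inverse x x≢0)

  *-inv : ∀ {x} (x≢0 : x ≢ 0#) → x * inv x≢0 ≡ 1#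
  *-inv {x} x≢0 = proj₂ (inverse x x≢0)

  domain : IntegralDomain
  domain = record
    { isCommutativeRing = isCommutativeRing ; 0≢1 = 0≢1
    ; noZeroDivisors = noZeroDivisors }
    where
    noZeroDivisors : ∀ x y → x * y ≡ 0# → x ≡ 0# ⊎ y ≡ 0#
    noZeroDivisors x y p with x ≟ 0#
    ... | yes x≡0 = inj₁ x≡0
    ... | no x≢0 = inj₂ (trans (sym (*-identityˡ y)) (trans (cong (_* y) (sym (*-inv x≢0)))
            (trans (solve 3 (λ x i y → x :* i :* y := i :* (x :* y)) refl x (inv x≢0) y)
              (trans (cong (inv x≢0 *_) p) (zeroʳ _)))))

  open IntegralDomain domain public using (noZeroDivisors)
  open DomainProperties domain public using (x-y≡0⇒x≡y; x≡y⇒x-y≡0; *≢0; *-cancelˡ; square≡0)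
  open DomainProperties domain using (1^)

  inv≢0 : ∀ {x} (x≢0 : x ≢ 0#) → inv x≢0 ≢ 0#
  inv≢0 x≢0 p = 0≢1 (trans (sym (zeroʳ _)) (trans (cong (_ *_) (sym p)) (*-inv x≢0)))

  pow-agree : ∀ x n → IntegralDomain._^_ domain x n ≡ x ^ n
  pow-agree x zero = refl
  pow-agree x (suc n) = cong (x *_) (pow-agree x n)

  suc-pred-order : suc (q ∸ 1) ≡ q
  suc-pred-order = lemma (Count≡.index {P = λ _ → ⊤} order 0# tt)
    where
    lemma : ∀ {n} → Fin n → suc (n ∸ 1) ≡ n
    lemma {suc n} _ = refl

  count-⊤ : CountIs _≡_ (λ (_ : Carrier) → ⊤) (suc (q ∸ 1))
  count-⊤ = subst (CountIs _≡_ (λ _ → ⊤)) (sym suc-pred-order) order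

  count-≢ : ∀ a → CountIs _≡_ (λ x → x ≢ a) (q ∸ 1)
  count-≢ a = count-cong (count-remove count-⊤ a tt) (λ _ → proj₂) (λ _ p → tt , p)

  -- Multiplication by a nonzero a permutes the nonzero elements; comparing their product before and
  -- after gives a^(q-1) = 1.
  fermat : ∀ a → a ^ q ≡ a
  fermat a = subst (λ n → a ^ n ≡ a) suc-pred-order (go (a ≟ 0#))
    where
    open import Algebra.Properties.CommutativeMonoid.Sum *-commutativeMonoid
    open PermutedSum *-commutativeMonoid
    open Count≡ (count-≢ 0#)
    product≢0 : ∀ {n} (f : Fin n → Carrier) → (∀ i → f i ≢ 0#) → sum f ≢ 0#
    product≢0 {zero} f f≢0 p = 0≢1 (sym p)
    product≢0 {suc n} f f≢0 = *≢0 (f≢0 zero) (product≢0 (λ i → f (suc i)) (λ i → f≢0 (suc i)))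
    product-const : ∀ n → sum {n} (λ _ → a) ≡ a ^ n
    product-const zero = refl
    product-const (suc n) = cong (a *_) (product-const n)
    go : Dec (a ≡ 0#) → a * a ^ (q ∸ 1) ≡ a
    go (yes a≡0) = trans (cong (λ y → y * (a ^ (q ∸ 1))) a≡0) (trans (zeroˡ _) (sym a≡0))
    go (no a≢0) = trans (cong (a *_) (sym (*-cancelˡ (product≢0 elem valid) (begin
        sum elem * 1#                                  ≡⟨ *-identityʳ _ ⟩
        sum elem                                       ≡⟨ sum-bijection (count-≢ 0#) (a *_) (inv a≢0 *_)
                                                            (λ _ → *≢0 a≢0) (λ _ → *≢0 (inv≢0 a≢0))
                                                            (λ x → trans (sym (*-assoc a _ x)) (trans (cong (_* x) (*-inv a≢0)) (*-identityˡ x)))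
                                                            (λ x → trans (sym (*-assoc _ a x)) (trans (cong (_* x) (trans (*-comm _ a) (*-inv a≢0))) (*-identityˡ x)))
                                                            (λ x → x) ⟩
        sum (λ i → a * elem i)                         ≡⟨ ∑-distrib-+ (λ _ → a) elem ⟩
        sum {q ∸ 1} (λ _ → a) * sum elem               ≡⟨ cong (_* sum elem) (product-const (q ∸ 1)) ⟩
        a ^ (q ∸ 1) * sum elem                         ≡⟨ *-comm _ _ ⟩
        sum elem * a ^ (q ∸ 1)                         ∎)))) (*-identityʳ a)
      where open ≡-Reasoning

  multiple : ℕ → Carrier
  multiple zero    = 0#
  multiple (suc n) = 1# + multiple n

  -- The additive analogue of `fermat`: translation by `1#` permutes the field, so the sum of all
  -- elements does not change when q · 1 is added to it.
  multiple-order : multiple q ≡ 0#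
  multiple-order = sym (trans (sym (-‿inverseʳ (sum elem))) (trans (cong (_+ (- sum elem)) (begin
      sum elem                                  ≡⟨ sum-bijection order (λ x → 1# + x) (λ x → - 1# + x) (λ _ _ → tt) (λ _ _ → tt)
                                                     (λ x → solve 1 (λ x → con (+ 1) :+ (:- con (+ 1) :+ x) := x) refl x)
                                                     (λ x → solve 1 (λ x → :- con (+ 1) :+ (con (+ 1) :+ x) := x) refl x) (λ x → x) ⟩
      sum (λ i → 1# + elem i)                   ≡⟨ ∑-distrib-+ (λ _ → 1#) elem ⟩
      sum {q} (λ _ → 1#) + sum elem             ≡⟨ cong (_+ sum elem) (sum-const q) ⟩
      multiple q + sum elem                     ∎))
    (solve 2 (λ m s → (m :+ s) :+ (:- s) := m) refl (multiple q) (sum elem))))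
    where
    open ≡-Reasoning
    open import Algebra.Properties.CommutativeMonoid.Sum +-commutativeMonoid
    open PermutedSum +-commutativeMonoid
    open Count≡ {P = λ _ → ⊤} order
    sum-const : ∀ n → sum {n} (λ _ → 1#) ≡ multiple n
    sum-const zero = refl
    sum-const (suc n) = cong (λ y → 1# + y) (sum-const n)

-- The map x ↦ x^q and the roots of quadratics over F

record Embedding {q : ℕ} (F : FiniteField q) (D : IntegralDomain) : Set where
  module F = FiniteField F
  open IntegralDomain D
  field
    j     : F.Carrier → Carrier
    j-+   : ∀ a b → j (a F.+ b) ≡ j a + j b
    j-*   : ∀ a b → j (a F.* b) ≡ j a * j b
    j-1   : j F.1# ≡ 1#
    j-inj : ∀ {a b} → j a ≡ j b → a ≡ b

module Frobenius {q : ℕ} {F : FiniteField q} {D : IntegralDomain} (E : Embedding F D) (2≤q : 2 ℕ.≤ q) where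
  open Embedding E
  open IntegralDomain D
  open DomainProperties D
  open CommutativeRing commutativeRing using (+-identityˡ; +-identityʳ; *-identityˡ; *-identityʳ; zeroˡ; zeroʳ; -‿inverseʳ; +-comm; *-comm)
  open IntegerSolver commutativeRing using (solve; _:=_; _:+_; _:*_; :-_; con; _:-_)
  private
    module FP = FieldProperties F
    module C = Count≡ {P = λ _ → ⊤} F.order

  j-0 : j F.0# ≡ 0#
  j-0 = trans (solve 1 (λ x → x := x :+ x :+ (:- x)) refl (j F.0#))
    (trans (cong (_+ (- j F.0#)) (trans (sym (j-+ _ _)) (cong j (FP.+-identityˡ _)))) (-‿inverseʳ _))

  j-neg : ∀ a → j (F.- a) ≡ - j a
  j-neg a = trans (solve 2 (λ x y → x := (y :+ x) :+ (:- y)) refl (j (F.- a)) (j a))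
    (trans (cong (_+ (- j a)) (trans (sym (j-+ _ _)) (trans (cong j (FP.-‿inverseʳ a)) j-0))) (+-identityˡ _))

  j-^ : ∀ a n → j (a F.^ n) ≡ j a ^ n
  j-^ a zero = j-1
  j-^ a (suc n) = trans (j-* a _) (cong (j a *_) (j-^ a n))

  j-fixed : ∀ a → j a ^ q ≡ j a
  j-fixed a = trans (sym (j-^ a q)) (cong j (FP.fermat a))

  root : Fin q → Carrier
  root i = j (C.elem i)

  root-injective : ∀ {i k} → root i ≡ root k → i ≡ k
  root-injective p = C.injective _ _ (j-inj p)

  -- The leading terms cancel, so the difference has degree less than q, and by `fermat` it vanishes
  -- at the q elements of F.
  ^q-shift : ∀ x c → (x + j c) ^ q ≡ x ^ q + j c
  ^q-shift x c = x-y≡0⇒x≡y (trans (poly-roots (poly q (ℕₚ.<⇒≤ 2≤q)) root root-injective vanish x) (zeroˡ _))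
    where
    poly : ∀ n → 1 ℕ.≤ n → Poly n 0# (λ x → (x + j c) ^ n + (- (x ^ n + j c)))
    poly (suc n) _ = poly-lead (solve 0 (con (+ 1) :+ (:- con (+ 1)) :* (con (+ 1) :+ con (+ 0)) := con (+ 0)) refl)
      (poly-ext (poly-+ (poly-shift^ (j c) (suc n)) (poly-scale (- 1#) (poly-+ (poly-^ (suc n)) (poly-const n (j c)))))
        (λ x → solve 2 (λ a b → a :+ (:- b) := a :+ (:- con (+ 1)) :* b) refl ((x + j c) ^ suc n) (x ^ suc n + j c)))
    vanish : ∀ i → (root i + j c) ^ q + (- (root i ^ q + j c)) ≡ 0#
    vanish i = x≡y⇒x-y≡0 (trans (cong (_^ q) (sym (j-+ _ _))) (trans (j-fixed _)
      (trans (j-+ _ _) (cong (_+ j c) (sym (j-fixed _))))))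

  -- The q elements of F are roots of x^q - x, which is therefore the product of the x - a with a in
  -- F.
  ^q-fixed : ∀ x → x ^ q ≡ x → ∃[ a ] (j a ≡ x)
  ^q-fixed x p = let i , s = rootProduct≡0 root x product≡0 in C.elem i , sym s
    where
    poly : ∀ n → 2 ℕ.≤ n → Poly n 1# (λ x → x ^ n + (- x))
    poly (suc zero) (s≤s ())
    poly (suc (suc n)) _ = poly-lead (solve 0 (con (+ 1) :+ (:- con (+ 1)) :* con (+ 0) := con (+ 1)) refl)
      (poly-ext (poly-+ (poly-^ (suc (suc n))) (poly-scale (- 1#) (poly-x* (poly-const n 1#))))
        (λ x → solve 2 (λ y x → y :+ (:- x) := y :+ (:- con (+ 1)) :* (x :* con (+ 1))) refl (x ^ suc (suc n)) x))
    product≡0 : rootProduct root x ≡ 0#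
    product≡0 = trans (sym (*-identityˡ _)) (trans (sym (poly-roots (poly q 2≤q) root root-injective
      (λ i → x≡y⇒x-y≡0 (j-fixed _)) x)) (x≡y⇒x-y≡0 p))

  -- Frobenius permutes the two roots θ and a - θ of a quadratic with coefficients in F.
  ^q-conjugate : ∀ a b x → x * x ≡ j a * x + j b → x ^ q ≡ x ⊎ x ^ q ≡ j a + (- x)
  -- For y = x^q the product is (y² - a y) - (x² - a x). Both brackets equal b, since raising the
  -- equation of x to the q-th power fixes its coefficients.
  ^q-conjugate a b x p with noZeroDivisors (x ^ q + (- x)) (x ^ q + (- (j a + (- x))))
    (trans (solve 3 (λ y x a → (y :+ (:- x)) :* (y :+ (:- (a :+ (:- x)))) := (y :* y :+ (:- (a :* y))) :+ (:- (x :* x :+ (:- (a :* x))))) refl (x ^ q) x (j a))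
      (x≡y⇒x-y≡0 (trans (minus (trans (sym (^-distrib-* x x q)) (trans (cong (_^ q) p)
        (trans (^q-shift _ b) (cong (_+ j b) (trans (^-distrib-* _ _ q) (cong (_* x ^ q) (j-fixed a))))))))
        (sym (minus p)))))
    where
    minus : ∀ {u v w} → u ≡ v + w → u + (- v) ≡ w
    minus {u} {v} {w} e = trans (cong (_+ (- v)) e) (solve 2 (λ v w → (v :+ w) :+ (:- v) := w) refl v w)
  ... | inj₁ e = inj₁ (x-y≡0⇒x≡y e)
  ... | inj₂ e = inj₂ (x-y≡0⇒x≡y e)

  -- If x goes to a - x, then a - x goes back to x. The difference is written (-1) x + a because the
  -- power map is known to respect products and translations by elements of F.
  ^q²-fixed : ∀ a b x → x * x ≡ j a * x + j b → x ^ (q ℕ.* q) ≡ x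
  ^q²-fixed a b x p with ^q-conjugate a b x p
  ... | inj₁ e = trans (^-* x q q) (trans (cong (_^ q) e) e)
  ... | inj₂ e = begin
    x ^ (q ℕ.* q)               ≡⟨ ^-* x q q ⟩
    (x ^ q) ^ q                 ≡⟨ cong (_^ q) (trans e (solve 2 (λ a x → a :+ (:- x) := (:- con (+ 1)) :* x :+ a) refl (j a) x)) ⟩
    ((- 1#) * x + j a) ^ q      ≡⟨ ^q-shift _ a ⟩
    ((- 1#) * x) ^ q + j a      ≡⟨ cong (_+ j a) (trans (^-distrib-* _ _ q) (cong₂ _*_ -1-fixed e)) ⟩
    (- 1#) * (j a + (- x)) + j a ≡⟨ solve 2 (λ a x → (:- con (+ 1)) :* (a :+ (:- x)) :+ a := x) refl (j a) x ⟩
    x                           ∎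
    where
    open ≡-Reasoning
    -1-fixed : (- 1#) ^ q ≡ - 1#
    -1-fixed = subst (λ y → y ^ q ≡ y) (trans (j-neg _) (cong -_ j-1)) (j-fixed (F.- F.1#))

module QuadraticExtension {q : ℕ} (K : FiniteField q) (a b : FiniteField.Carrier K)
  (irreducible : ∀ x → ¬ (FiniteField._*_ K x x ≡ FiniteField._+_ K (FiniteField._*_ K a x) b)) where
  open FiniteField K
  open FieldProperties K

  infixl 6 _+′_
  infixl 7 _*′_
  -- The pair `(u , v)` stands for u + v θ, where θ² = a θ + b.
  _+′_ _*′_ : Carrier × Carrier → Carrier × Carrier → Carrier × Carrier
  (u , v) +′ (u′ , v′) = u + u′ , v + v′
  (u , v) *′ (u′ , v′) = u * u′ + b * (v * v′) , u * v′ + v * u′ + a * (v * v′)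
  -′_ : Carrier × Carrier → Carrier × Carrier
  -′ (u , v) = - u , - v

  -- The product of u + v θ with its conjugate u + v (a - θ).
  norm : Carrier × Carrier → Carrier
  norm (u , v) = u * u + a * (u * v) + - (b * (v * v))

  norm-* : ∀ x y → norm (x *′ y) ≡ norm x * norm y
  norm-* (u , v) (u′ , v′) = solve 6 (λ a b u v u′ v′ →
      let N = λ u v → u :* u :+ a :* (u :* v) :+ :- (b :* (v :* v)) in
      N (u :* u′ :+ b :* (v :* v′)) (u :* v′ :+ v :* u′ :+ a :* (v :* v′)) := N u v :* N u′ v′)
    refl a b u v u′ v′

  -- If v is nonzero, dividing the norm by v² exhibits - u / v as a root of the irreducible x² - a x
  -- - b.
  norm≡0 : ∀ x → norm x ≡ 0# → x ≡ (0# , 0#)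
  norm≡0 (u , v) p with v ≟ 0#
  ... | yes refl = cong (_, 0#) (square≡0 (trans (solve 3 (λ a b u → u :* u := u :* u :+ a :* (u :* O) :+ :- (b :* (O :* O))) refl a b u) p))
  ... | no v≢0 = ⊥-elim (irreducible (- (u * w)) (x-y≡0⇒x≡y (begin
      - (u * w) * - (u * w) + - (a * - (u * w) + b)
        ≡⟨ cong₂ (λ y z → - (u * w) * - (u * w) + - (a * - (u * y) + z)) (trans (sym (*-identityˡ w)) (cong (_* w) (sym (*-inv v≢0)))) (sym (trans (cong (b *_) one) (*-identityʳ b))) ⟩
      - (u * w) * - (u * w) + - (a * - (u * (v * w * w)) + b * (v * w * (v * w)))
        ≡⟨ solve 5 (λ a b u v w → :- (u :* w) :* :- (u :* w) :+ :- (a :* :- (u :* (v :* w :* w)) :+ b :* (v :* w :* (v :* w)))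
             := w :* w :* (u :* u :+ a :* (u :* v) :+ :- (b :* (v :* v)))) refl a b u v w ⟩
      w * w * norm (u , v)
        ≡⟨ trans (cong (w * w *_) p) (zeroʳ _) ⟩
      0# ∎)))
    where
    open ≡-Reasoning
    w = inv v≢0
    one : v * w * (v * w) ≡ 1#
    one = trans (cong₂ _*_ (*-inv v≢0) (*-inv v≢0)) (*-identityˡ _)

  -- The norm is multiplicative and vanishes only at zero, which excludes zero divisors; a domain is
  -- what the root count in `Frobenius` asks for.
  domain′ : IntegralDomain
  domain′ = record
    { Carrier = Carrier × Carrier ; _+_ = _+′_ ; _*_ = _*′_ ; -_ = -′_ ; 0# = 0# , 0# ; 1# = 1# , 0#
    ; isCommutativeRing = record
      { isRing = record
        { +-isAbelianGroup = record
          { isGroup = record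
            { isMonoid = record
              { isSemigroup = record
                { isMagma = record { isEquivalence = isEquivalence ; ∙-cong = cong₂ _+′_ }
                ; assoc = λ x y z → cong₂ _,_ (+-assoc _ _ _) (+-assoc _ _ _) }
              ; identity = (λ x → cong₂ _,_ (+-identityˡ _) (+-identityˡ _)) , (λ x → cong₂ _,_ (+-identityʳ _) (+-identityʳ _)) }
            ; inverse = (λ x → cong₂ _,_ (-‿inverseˡ _) (-‿inverseˡ _)) , (λ x → cong₂ _,_ (-‿inverseʳ _) (-‿inverseʳ _))
            ; ⁻¹-cong = cong -′_ }
          ; comm = λ x y → cong₂ _,_ (+-comm _ _) (+-comm _ _) }
        ; *-cong = cong₂ _*′_
        ; *-assoc = λ x y z → cong₂ _,_
            (solve 8 (λ a b u v u′ v′ u″ v″ → (u :* u′ :+ b :* (v :* v′)) :* u″ :+ b :* ((u :* v′ :+ v :* u′ :+ a :* (v :* v′)) :* v″)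
              := u :* (u′ :* u″ :+ b :* (v′ :* v″)) :+ b :* (v :* (u′ :* v″ :+ v′ :* u″ :+ a :* (v′ :* v″)))) refl
              a b (proj₁ x) (proj₂ x) (proj₁ y) (proj₂ y) (proj₁ z) (proj₂ z))
            (solve 8 (λ a b u v u′ v′ u″ v″ →
              (u :* u′ :+ b :* (v :* v′)) :* v″ :+ (u :* v′ :+ v :* u′ :+ a :* (v :* v′)) :* u″ :+ a :* ((u :* v′ :+ v :* u′ :+ a :* (v :* v′)) :* v″)
              := u :* (u′ :* v″ :+ v′ :* u″ :+ a :* (v′ :* v″)) :+ v :* (u′ :* u″ :+ b :* (v′ :* v″)) :+ a :* (v :* (u′ :* v″ :+ v′ :* u″ :+ a :* (v′ :* v″)))) refl
              a b (proj₁ x) (proj₂ x) (proj₁ y) (proj₂ y) (proj₁ z) (proj₂ z))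
        ; *-identity = (λ x → cong₂ _,_
              (solve 3 (λ b u v → I :* u :+ b :* (O :* v) := u) refl b (proj₁ x) (proj₂ x))
              (solve 3 (λ a u v → I :* v :+ O :* u :+ a :* (O :* v) := v) refl a (proj₁ x) (proj₂ x)))
          , (λ x → cong₂ _,_
              (solve 3 (λ b u v → u :* I :+ b :* (v :* O) := u) refl b (proj₁ x) (proj₂ x))
              (solve 3 (λ a u v → u :* O :+ v :* I :+ a :* (v :* O) := v) refl a (proj₁ x) (proj₂ x)))
        ; distrib = (λ x y z → cong₂ _,_
              (solve 7 (λ b u v u′ v′ u″ v″ → u :* (u′ :+ u″) :+ b :* (v :* (v′ :+ v″)) := (u :* u′ :+ b :* (v :* v′)) :+ (u :* u″ :+ b :* (v :* v″))) refl
                b (proj₁ x) (proj₂ x) (proj₁ y) (proj₂ y) (proj₁ z) (proj₂ z))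
              (solve 7 (λ a u v u′ v′ u″ v″ → u :* (v′ :+ v″) :+ v :* (u′ :+ u″) :+ a :* (v :* (v′ :+ v″))
                := (u :* v′ :+ v :* u′ :+ a :* (v :* v′)) :+ (u :* v″ :+ v :* u″ :+ a :* (v :* v″))) refl
                a (proj₁ x) (proj₂ x) (proj₁ y) (proj₂ y) (proj₁ z) (proj₂ z)))
          , (λ z x y → cong₂ _,_
              (solve 7 (λ b u v u′ v′ u″ v″ → (u′ :+ u″) :* u :+ b :* ((v′ :+ v″) :* v) := (u′ :* u :+ b :* (v′ :* v)) :+ (u″ :* u :+ b :* (v″ :* v))) refl
                b (proj₁ z) (proj₂ z) (proj₁ x) (proj₂ x) (proj₁ y) (proj₂ y))
              (solve 7 (λ a u v u′ v′ u″ v″ → (u′ :+ u″) :* v :+ (v′ :+ v″) :* u :+ a :* ((v′ :+ v″) :* v)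
                := (u′ :* v :+ v′ :* u :+ a :* (v′ :* v)) :+ (u″ :* v :+ v″ :* u :+ a :* (v″ :* v))) refl
                a (proj₁ z) (proj₂ z) (proj₁ x) (proj₂ x) (proj₁ y) (proj₂ y))) }
      ; *-comm = λ x y → cong₂ _,_
          (solve 5 (λ b u v u′ v′ → u :* u′ :+ b :* (v :* v′) := u′ :* u :+ b :* (v′ :* v)) refl b (proj₁ x) (proj₂ x) (proj₁ y) (proj₂ y))
          (solve 5 (λ a u v u′ v′ → u :* v′ :+ v :* u′ :+ a :* (v :* v′) := u′ :* v :+ v′ :* u :+ a :* (v′ :* v)) refl a (proj₁ x) (proj₂ x) (proj₁ y) (proj₂ y)) }
    ; 0≢1 = λ p → 0≢1 (cong proj₁ p)
    ; noZeroDivisors = λ x y p → [ (λ e → inj₁ (norm≡0 x e)) , (λ e → inj₂ (norm≡0 y e)) ]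
        (noZeroDivisors _ _ (trans (sym (norm-* x y)) (trans (cong norm p)
          (solve 2 (λ a b → O :* O :+ a :* (O :* O) :+ :- (b :* (O :* O)) := O) refl a b)))) }

  embedding : Embedding K domain′
  embedding = record
    { j = λ x → x , 0#
    ; j-+ = λ x y → cong (x + y ,_) (sym (+-identityˡ 0#))
    ; j-* = λ x y → cong₂ _,_ (solve 3 (λ b x y → x :* y := x :* y :+ b :* (O :* O)) refl b x y)
        (solve 3 (λ a x y → O := x :* O :+ O :* y :+ a :* (O :* O)) refl a x y)
    ; j-1 = refl
    ; j-inj = cong proj₁ }

module QuadExtProperties {q : ℕ} (2≤q : 2 ℕ.≤ q) {F : FiniteField q} (E : QuadExt F) where
  open QuadExt E
  private
    module FP = FieldProperties F
    module KP = FieldProperties K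

  2≤q² : 2 ℕ.≤ q ℕ.* q
  2≤q² = ℕₚ.≤-trans 2≤q (ℕₚ.m≤m*n q q {{ℕ.>-nonZero (ℕₚ.<-trans (s≤s z≤n) 2≤q)}})

  ι-embedding : Embedding F KP.domain
  ι-embedding = record { j = ι ; j-+ = ι-+ ; j-* = ι-* ; j-1 = ι-1 ; j-inj = ι-inj _ _ }

  module Frob = Frobenius ι-embedding 2≤q
  open Frob public using () renaming (j-0 to ι-0; j-neg to ι-neg)

  irrational⇒^q≢ : ∀ s → Irrational s → s K.^ q ≢ s
  irrational⇒^q≢ s irr p = irr (Frob.^q-fixed s (trans (KP.pow-agree s q) p))

  irrational⇒conjugate : ∀ a b s → Irrational s → s K.* s ≡ ι a K.* s K.+ ι b → s K.^ q ≡ ι a K.+ (K.- s)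
  irrational⇒conjugate a b s irr p with Frob.^q-conjugate a b s p
  ... | inj₁ e = ⊥-elim (irrational⇒^q≢ s irr (trans (sym (KP.pow-agree s q)) e))
  ... | inj₂ e = trans (sym (KP.pow-agree s q)) e

  -- If x² - a x - b had no root in K, then K together with a root θ in the quadratic
  -- extension of K would be more than q² fixed points of x ↦ x^(q²).
  quadratic-root : ∀ a b → ∃[ s ] (s K.* s ≡ ι a K.* s K.+ ι b)
  quadratic-root a b with search K.order (λ s → s K.* s KP.≟ ι a K.* s K.+ ι b)
  ... | yes r = r
  ... | no none = ⊥-elim (K.0≢1 (cong proj₂ (proj₂ fixed)))
    where
    module L = QuadraticExtension K (ι a) (ι b) (λ x p → none (x , p))
    module D = IntegralDomain L.domain′
    ι′ : Embedding F L.domain′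
    ι′ = record
      { j = λ x → ι x , K.0#
      ; j-+ = λ x y → trans (cong (_, K.0#) (ι-+ x y)) (Embedding.j-+ L.embedding _ _)
      ; j-* = λ x y → trans (cong (_, K.0#) (ι-* x y)) (Embedding.j-* L.embedding _ _)
      ; j-1 = cong (_, K.0#) ι-1
      ; j-inj = λ p → ι-inj _ _ (cong proj₁ p) }
    θ : D.Carrier
    θ = K.0# , K.1#
    open KP using (solve; _:=_; _:+_; _:*_; :-_; O; I)
    θ²≡aθ+b : θ D.* θ ≡ (ι a , K.0#) D.* θ D.+ (ι b , K.0#)
    θ²≡aθ+b = cong₂ _,_
      (solve 2 (λ a b → O :* O :+ b :* (I :* I) := a :* O :+ b :* (O :* I) :+ b) refl (ι a) (ι b))
      (solve 1 (λ a → O :* I :+ I :* O :+ a :* (I :* I)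
        := a :* I :+ O :* O :+ a :* (O :* I) :+ O) refl (ι a))
    fixed : ∃[ k ] ((k , K.0#) ≡ θ)
    fixed = Frobenius.^q-fixed L.embedding 2≤q² θ (Frobenius.^q²-fixed ι′ 2≤q a b θ θ²≡aθ+b)

-- Linear algebra in V4 and binary cubic forms

-- Points of the projective line are homogeneous pairs. A covector on V4 is a binary cubic form, evaluated at w by
-- pairing with cub w. The construction is generic so that it also applies to solver polynomials.
module Forms (A : Set) (_+_ _*_ : A → A → A) (-_ : A → A) (one : A) where
  infixl 6 _⊞_
  infixl 7 _⊠_
  _⊞_ _⊠_ : A → A → A
  _⊞_ = _+_
  _⊠_ = _*_

  three : A
  three = one ⊞ one ⊞ one

  cube : A → A
  cube x = x ⊠ x ⊠ x

  cross : A × A → A × A → A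
  cross (x , y) (z , w) = x ⊠ w ⊞ (- (y ⊠ z))

  dot : A × A × A × A → A × A × A × A → A
  dot (a₀ , a₁ , a₂ , a₃) (b₀ , b₁ , b₂ , b₃) = a₀ ⊠ b₀ ⊞ a₁ ⊠ b₁ ⊞ a₂ ⊠ b₂ ⊞ a₃ ⊠ b₃

  cub : A × A → A × A × A × A
  cub (x , y) = x ⊠ x ⊠ x , x ⊠ x ⊠ y , x ⊠ y ⊠ y , y ⊠ y ⊠ y

  osc : A × A → A × A × A × A
  osc (x , y) = y ⊠ y ⊠ y , (- (three ⊠ (x ⊠ y ⊠ y))) , three ⊠ (x ⊠ x ⊠ y) , (- (x ⊠ x ⊠ x))

  -- the form w ↦ (w × p)² (w × r)
  dbl : A × A → A × A → A × A × A × A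
  dbl (x , y) (z , w) =
    y ⊠ y ⊠ w , (- (x ⊠ y ⊠ w ⊞ y ⊠ x ⊠ w ⊞ y ⊠ y ⊠ z)) , x ⊠ x ⊠ w ⊞ x ⊠ y ⊠ z ⊞ y ⊠ x ⊠ z , (- (x ⊠ x ⊠ z))

  -- derivative of cub at the first argument in the direction of the second
  tan : A × A → A × A → A × A × A × A
  tan (x , y) (z , w) =
    three ⊠ (x ⊠ x ⊠ z) , x ⊠ y ⊠ z ⊞ x ⊠ y ⊠ z ⊞ x ⊠ x ⊠ w , x ⊠ y ⊠ w ⊞ x ⊠ y ⊠ w ⊞ y ⊠ y ⊠ z , three ⊠ (y ⊠ y ⊠ w)

module Geometry {q : ℕ} (F : FiniteField q) where
  open FiniteField F
  open FieldProperties F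
  private
    module Form = Forms Carrier _+_ _*_ -_ 1#
  open Form using (cube) public

  -- Opaque, so that later arguments rest on identities between forms and not on expanded
  -- coordinates.
  opaque
    cross : Carrier × Carrier → Carrier × Carrier → Carrier
    cross = Form.cross

    cub osc : Carrier × Carrier → V4
    cub = Form.cub
    osc = Form.osc

    dbl tan : Carrier × Carrier → Carrier × Carrier → V4
    dbl = Form.dbl
    tan = Form.tan

  private
    module S {n} = Forms (Polynomial n) _:+_ _:*_ :-_ I

  ≡V4 : ∀ {a₀ a₁ a₂ a₃ b₀ b₁ b₂ b₃ : Carrier} → a₀ ≡ b₀ → a₁ ≡ b₁ → a₂ ≡ b₂ → a₃ ≡ b₃ →
    (a₀ , a₁ , a₂ , a₃) ≡ (b₀ , b₁ , b₂ , b₃)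
  ≡V4 refl refl refl refl = refl

  zero-sum : ∀ {x y} → x ≡ 0# → y ≡ 0# → x + y ≡ 0#
  zero-sum refl refl = +-identityˡ 0#

  *-zeroʳ : ∀ x {y} → y ≡ 0# → x * y ≡ 0#
  *-zeroʳ x refl = zeroʳ x

  *-zeroˡ : ∀ {x} y → x ≡ 0# → x * y ≡ 0#
  *-zeroˡ y refl = zeroˡ y

  comb0 : ∀ {x y} a b → x ≡ 0# → y ≡ 0# → a * x + b * y ≡ 0#
  comb0 a b p q = zero-sum (*-zeroʳ a p) (*-zeroʳ b q)

  zero⇒ : ∀ {x y} → x ≢ 0# → x * y ≡ 0# → y ≡ 0#
  zero⇒ {x} {y} x≢0 p = [ (λ e → ⊥-elim (x≢0 e)) , (λ e → e) ] (noZeroDivisors x y p)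

  zero⇒ˡ : ∀ {x y} → y ≢ 0# → x * y ≡ 0# → x ≡ 0#
  zero⇒ˡ {x} {y} y≢0 p = zero⇒ y≢0 (trans (*-comm y x) p)

  cube≢0 : ∀ {x} → x ≢ 0# → cube x ≢ 0#
  cube≢0 x≢0 = *≢0 (*≢0 x≢0 x≢0) x≢0

  cube≡0 : ∀ {x} → cube x ≡ 0# → x ≡ 0#
  cube≡0 {x} p = [ square≡0 , (λ e → e) ] (noZeroDivisors _ _ p)

  ·-comm : ∀ c x → c · x ≡ x · c
  ·-comm (a , b , c , d) (x , y , z , w) =
    cong₂ _+_ (cong₂ _+_ (cong₂ _+_ (*-comm a x) (*-comm b y)) (*-comm c z)) (*-comm d w)

  ·-⊙ : ∀ k c x → (k ⊙ c) · x ≡ k * (c · x)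
  ·-⊙ k (a , b , c , d) (x , y , z , w) = trans
    (cong₂ _+_ (cong₂ _+_ (cong₂ _+_ (*-assoc k a x) (*-assoc k b y)) (*-assoc k c z)) (*-assoc k d w))
    (solve 5 (λ k x y z w → k :* x :+ k :* y :+ k :* z :+ k :* w := k :* (x :+ y :+ z :+ w)) refl k (a * x) (b * y) (c * z) (d * w))

  ·-comb : ∀ c a b u v → c · ((a ⊙ u) ⊕ (b ⊙ v)) ≡ a * (c · u) + b * (c · v)
  ·-comb (c₀ , c₁ , c₂ , c₃) a b (u₀ , u₁ , u₂ , u₃) (v₀ , v₁ , v₂ , v₃) = trans
    (cong₂ _+_ (cong₂ _+_ (cong₂ _+_ (e c₀ u₀ v₀) (e c₁ u₁ v₁)) (e c₂ u₂ v₂)) (e c₃ u₃ v₃))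
    (trans (f (a * (c₀ * u₀)) (b * (c₀ * v₀)) (a * (c₁ * u₁)) (b * (c₁ * v₁)) (a * (c₂ * u₂)) (b * (c₂ * v₂)) (a * (c₃ * u₃)) (b * (c₃ * v₃)))
      (cong₂ _+_ (g a (c₀ * u₀) (c₁ * u₁) (c₂ * u₂) (c₃ * u₃)) (g b (c₀ * v₀) (c₁ * v₁) (c₂ * v₂) (c₃ * v₃))))
    where
    e : ∀ c u v → c * (a * u + b * v) ≡ a * (c * u) + b * (c * v)
    e = λ c u v → solve 5 (λ c a b u v → c :* (a :* u :+ b :* v) := a :* (c :* u) :+ b :* (c :* v)) refl c a b u v
    f : ∀ x x′ y y′ z z′ w w′ → (x + x′) + (y + y′) + (z + z′) + (w + w′) ≡ (x + y + z + w) + (x′ + y′ + z′ + w′)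
    f = solve 8 (λ x x′ y y′ z z′ w w′ → (x :+ x′) :+ (y :+ y′) :+ (z :+ z′) :+ (w :+ w′) := (x :+ y :+ z :+ w) :+ (x′ :+ y′ :+ z′ :+ w′)) refl
    g : ∀ k x y z w → k * x + k * y + k * z + k * w ≡ k * (x + y + z + w)
    g = solve 5 (λ k x y z w → k :* x :+ k :* y :+ k :* z :+ k :* w := k :* (x :+ y :+ z :+ w)) refl

  comb-· : ∀ a b u v c → ((a ⊙ u) ⊕ (b ⊙ v)) · c ≡ a * (u · c) + b * (v · c)
  comb-· a b u v c = trans (·-comm _ c) (trans (·-comb c a b u v) (cong₂ (λ x y → a * x + b * y) (·-comm c u) (·-comm c v)))

  ·-span : ∀ c {x u v} → InSpan x u v → c · u ≡ 0# → c · v ≡ 0# → c · x ≡ 0#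
  ·-span c {u = u} {v} (a , b , refl) p q = trans (·-comb c a b u v) (comb0 a b p q)

  ·-zeroV : ∀ c → c · zeroV ≡ 0#
  ·-zeroV (c₀ , c₁ , c₂ , c₃) = solve 4 (λ a b c d → S.dot (a , b , c , d) (O , O , O , O) := O) refl c₀ c₁ c₂ c₃

  ·-nondegenerate : ∀ c d → (∀ x → c · x ≡ d · x) → c ≡ d
  ·-nondegenerate (a , b , c , d) (a′ , b′ , c′ , d′) e = ≡V4
    (trans (sym (e₀ a b c d)) (trans (e (1# , 0# , 0# , 0#)) (e₀ a′ b′ c′ d′)))
    (trans (sym (e₁ a b c d)) (trans (e (0# , 1# , 0# , 0#)) (e₁ a′ b′ c′ d′)))
    (trans (sym (e₂ a b c d)) (trans (e (0# , 0# , 1# , 0#)) (e₂ a′ b′ c′ d′)))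
    (trans (sym (e₃ a b c d)) (trans (e (0# , 0# , 0# , 1#)) (e₃ a′ b′ c′ d′)))
    where
    e₀ : ∀ a b c d → a * 1# + b * 0# + c * 0# + d * 0# ≡ a
    e₀ = solve 4 (λ a b c d → a :* I :+ b :* O :+ c :* O :+ d :* O := a) refl
    e₁ : ∀ a b c d → a * 0# + b * 1# + c * 0# + d * 0# ≡ b
    e₁ = solve 4 (λ a b c d → a :* O :+ b :* I :+ c :* O :+ d :* O := b) refl
    e₂ : ∀ a b c d → a * 0# + b * 0# + c * 1# + d * 0# ≡ c
    e₂ = solve 4 (λ a b c d → a :* O :+ b :* O :+ c :* I :+ d :* O := c) refl
    e₃ : ∀ a b c d → a * 0# + b * 0# + c * 0# + d * 1# ≡ d
    e₃ = solve 4 (λ a b c d → a :* O :+ b :* O :+ c :* O :+ d :* I := d) refl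

  span₁ : ∀ u v → InSpan u u v
  span₁ (a , b , c , d) (x , y , z , w) = 1# , 0# , ≡V4 (e a x) (e b y) (e c z) (e d w)
    where
    e : ∀ a b → a ≡ 1# * a + 0# * b
    e = solve 2 (λ a b → a := I :* a :+ O :* b) refl

  span-trans : ∀ {x u v u′ v′} → InSpan x u v → InSpan u u′ v′ → InSpan v u′ v′ → InSpan x u′ v′
  span-trans {u′ = a , b , c , d} {x , y , z , w} (α , β , refl) (γ , δ , refl) (ε , ζ , refl) =
    α * γ + β * ε , α * δ + β * ζ , ≡V4 (e a x) (e b y) (e c z) (e d w)
    where
    e : ∀ a x → α * (γ * a + δ * x) + β * (ε * a + ζ * x) ≡ (α * γ + β * ε) * a + (α * δ + β * ζ) * x
    e = λ a x → solve 8 (λ α β γ δ ε ζ a x → α :* (γ :* a :+ δ :* x) :+ β :* (ε :* a :+ ζ :* x)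
      := (α :* γ :+ β :* ε) :* a :+ (α :* δ :+ β :* ζ) :* x) refl α β γ δ ε ζ a x

  -- `Indep` quantifies over the scalars of one field, whereas a nonzero minor survives base change
  -- to K. It also singles out the two coordinates by which `annihilator` eliminates.
  data NonzeroMinor : V4 → V4 → Set where
    m₀₁ : ∀ {a b c d x y z w} → a * y + - (b * x) ≢ 0# → NonzeroMinor (a , b , c , d) (x , y , z , w)
    m₀₂ : ∀ {a b c d x y z w} → a * z + - (c * x) ≢ 0# → NonzeroMinor (a , b , c , d) (x , y , z , w)
    m₀₃ : ∀ {a b c d x y z w} → a * w + - (d * x) ≢ 0# → NonzeroMinor (a , b , c , d) (x , y , z , w)
    m₁₂ : ∀ {a b c d x y z w} → b * z + - (c * y) ≢ 0# → NonzeroMinor (a , b , c , d) (x , y , z , w)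
    m₁₃ : ∀ {a b c d x y z w} → b * w + - (d * y) ≢ 0# → NonzeroMinor (a , b , c , d) (x , y , z , w)
    m₂₃ : ∀ {a b c d x y z w} → c * w + - (d * z) ≢ 0# → NonzeroMinor (a , b , c , d) (x , y , z , w)

  -- If all minors vanish, each combination - vᵢ u + uᵢ v is zero, so independence makes every
  -- coordinate uᵢ zero; but u cannot be zero.
  independent⇒minor : ∀ {u v} → Indep u v → NonzeroMinor u v
  independent⇒minor {a , b , c , d} {x , y , z , w} ind with a * y + - (b * x) ≟ 0# | a * z + - (c * x) ≟ 0# | a * w + - (d * x) ≟ 0#
    | b * z + - (c * y) ≟ 0# | b * w + - (d * y) ≟ 0# | c * w + - (d * z) ≟ 0#
  ... | no p | _ | _ | _ | _ | _ = m₀₁ p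
  ... | yes _ | no p | _ | _ | _ | _ = m₀₂ p
  ... | yes _ | yes _ | no p | _ | _ | _ = m₀₃ p
  ... | yes _ | yes _ | yes _ | no p | _ | _ = m₁₂ p
  ... | yes _ | yes _ | yes _ | yes _ | no p | _ = m₁₃ p
  ... | yes _ | yes _ | yes _ | yes _ | yes _ | no p = m₂₃ p
  ... | yes e₀₁ | yes e₀₂ | yes e₀₃ | yes e₁₂ | yes e₁₃ | yes e₂₃ = ⊥-elim (0≢1 (sym (proj₁ (ind 1# 0# (≡V4
      (vanish a x (ind₂ (- x) a (≡V4 (self a x) (skew e₀₁) (skew e₀₂) (skew e₀₃))))
      (vanish b y (ind₂ (- y) b (≡V4 (skew′ e₀₁) (self b y) (skew e₁₂) (skew e₁₃))))
      (vanish c z (ind₂ (- z) c (≡V4 (skew′ e₀₂) (skew′ e₁₂) (self c z) (skew e₂₃))))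
      (vanish d w (ind₂ (- w) d (≡V4 (skew′ e₀₃) (skew′ e₁₃) (skew′ e₂₃) (self d w)))))))))
    where
    ind₂ : ∀ α β → (α ⊙ (a , b , c , d)) ⊕ (β ⊙ (x , y , z , w)) ≡ zeroV → β ≡ 0#
    ind₂ α β p = proj₂ (ind α β p)
    self : ∀ a x → - x * a + a * x ≡ 0#
    self = solve 2 (λ a x → :- x :* a :+ a :* x := O) refl
    skew : ∀ {a b x y} → a * y + - (b * x) ≡ 0# → - x * b + a * y ≡ 0#
    skew {a} {b} {x} {y} e = trans (solve 4 (λ a b x y → :- x :* b :+ a :* y := a :* y :+ :- (b :* x)) refl a b x y) e
    skew′ : ∀ {a b x y} → a * y + - (b * x) ≡ 0# → - y * a + b * x ≡ 0#
    skew′ {a} {b} {x} {y} e = trans (solve 4 (λ a b x y → :- y :* a :+ b :* x := :- (a :* y :+ :- (b :* x))) refl a b x y)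
      (trans (cong -_ e) (solve 0 (:- O := O) refl))
    vanish : ∀ a x → a ≡ 0# → 1# * a + 0# * x ≡ 0#
    vanish a x p = trans (solve 2 (λ a x → I :* a :+ O :* x := a) refl a x) p

  minor⇒independent : ∀ {u v} → NonzeroMinor u v → Indep u v
  minor⇒independent minor α β p = go minor (cong proj₁ p) (cong (λ v → proj₁ (proj₂ v)) p)
      (cong (λ v → proj₁ (proj₂ (proj₂ v))) p) (cong (λ v → proj₂ (proj₂ (proj₂ v))) p)
    where
    two : ∀ {a b x y} → a * y + - (b * x) ≢ 0# → α * a + β * x ≡ 0# → α * b + β * y ≡ 0# → α ≡ 0# × β ≡ 0#
    two {a} {b} {x} {y} m e f =
      zero⇒ˡ m (trans (solve 6 (λ α β a b x y → α :* (a :* y :+ :- (b :* x)) := y :* (α :* a :+ β :* x) :+ :- x :* (α :* b :+ β :* y)) refl α β a b x y) (comb0 y (- x) e f)) ,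
      zero⇒ˡ m (trans (solve 6 (λ α β a b x y → β :* (a :* y :+ :- (b :* x)) := :- b :* (α :* a :+ β :* x) :+ a :* (α :* b :+ β :* y)) refl α β a b x y) (comb0 (- b) a e f))
    go : ∀ {u v} → NonzeroMinor u v → proj₁ ((α ⊙ u) ⊕ (β ⊙ v)) ≡ 0# → proj₁ (proj₂ ((α ⊙ u) ⊕ (β ⊙ v))) ≡ 0# →
      proj₁ (proj₂ (proj₂ ((α ⊙ u) ⊕ (β ⊙ v)))) ≡ 0# → proj₂ (proj₂ (proj₂ ((α ⊙ u) ⊕ (β ⊙ v)))) ≡ 0# → α ≡ 0# × β ≡ 0#
    go (m₀₁ m) e₀ e₁ e₂ e₃ = two m e₀ e₁
    go (m₀₂ m) e₀ e₁ e₂ e₃ = two m e₀ e₂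
    go (m₀₃ m) e₀ e₁ e₂ e₃ = two m e₀ e₃
    go (m₁₂ m) e₀ e₁ e₂ e₃ = two m e₁ e₂
    go (m₁₃ m) e₀ e₁ e₂ e₃ = two m e₁ e₃
    go (m₂₃ m) e₀ e₁ e₂ e₃ = two m e₂ e₃

  Kills : V4 → V4 → V4 → Set
  Kills c u v = c · u ≡ 0# × c · v ≡ 0#

  kills-comb : ∀ {c d u v} α β → Kills c u v → Kills d u v → Kills ((α ⊙ c) ⊕ (β ⊙ d)) u v
  kills-comb {c} {d} {u} {v} α β (p , q) (r , s) =
    trans (comb-· α β c d u) (comb0 α β p r) , trans (comb-· α β c d v) (comb0 α β q s)

  -- The covectors killing a line form a plane. As the 01 minor is nonzero, such a covector is
  -- determined by its last two coordinates; there a and b have nonzero determinant, and Cramer's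
  -- rule expresses c.
  annihilator₀₁ : ∀ {u₀ u₁ u₂ u₃ v₀ v₁ v₂ v₃ a b c} → let u = (u₀ , u₁ , u₂ , u₃) ; v = (v₀ , v₁ , v₂ , v₃) in
    u₀ * v₁ + - (u₁ * v₀) ≢ 0# → Indep a b → Kills a u v → Kills b u v → Kills c u v → InSpan c a b
  annihilator₀₁ {u₀} {u₁} {u₂} {u₃} {v₀} {v₁} {v₂} {v₃} {a@(a₀ , a₁ , a₂ , a₃)} {b@(b₀ , b₁ , b₂ , b₃)} {c@(c₀ , c₁ , c₂ , c₃)} m ind ka kb kc =
    λ′ , μ′ , ≡V4 (diff _ _ _ _ _ (cong proj₁ y≡0)) (diff _ _ _ _ _ (cong (λ v → proj₁ (proj₂ v)) y≡0))
      (diff _ _ _ _ _ (cong (λ v → proj₁ (proj₂ (proj₂ v))) y≡0)) (diff _ _ _ _ _ (cong (λ v → proj₂ (proj₂ (proj₂ v))) y≡0))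
    where
    u = u₀ , u₁ , u₂ , u₃
    v = v₀ , v₁ , v₂ , v₃
    kills⇒zero : ∀ {x₀ x₁ x₂ x₃} → Kills (x₀ , x₁ , x₂ , x₃) u v → x₂ ≡ 0# → x₃ ≡ 0# → (x₀ , x₁ , x₂ , x₃) ≡ zeroV
    kills⇒zero {x₀} {x₁} (p , r) refl refl = ≡V4
      (zero⇒ˡ m (trans (solve 6 (λ x₀ x₁ u₀ u₁ v₀ v₁ → x₀ :* (u₀ :* v₁ :+ :- (u₁ :* v₀)) :=
          v₁ :* (x₀ :* u₀ :+ x₁ :* u₁) :+ :- u₁ :* (x₀ :* v₀ :+ x₁ :* v₁)) refl x₀ x₁ u₀ u₁ v₀ v₁) (comb0 v₁ (- u₁) (two p) (two r))))
      (zero⇒ˡ m (trans (solve 6 (λ x₀ x₁ u₀ u₁ v₀ v₁ → x₁ :* (u₀ :* v₁ :+ :- (u₁ :* v₀)) :=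
          :- v₀ :* (x₀ :* u₀ :+ x₁ :* u₁) :+ u₀ :* (x₀ :* v₀ :+ x₁ :* v₁)) refl x₀ x₁ u₀ u₁ v₀ v₁) (comb0 (- v₀) u₀ (two p) (two r))))
      refl refl
      where
      two : ∀ {s a b} → s + 0# * a + 0# * b ≡ 0# → s ≡ 0#
      two {s} {a} {b} = trans (solve 3 (λ s a b → s := s :+ O :* a :+ O :* b) refl s a b)
    d = a₂ * b₃ + - (a₃ * b₂)
    d≢0 : d ≢ 0#
    d≢0 d≡0 = 0≢1 (sym (proj₁ (ind 1# 0# (trans (sym (proj₂ (proj₂ (span₁ a b))))
        (kills⇒zero ka (proj₂ (ind (- b₂) a₂ y₂)) (proj₂ (ind (- b₃) a₃ y₃)))))))
      where
      y₂ = kills⇒zero (kills-comb (- b₂) a₂ ka kb) (solve 2 (λ a b → :- b :* a :+ a :* b := O) refl a₂ b₂)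
        (trans (solve 4 (λ a₂ a₃ b₂ b₃ → :- b₂ :* a₃ :+ a₂ :* b₃ := a₂ :* b₃ :+ :- (a₃ :* b₂)) refl a₂ a₃ b₂ b₃) d≡0)
      y₃ = kills⇒zero (kills-comb (- b₃) a₃ ka kb)
        (trans (solve 4 (λ a₂ a₃ b₂ b₃ → :- b₃ :* a₂ :+ a₃ :* b₂ := :- I :* (a₂ :* b₃ :+ :- (a₃ :* b₂))) refl a₂ a₃ b₂ b₃) (*-zeroʳ _ d≡0))
        (solve 2 (λ a b → :- b :* a :+ a :* b := O) refl a₃ b₃)
    i = inv d≢0
    λ′ = (c₂ * b₃ + - (c₃ * b₂)) * i
    μ′ = (a₂ * c₃ + - (a₃ * c₂)) * i
    diff : ∀ c α a β b → 1# * c + - 1# * (α * a + β * b) ≡ 0# → c ≡ α * a + β * b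
    diff c α a β b p = x-y≡0⇒x≡y (trans (solve 2 (λ x y → x :+ :- y := I :* x :+ :- I :* y) refl c (α * a + β * b)) p)
    y≡0 : (1# ⊙ c) ⊕ ((- 1#) ⊙ ((λ′ ⊙ a) ⊕ (μ′ ⊙ b))) ≡ zeroV
    y≡0 = kills⇒zero (kills-comb 1# (- 1#) kc (kills-comb λ′ μ′ ka kb))
      (trans (solve 7 (λ a₂ a₃ b₂ b₃ c₂ c₃ i → I :* c₂ :+ :- I :* ((c₂ :* b₃ :+ :- (c₃ :* b₂)) :* i :* a₂ :+ (a₂ :* c₃ :+ :- (a₃ :* c₂)) :* i :* b₂)
        := c₂ :* (I :+ :- ((a₂ :* b₃ :+ :- (a₃ :* b₂)) :* i))) refl a₂ a₃ b₂ b₃ c₂ c₃ i)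
        (*-zeroʳ c₂ (x≡y⇒x-y≡0 (sym (*-inv d≢0)))))
      (trans (solve 7 (λ a₂ a₃ b₂ b₃ c₂ c₃ i → I :* c₃ :+ :- I :* ((c₂ :* b₃ :+ :- (c₃ :* b₂)) :* i :* a₃ :+ (a₂ :* c₃ :+ :- (a₃ :* c₂)) :* i :* b₃)
        := c₃ :* (I :+ :- ((a₂ :* b₃ :+ :- (a₃ :* b₂)) :* i))) refl a₂ a₃ b₂ b₃ c₂ c₃ i)
        (*-zeroʳ c₃ (x≡y⇒x-y≡0 (sym (*-inv d≢0)))))

  -- Each σ moves the two indexed coordinates to the front and the corresponding τ undoes it; this
  -- reduces every minor to the case 01.
  σ₀₂ τ₀₂ : V4 → V4
  σ₀₂ (x , y , z , w) = x , z , y , w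
  τ₀₂ (x , y , z , w) = x , z , y , w

  σ₀₂-· : ∀ c x → σ₀₂ c · σ₀₂ x ≡ c · x
  σ₀₂-· (a , b , c , d) (x , y , z , w) =
    solve 4 (λ x y z w → x :+ z :+ y :+ w := x :+ y :+ z :+ w) refl (a * x) (b * y) (c * z) (d * w)

  σ₀₃ τ₀₃ : V4 → V4
  σ₀₃ (x , y , z , w) = x , w , z , y
  τ₀₃ (x , y , z , w) = x , w , z , y

  σ₀₃-· : ∀ c x → σ₀₃ c · σ₀₃ x ≡ c · x
  σ₀₃-· (a , b , c , d) (x , y , z , w) =
    solve 4 (λ x y z w → x :+ w :+ z :+ y := x :+ y :+ z :+ w) refl (a * x) (b * y) (c * z) (d * w)

  σ₁₂ τ₁₂ : V4 → V4
  σ₁₂ (x , y , z , w) = y , z , x , w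
  τ₁₂ (x , y , z , w) = z , x , y , w

  σ₁₂-· : ∀ c x → σ₁₂ c · σ₁₂ x ≡ c · x
  σ₁₂-· (a , b , c , d) (x , y , z , w) =
    solve 4 (λ x y z w → y :+ z :+ x :+ w := x :+ y :+ z :+ w) refl (a * x) (b * y) (c * z) (d * w)

  σ₁₃ τ₁₃ : V4 → V4
  σ₁₃ (x , y , z , w) = y , w , x , z
  τ₁₃ (x , y , z , w) = z , x , w , y

  σ₁₃-· : ∀ c x → σ₁₃ c · σ₁₃ x ≡ c · x
  σ₁₃-· (a , b , c , d) (x , y , z , w) =
    solve 4 (λ x y z w → y :+ w :+ x :+ z := x :+ y :+ z :+ w) refl (a * x) (b * y) (c * z) (d * w)

  σ₂₃ τ₂₃ : V4 → V4
  σ₂₃ (x , y , z , w) = z , w , x , y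
  τ₂₃ (x , y , z , w) = z , w , x , y

  σ₂₃-· : ∀ c x → σ₂₃ c · σ₂₃ x ≡ c · x
  σ₂₃-· (a , b , c , d) (x , y , z , w) =
    solve 4 (λ x y z w → z :+ w :+ x :+ y := x :+ y :+ z :+ w) refl (a * x) (b * y) (c * z) (d * w)

  annihilator : ∀ {u v a b c} → Indep u v → Indep a b → Kills a u v → Kills b u v → Kills c u v → InSpan c a b
  annihilator {u} {v} {a} {b} {c} ind-uv ind ka kb kc = go (independent⇒minor ind-uv)
    where
    permute : (σ : V4 → V4) → (∀ x y → σ x · σ y ≡ x · y) → (∀ α β → (α ⊙ σ a) ⊕ (β ⊙ σ b) ≡ zeroV → (α ⊙ a) ⊕ (β ⊙ b) ≡ zeroV) →
      (∀ α β → σ c ≡ (α ⊙ σ a) ⊕ (β ⊙ σ b) → c ≡ (α ⊙ a) ⊕ (β ⊙ b)) →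
      (Indep (σ a) (σ b) → Kills (σ a) (σ u) (σ v) → Kills (σ b) (σ u) (σ v) → Kills (σ c) (σ u) (σ v) → InSpan (σ c) (σ a) (σ b)) →
      InSpan c a b
    permute σ σ· σ-zero σ-span base =
      let α , β , e = base (λ α β p → ind α β (σ-zero α β p)) (kill a ka) (kill b kb) (kill c kc) in α , β , σ-span α β e
      where
      kill : ∀ x → Kills x u v → Kills (σ x) (σ u) (σ v)
      kill x (p , r) = trans (σ· x u) p , trans (σ· x v) r
    go : NonzeroMinor u v → InSpan c a b
    go (m₀₁ m) = annihilator₀₁ m ind ka kb kc
    go (m₀₂ m) = permute σ₀₂ σ₀₂-· (λ α β p → cong τ₀₂ p) (λ α β p → cong τ₀₂ p) (annihilator₀₁ m)
    go (m₀₃ m) = permute σ₀₃ σ₀₃-· (λ α β p → cong τ₀₃ p) (λ α β p → cong τ₀₃ p) (annihilator₀₁ m)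
    go (m₁₂ m) = permute σ₁₂ σ₁₂-· (λ α β p → cong τ₁₂ p) (λ α β p → cong τ₁₂ p) (annihilator₀₁ m)
    go (m₁₃ m) = permute σ₁₃ σ₁₃-· (λ α β p → cong τ₁₃ p) (λ α β p → cong τ₁₃ p) (annihilator₀₁ m)
    go (m₂₃ m) = permute σ₂₃ σ₂₃-· (λ α β p → cong τ₂₃ p) (λ α β p → cong τ₂₃ p) (annihilator₀₁ m)

-- Cubes, forms with a double root, and axes

module Cubic {q : ℕ} (F : FiniteField q) where
  open FiniteField F
  open FieldProperties F
  open Geometry F
  private
    module S {n} = Forms (Polynomial n) _:+_ _:*_ :-_ I

  hom : Maybe Carrier → Carrier × Carrier
  hom (just t) = t , 1#
  hom nothing  = 1# , 0#

  opaque
    unfolding cross cub osc dbl tan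

    osc-cub : ∀ a w → osc a · cub w ≡ cube (cross w a)
    osc-cub (x , y) (z , w) = solve 4 (λ x y z w → S.dot (S.osc (x , y)) (S.cub (z , w)) := S.cube (S.cross (z , w) (x , y))) refl x y z w

    osc-tan : ∀ a w z → osc a · tan w z ≡ 3# * (cross w a * cross w a * cross z a)
    osc-tan (a , b) (c , d) (e , f) = solve 6 (λ a b c d e f →
      S.dot (S.osc (a , b)) (S.tan (c , d) (e , f)) := S.three :* (S.cross (c , d) (a , b) :* S.cross (c , d) (a , b) :* S.cross (e , f) (a , b))) refl a b c d e f

    dbl-cub : ∀ p r w → dbl p r · cub w ≡ cross w p * cross w p * cross w r
    dbl-cub (a , b) (c , d) (e , f) = solve 6 (λ a b c d e f →
      S.dot (S.dbl (a , b) (c , d)) (S.cub (e , f)) := S.cross (e , f) (a , b) :* S.cross (e , f) (a , b) :* S.cross (e , f) (c , d)) refl a b c d e f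

    dbl-tan₁ : ∀ p r → dbl p r · tan p r ≡ 0#
    dbl-tan₁ (a , b) (c , d) = solve 4 (λ a b c d → S.dot (S.dbl (a , b) (c , d)) (S.tan (a , b) (c , d)) := O) refl a b c d

    dbl-tan₂ : ∀ p r → dbl p r · tan r p ≡ cross r p * cross r p * cross p r
    dbl-tan₂ (a , b) (c , d) = solve 4 (λ a b c d →
      S.dot (S.dbl (a , b) (c , d)) (S.tan (c , d) (a , b)) := S.cross (c , d) (a , b) :* S.cross (c , d) (a , b) :* S.cross (a , b) (c , d)) refl a b c d

    cross-self : ∀ p → cross p p ≡ 0#
    cross-self (x , y) = solve 2 (λ x y → S.cross (x , y) (x , y) := O) refl x y

    cross-anti : ∀ p r → cross p r ≡ - cross r p
    cross-anti (x , y) (z , w) = solve 4 (λ x y z w → S.cross (x , y) (z , w) := :- S.cross (z , w) (x , y)) refl x y z w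

    plücker : ∀ p r s t → cross p s * cross r t + - (cross r s * cross p t) ≡ cross p r * cross s t
    plücker (a , b) (c , d) (e , f) (g , h) = solve 8 (λ a b c d e f g h →
      S.cross (a , b) (e , f) :* S.cross (c , d) (g , h) :+ :- (S.cross (c , d) (e , f) :* S.cross (a , b) (g , h))
        := S.cross (a , b) (c , d) :* S.cross (e , f) (g , h)) refl a b c d e f g h

    -- cub p, cub r, tan p r, tan r p is a basis of V4 with dual basis osc r, osc p, dbl r p, dbl p r (up to scalars).
    basis-expansion : ∀ p r x → cube (cross p r) ⊙ x ≡
      (((osc r · x) ⊙ cub p) ⊕ ((- (osc p · x)) ⊙ cub r)) ⊕ (((- (dbl r p · x)) ⊙ tan p r) ⊕ ((dbl p r · x) ⊙ tan r p))
    basis-expansion (a , b) (c , d) (x₀ , x₁ , x₂ , x₃) = ≡V4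
      (solve 8 (λ a b c d x₀ x₁ x₂ x₃ → let p = a , b ; r = c , d ; x = x₀ , x₁ , x₂ , x₃ in
        S.cube (S.cross p r) :* x₀ := (S.dot (S.osc r) x :* proj₁ (S.cub p) :+ (:- S.dot (S.osc p) x) :* proj₁ (S.cub r))
          :+ ((:- S.dot (S.dbl r p) x) :* proj₁ (S.tan p r) :+ S.dot (S.dbl p r) x :* proj₁ (S.tan r p))) refl a b c d x₀ x₁ x₂ x₃)
      (solve 8 (λ a b c d x₀ x₁ x₂ x₃ → let p = a , b ; r = c , d ; x = x₀ , x₁ , x₂ , x₃ in
        S.cube (S.cross p r) :* x₁ := (S.dot (S.osc r) x :* (a :* a :* b) :+ (:- S.dot (S.osc p) x) :* (c :* c :* d))
          :+ ((:- S.dot (S.dbl r p) x) :* proj₁ (proj₂ (S.tan p r)) :+ S.dot (S.dbl p r) x :* proj₁ (proj₂ (S.tan r p)))) refl a b c d x₀ x₁ x₂ x₃)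
      (solve 8 (λ a b c d x₀ x₁ x₂ x₃ → let p = a , b ; r = c , d ; x = x₀ , x₁ , x₂ , x₃ in
        S.cube (S.cross p r) :* x₂ := (S.dot (S.osc r) x :* (a :* b :* b) :+ (:- S.dot (S.osc p) x) :* (c :* d :* d))
          :+ ((:- S.dot (S.dbl r p) x) :* proj₁ (proj₂ (proj₂ (S.tan p r))) :+ S.dot (S.dbl p r) x :* proj₁ (proj₂ (proj₂ (S.tan r p))))) refl a b c d x₀ x₁ x₂ x₃)
      (solve 8 (λ a b c d x₀ x₁ x₂ x₃ → let p = a , b ; r = c , d ; x = x₀ , x₁ , x₂ , x₃ in
        S.cube (S.cross p r) :* x₃ := (S.dot (S.osc r) x :* (b :* b :* b) :+ (:- S.dot (S.osc p) x) :* (d :* d :* d))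
          :+ ((:- S.dot (S.dbl r p) x) :* proj₂ (proj₂ (proj₂ (S.tan p r))) :+ S.dot (S.dbl p r) x :* proj₂ (proj₂ (proj₂ (S.tan r p))))) refl a b c d x₀ x₁ x₂ x₃)

    cross-combˡ : ∀ α β a b c d w → cross (α * a + β * c , α * b + β * d) w ≡ α * cross (a , b) w + β * cross (c , d) w
    cross-combˡ α β a b c d (x , y) = solve 8 (λ α β a b c d x y →
      S.cross (α :* a :+ β :* c , α :* b :+ β :* d) (x , y) := α :* S.cross (a , b) (x , y) :+ β :* S.cross (c , d) (x , y)) refl α β a b c d x y

    cross-scaleˡ : ∀ k a b w → cross (k * a , k * b) w ≡ k * cross (a , b) w
    cross-scaleˡ k a b (x , y) = solve 5 (λ k a b x y → S.cross (k :* a , k :* b) (x , y) := k :* S.cross (a , b) (x , y)) refl k a b x y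

    cross≡0 : ∀ s t → cross (hom s) (hom t) ≡ 0# → s ≡ t
    cross≡0 (just s) (just t) p = cong just (x-y≡0⇒x≡y (trans (solve 2 (λ s t → s :+ :- t := S.cross (s , I) (t , I)) refl s t) p))
    cross≡0 (just s) nothing p = ⊥-elim (0≢1 (trans (sym (trans (cong -_ p) (solve 0 (:- O := O) refl))) (solve 1 (λ s → :- S.cross (s , I) (I , O) := I) refl s)))
    cross≡0 nothing (just t) p = ⊥-elim (0≢1 (trans (sym p) (solve 1 (λ t → S.cross (I , O) (t , I) := I) refl t)))
    cross≡0 nothing nothing p = refl

    Pt≡cub : ∀ t → Pt t ≡ cub (hom t)
    Pt≡cub (just t) = ≡V4 (solve 1 (λ t → t :* (t :* (t :* I)) := t :* t :* t) refl t) (solve 1 (λ t → t :* (t :* I) := t :* t :* I) refl t)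
      (solve 1 (λ t → t := t :* I :* I) refl t) (solve 0 (I := I :* I :* I) refl)
    Pt≡cub nothing = ≡V4 (solve 0 (I := I :* I :* I) refl) (solve 0 (O := I :* I :* O) refl) (solve 0 (O := I :* O :* O) refl) (solve 0 (O := O :* O :* O) refl)

    oscV≡osc : ∀ t → oscV t ≡ osc (hom (just t))
    oscV≡osc t = ≡V4 (solve 0 (I := I :* I :* I) refl) (solve 1 (λ t → :- (S.three :* t) := :- (S.three :* (t :* I :* I))) refl t)
      (solve 1 (λ t → S.three :* (t :* (t :* I)) := S.three :* (t :* t :* I)) refl t) (solve 1 (λ t → :- (t :* (t :* (t :* I))) := :- (t :* t :* t)) refl t)

    πinfV≡osc : πinfV ≡ (- 1#) ⊙ osc (hom nothing)
    πinfV≡osc = ≡V4 (solve 0 (O := :- I :* (O :* O :* O)) refl) (solve 0 (O := :- I :* :- (S.three :* (I :* O :* O))) refl)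
      (solve 0 (O := :- I :* (S.three :* (I :* I :* O))) refl) (solve 0 (I := :- I :* :- (I :* I :* I)) refl)

  cross≢0 : ∀ {s t} → s ≢ t → cross (hom s) (hom t) ≢ 0#
  cross≢0 s≢t p = s≢t (cross≡0 _ _ p)

  infix 4 _≟ᴹ_
  _≟ᴹ_ : (s t : Maybe Carrier) → Dec (s ≡ t)
  _≟ᴹ_ = ≡-dec _≟_

  -- The covector `osc (hom s)` vanishes at the point of s and not at that of t, and vice versa, so
  -- pairing a relation with either point isolates one coefficient.
  osc-independent : ∀ {s t} → s ≢ t → Indep (osc (hom s)) (osc (hom t))
  osc-independent {s} {t} s≢t a b e =
    zero⇒ˡ (cube≢0 (cross≢0 (λ p → s≢t (sym p)))) (trans (cong (a *_) (sym (osc-cub (hom s) (hom t)))) (trans (solve 2 (λ x b → x := x :+ b :* O) refl _ b)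
      (trans (cong (λ y → a * (osc (hom s) · cub (hom t)) + b * y) (sym (vanish t))) (trans (sym (comb-· a b (osc (hom s)) (osc (hom t)) (cub (hom t)))) (trans (cong (_· cub (hom t)) e) (trans (·-comm zeroV _) (·-zeroV _))))))) ,
    zero⇒ˡ (cube≢0 (cross≢0 s≢t)) (trans (cong (b *_) (sym (osc-cub (hom t) (hom s)))) (trans (solve 2 (λ x a → x := a :* O :+ x) refl _ a)
      (trans (cong (λ y → a * y + b * (osc (hom t) · cub (hom s))) (sym (vanish s))) (trans (sym (comb-· a b (osc (hom s)) (osc (hom t)) (cub (hom s)))) (trans (cong (_· cub (hom s)) e) (trans (·-comm zeroV _) (·-zeroV _)))))))
    where
    vanish : ∀ s → osc (hom s) · cub (hom s) ≡ 0#
    vanish s = trans (osc-cub (hom s) (hom s)) (trans (cong cube (cross-self (hom s))) (solve 0 (O :* O :* O := O) refl))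

  -- With A = t × τ, B = t × τ′, A′ = u × τ, B′ = u × τ′, the first two hypotheses say that λ (·×τ)³ + μ (·×τ′)³
  -- vanishes at t and at u, and the third that its derivative at t does.
  cubes-combination : ∀ λ′ μ A B A′ B′ → A * B′ + - (A′ * B) ≢ 0# →
    λ′ * cube A + μ * cube B ≡ 0# → λ′ * cube A′ + μ * cube B′ ≡ 0# →
    λ′ * (3# * (A * A * A′)) + μ * (3# * (B * B * B′)) ≡ 0# → λ′ ≡ 0# × μ ≡ 0#
  cubes-combination λ′ μ A B A′ B′ W≢0 E₁ E₂ E₃ with 3# ≟ 0#
  -- Cubing is additive here, so the cube of A B′ - A′ B is the determinant of the linear system
  -- given by the first two equations, and Cramer's rule applies.
  ... | yes 3≡0 =
        zero⇒ˡ W³≢0 (trans (solve 6 (λ l m A B A′ B′ → l :* S.cube (A :* B′ :+ :- (A′ :* B)) :=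
            S.cube B′ :* (l :* S.cube A :+ m :* S.cube B) :+ :- S.cube B :* (l :* S.cube A′ :+ m :* S.cube B′)
              :+ S.three :* (l :* (A :* B′ :* (A′ :* B)) :* :- (A :* B′ :+ :- (A′ :* B)))) refl λ′ μ A B A′ B′)
          (zero-sum (comb0 _ _ E₁ E₂) (*-zeroˡ _ 3≡0))) ,
        zero⇒ˡ W³≢0 (trans (solve 6 (λ l m A B A′ B′ → m :* S.cube (A :* B′ :+ :- (A′ :* B)) :=
            :- S.cube A′ :* (l :* S.cube A :+ m :* S.cube B) :+ S.cube A :* (l :* S.cube A′ :+ m :* S.cube B′)
              :+ S.three :* (m :* (A :* B′ :* (A′ :* B)) :* :- (A :* B′ :+ :- (A′ :* B)))) refl λ′ μ A B A′ B′)
          (zero-sum (comb0 _ _ E₁ E₂) (*-zeroˡ _ 3≡0)))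
        where W³≢0 = cube≢0 W≢0
  -- Cancelling 3 in the third equation and eliminating with the first gives λ A² = 0 and μ B² = 0.
  -- A nonzero coefficient then makes A B′ - A′ B vanish, with the help of the second equation when
  -- the other coefficient is zero.
  ... | no 3≢0 = go (λ′ ≟ 0#) (μ ≟ 0#)
        where
        E₃′ : λ′ * (A * A * A′) + μ * (B * B * B′) ≡ 0#
        E₃′ = zero⇒ 3≢0 (trans (solve 7 (λ c l m A B A′ B′ → c :* (l :* (A :* A :* A′) :+ m :* (B :* B :* B′)) :=
          l :* (c :* (A :* A :* A′)) :+ m :* (c :* (B :* B :* B′))) refl 3# λ′ μ A B A′ B′) E₃)
        λAA≡0 : λ′ * (A * A) ≡ 0#
        λAA≡0 = zero⇒ˡ W≢0 (trans (solve 6 (λ l m A B A′ B′ → l :* (A :* A) :* (A :* B′ :+ :- (A′ :* B)) :=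
          B′ :* (l :* S.cube A :+ m :* S.cube B) :+ :- B :* (l :* (A :* A :* A′) :+ m :* (B :* B :* B′))) refl λ′ μ A B A′ B′) (comb0 _ _ E₁ E₃′))
        μBB≡0 : μ * (B * B) ≡ 0#
        μBB≡0 = zero⇒ˡ W≢0 (trans (solve 6 (λ l m A B A′ B′ → m :* (B :* B) :* (A :* B′ :+ :- (A′ :* B)) :=
          :- A′ :* (l :* S.cube A :+ m :* S.cube B) :+ A :* (l :* (A :* A :* A′) :+ m :* (B :* B :* B′))) refl λ′ μ A B A′ B′) (comb0 _ _ E₁ E₃′))
        W≡0 : (A ≡ 0# × (B ≡ 0# ⊎ A′ ≡ 0#)) ⊎ (B ≡ 0# × B′ ≡ 0#) → ⊥
        W≡0 (inj₁ (refl , inj₁ refl)) = W≢0 (solve 2 (λ A′ B′ → O :* B′ :+ :- (A′ :* O) := O) refl A′ B′)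
        W≡0 (inj₁ (refl , inj₂ refl)) = W≢0 (solve 2 (λ B B′ → O :* B′ :+ :- (O :* B) := O) refl B B′)
        W≡0 (inj₂ (refl , refl)) = W≢0 (solve 2 (λ A A′ → A :* O :+ :- (A′ :* O) := O) refl A A′)
        go : Dec (λ′ ≡ 0#) → Dec (μ ≡ 0#) → λ′ ≡ 0# × μ ≡ 0#
        go (yes λ≡0) (yes μ≡0) = λ≡0 , μ≡0
        go (yes λ≡0) (no μ≢0) = ⊥-elim (W≡0 (inj₂ (square≡0 (zero⇒ μ≢0 μBB≡0) ,
          cube≡0 (zero⇒ μ≢0 (trans (trans (sym (+-identityˡ _)) (cong (_+ μ * cube B′) (sym (*-zeroˡ _ λ≡0)))) E₂)))))
        go (no λ≢0) (yes μ≡0) = ⊥-elim (W≡0 (inj₁ (square≡0 (zero⇒ λ≢0 λAA≡0) ,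
          inj₂ (cube≡0 (zero⇒ λ≢0 (trans (trans (sym (+-identityʳ _)) (cong (λ y → λ′ * cube A′ + y) (sym (*-zeroˡ _ μ≡0)))) E₂))))))
        go (no λ≢0) (no μ≢0) = ⊥-elim (W≡0 (inj₁ (square≡0 (zero⇒ λ≢0 λAA≡0) , inj₁ (square≡0 (zero⇒ μ≢0 μBB≡0)))))

  -- By `annihilator` the form would be a combination of the cubes at σ and τ. The statement holds
  -- over any finite field: F serves the real axes, and K with τ the conjugate of σ the imaginary
  -- ones.
  dbl-plane∌axis : ∀ {s t σ τ u v} → s ≢ t → σ ≢ τ → Indep u v →
    Kills (dbl (hom s) (hom t)) u v → Kills (osc (hom σ)) u v → Kills (osc (hom τ)) u v → ⊥
  dbl-plane∌axis {s} {t} {σ} {τ} s≢t σ≢τ ind kd kσ kτ =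
    *≢0 (*≢0 (cross≢0 t≢s) (cross≢0 t≢s)) (cross≢0 s≢t) (trans (sym (dbl-tan₂ (hom s) (hom t)))
      (trans (at (tan (hom t) (hom s))) (trans (cong₂ (λ a b → a * _ + b * _) (proj₁ vanish) (proj₂ vanish)) (solve 2 (λ a b → O :* a :+ O :* b := O) refl _ _))))
    where
    t≢s = λ p → s≢t (sym p)
    span = annihilator ind (osc-independent σ≢τ) kσ kτ kd
    λ′ = proj₁ span
    μ = proj₁ (proj₂ span)
    at : ∀ x → dbl (hom s) (hom t) · x ≡ λ′ * (osc (hom σ) · x) + μ * (osc (hom τ) · x)
    at x = trans (cong (_· x) (proj₂ (proj₂ span))) (comb-· λ′ μ _ _ x)
    at-cub : ∀ w → cross w (hom s) * cross w (hom s) * cross w (hom t) ≡ 0# → λ′ * cube (cross w (hom σ)) + μ * cube (cross w (hom τ)) ≡ 0#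
    at-cub w p = trans (cong₂ (λ a b → λ′ * a + μ * b) (sym (osc-cub _ w)) (sym (osc-cub _ w))) (trans (sym (at (cub w))) (trans (dbl-cub _ _ w) p))
    vanish : λ′ ≡ 0# × μ ≡ 0#
    vanish = cubes-combination λ′ μ (cross (hom s) (hom σ)) (cross (hom s) (hom τ)) (cross (hom t) (hom σ)) (cross (hom t) (hom τ))
      (λ p → *≢0 (cross≢0 s≢t) (cross≢0 σ≢τ) (trans (sym (plücker (hom s) (hom t) (hom σ) (hom τ))) p))
      (at-cub (hom s) (trans (cong (λ a → a * a * cross (hom s) (hom t)) (cross-self (hom s))) (solve 1 (λ a → O :* O :* a := O) refl _)))
      (at-cub (hom t) (trans (cong (λ a → cross (hom t) (hom s) * cross (hom t) (hom s) * a) (cross-self (hom t))) (zeroʳ _)))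
      (trans (cong₂ (λ a b → λ′ * a + μ * b) (sym (osc-tan _ _ _)) (sym (osc-tan _ _ _))) (trans (sym (at (tan (hom s) (hom t)))) (dbl-tan₁ _ _)))

-- 2_C-planes as ordered pairs of points of C

module Planes {q : ℕ} (F : FiniteField q) where
  open FiniteField F
  open FieldProperties F
  open Geometry F
  open Cubic F

  -- Total, so that points and parameters can be written down as plain functions before any
  -- nonvanishing is proved.
  inv₀ : Carrier → Carrier
  inv₀ x with x ≟ 0#
  ... | yes _  = 0#
  ... | no x≢0 = inv x≢0

  *-inv₀ : ∀ {x} → x ≢ 0# → x * inv₀ x ≡ 1#
  *-inv₀ {x} x≢0 with x ≟ 0#
  ... | yes x≡0 = ⊥-elim (x≢0 x≡0)
  ... | no x≢0′ = *-inv x≢0′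

  x*i*y : ∀ {x} y → x ≢ 0# → x * (inv₀ x * y) ≡ y
  x*i*y {x} y x≢0 = trans (sym (*-assoc x _ y)) (trans (cong (_* y) (*-inv₀ x≢0)) (*-identityˡ y))

  inv₀≢0 : ∀ {x} → x ≢ 0# → inv₀ x ≢ 0#
  inv₀≢0 {x} x≢0 p = 0≢1 (trans (sym (zeroʳ x)) (trans (cong (x *_) (sym p)) (*-inv₀ x≢0)))

  ⊙-identity : ∀ x → 1# ⊙ x ≡ x
  ⊙-identity (a , b , c , d) = ≡V4 (*-identityˡ a) (*-identityˡ b) (*-identityˡ c) (*-identityˡ d)

  ⊙-⊙ : ∀ k l x → k ⊙ (l ⊙ x) ≡ (k * l) ⊙ x
  ⊙-⊙ k l (a , b , c , d) = ≡V4 (e a) (e b) (e c) (e d)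
    where
    e : ∀ x → k * (l * x) ≡ k * l * x
    e x = sym (*-assoc k l x)

  ⊙-unscale : ∀ {k x y} → k ≢ 0# → k ⊙ x ≡ y → x ≡ inv₀ k ⊙ y
  ⊙-unscale {k} {x} k≢0 refl = sym (trans (⊙-⊙ _ k x) (trans (cong (_⊙ x) (trans (*-comm _ k) (*-inv₀ k≢0))) (⊙-identity x)))

  0⊙ : ∀ x → 0# ⊙ x ≡ zeroV
  0⊙ (a , b , c , d) = ≡V4 (zeroˡ a) (zeroˡ b) (zeroˡ c) (zeroˡ d)

  ·-⊙ʳ : ∀ k c x → c · (k ⊙ x) ≡ k * (c · x)
  ·-⊙ʳ k c x = trans (·-comm c _) (trans (·-⊙ k x c) (cong (k *_) (·-comm x c)))

  ·-⊕ : ∀ c x y → c · (x ⊕ y) ≡ c · x + c · y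
  ·-⊕ c x y = trans (cong₂ (λ x y → c · (x ⊕ y)) (sym (⊙-identity x)) (sym (⊙-identity y)))
    (trans (·-comb c 1# 1# x y) (cong₂ _+_ (*-identityˡ _) (*-identityˡ _)))

  osc-self : ∀ p → osc p · cub p ≡ 0#
  osc-self p = trans (osc-cub p p) (trans (cong cube (cross-self p)) (solve 0 (O :* O :* O := O) refl))

  dbl-cub₁ : ∀ p r → dbl p r · cub p ≡ 0#
  dbl-cub₁ p r = trans (dbl-cub p r p) (trans (cong (λ a → a * a * cross p r) (cross-self p)) (solve 1 (λ a → O :* O :* a := O) refl _))

  dbl-cub₂ : ∀ p r → dbl p r · cub r ≡ 0#
  dbl-cub₂ p r = trans (dbl-cub p r r) (trans (cong (λ a → cross r p * cross r p * a) (cross-self r)) (zeroʳ _))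

  osc-tan₁ : ∀ p r → osc p · tan p r ≡ 0#
  osc-tan₁ p r = trans (osc-tan p p r) (trans (cong (λ a → 3# * (a * a * cross r p)) (cross-self p)) (solve 2 (λ c a → c :* (O :* O :* a) := O) refl 3# _))

  osc-tan₂ : ∀ p r → osc r · tan p r ≡ 0#
  osc-tan₂ p r = trans (osc-tan r p r) (trans (cong (λ a → 3# * (cross p r * cross p r * a)) (cross-self r)) (trans (cong (3# *_) (zeroʳ _)) (zeroʳ _)))

  dbl-root : ∀ {s t w} → dbl (hom s) (hom t) · Pt w ≡ 0# → w ≡ s ⊎ w ≡ t
  dbl-root {s} {t} {w} e = [ (λ p → inj₁ (cross≡0 w s (square≡0 p))) , (λ p → inj₂ (cross≡0 w t p)) ]
    (noZeroDivisors (cross (hom w) (hom s) * cross (hom w) (hom s)) (cross (hom w) (hom t))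
      (trans (sym (dbl-cub (hom s) (hom t) (hom w))) (trans (cong (dbl (hom s) (hom t) ·_) (sym (Pt≡cub w))) e)))

  dbl≢0 : ∀ {s t} → s ≢ t → dbl (hom s) (hom t) ≢ zeroV
  dbl≢0 {s} {t} s≢t e = *≢0 (*≢0 t×s≢0 t×s≢0) (cross≢0 s≢t) (trans (sym (dbl-tan₂ (hom s) (hom t))) (trans (cong (_· tan (hom t) (hom s)) e) (trans (·-comm zeroV _) (·-zeroV _))))
    where t×s≢0 = cross≢0 (λ p → s≢t (sym p))

  module Expansion {s t : Maybe Carrier} (s≢t : s ≢ t) where
    p r : Carrier × Carrier
    p = hom s
    r = hom t

    δ≢0 : cross p r ≢ 0#
    δ≢0 = cross≢0 s≢t

    expand : ∀ c x → cube (cross p r) * (c · x) ≡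
      ((osc r · x) * (c · cub p) + (- (osc p · x)) * (c · cub r)) + ((- (dbl r p · x)) * (c · tan p r) + (dbl p r · x) * (c · tan r p))
    expand c x = trans (sym (·-⊙ʳ (cube (cross p r)) c x)) (trans (cong (c ·_) (basis-expansion p r x)) (trans (·-⊕ c _ _)
      (cong₂ _+_ (·-comb c _ _ (cub p) (cub r)) (·-comb c _ _ (tan p r) (tan r p)))))

    -- By `basis-expansion` these four functionals determine the pairing with every covector, hence
    -- the vector.
    coordinates-ext : ∀ {x y} → osc r · x ≡ osc r · y → osc p · x ≡ osc p · y → dbl r p · x ≡ dbl r p · y → dbl p r · x ≡ dbl p r · y → x ≡ y
    coordinates-ext {x} {y} e₁ e₂ e₃ e₄ = ·-nondegenerate x y (λ c → trans (·-comm x c) (trans (*-cancelˡ (cube≢0 δ≢0)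
      (trans (expand c x) (trans (cong₂ _+_ (cong₂ (λ a b → a * (c · cub p) + (- b) * (c · cub r)) e₁ e₂) (cong₂ (λ a b → (- a) * (c · tan p r) + b * (c · tan r p)) e₃ e₄))
        (sym (expand c y))))) (·-comm c y)))

  dehomogenize : ∀ x y → ¬ (x ≡ 0# × y ≡ 0#) → ∃[ m ] ∃[ k ] (k ≢ 0# × x ≡ k * proj₁ (hom m) × y ≡ k * proj₂ (hom m))
  dehomogenize x y ≢0 with y ≟ 0#
  ... | no y≢0 = just (inv₀ y * x) , y , y≢0 , sym (x*i*y x y≢0) , sym (*-identityʳ y)
  ... | yes y≡0 = nothing , x , (λ x≡0 → ≢0 (x≡0 , y≡0)) , sym (*-identityʳ x) , trans y≡0 (sym (zeroʳ x))

  module _ {s t : Maybe Carrier} (s≢t : s ≢ t) where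
    open Expansion s≢t

    -- A form vanishing at s and t is α (·×s)²(·×t) + β (·×t)²(·×s), and its third root is α s + β t.
    tangent-at-root : ∀ c → c ≢ zeroV → c · cub p ≡ 0# → c · cub r ≡ 0# → (∀ w → c · cub (hom w) ≡ 0# → w ≡ s ⊎ w ≡ t) →
      ∃[ l ] (l ≢ 0# × (c ≡ l ⊙ dbl p r ⊎ c ≡ l ⊙ dbl r p))
    tangent-at-root c c≢0 cp cr roots = conclude (roots m root)
      where
      α β : Carrier
      α = c · tan r p
      β = - (c · tan p r)
      expand-c : ∀ x → cube (cross p r) * (c · x) ≡ α * (dbl p r · x) + β * (dbl r p · x)
      expand-c x = trans (expand c x) (trans (cong₂ (λ a b → ((osc r · x) * a + (- (osc p · x)) * b) + ((- (dbl r p · x)) * (c · tan p r) + (dbl p r · x) * α)) cp cr)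
        (solve 6 (λ o o′ d τ d′ α → (o :* O :+ :- o′ :* O) :+ (:- d :* τ :+ d′ :* α) := α :* d′ :+ :- τ :* d) refl (osc r · x) (osc p · x) (dbl r p · x) (c · tan p r) (dbl p r · x) α))
      only : ∀ {l x y} → cube (cross p r) * x ≡ l * y → x ≡ inv₀ (cube (cross p r)) * l * y
      only {l} {x} {y} e = *-cancelˡ (cube≢0 δ≢0) (trans e (sym (trans (cong (cube (cross p r) *_) (*-assoc _ l y)) (x*i*y _ (cube≢0 δ≢0)))))
      scale≢0 : ∀ {d} → (l : Carrier) → c ≡ (inv₀ (cube (cross p r)) * l) ⊙ d → inv₀ (cube (cross p r)) * l ≢ 0#
      scale≢0 {d} l e z = c≢0 (trans e (trans (cong (_⊙ d) z) (0⊙ d)))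
      only-α : β ≡ 0# → c ≡ (inv₀ (cube (cross p r)) * α) ⊙ dbl p r
      only-α β≡0 = ·-nondegenerate _ _ (λ x → trans (only (trans (expand-c x) (trans (cong (λ b → α * (dbl p r · x) + b * (dbl r p · x)) β≡0)
        (solve 2 (λ a d → a :+ O :* d := a) refl (α * (dbl p r · x)) (dbl r p · x))))) (sym (·-⊙ _ (dbl p r) x)))
      only-β : α ≡ 0# → c ≡ (inv₀ (cube (cross p r)) * β) ⊙ dbl r p
      only-β α≡0 = ·-nondegenerate _ _ (λ x → trans (only (trans (expand-c x) (trans (cong (λ a → a * (dbl p r · x) + β * (dbl r p · x)) α≡0)
        (solve 2 (λ b d → O :* d :+ b := b) refl (β * (dbl r p · x)) (dbl p r · x))))) (sym (·-⊙ _ (dbl r p) x)))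
      z : Carrier × Carrier
      z = α * proj₁ p + β * proj₁ r , α * proj₂ p + β * proj₂ r
      z×p : cross z p ≡ β * cross r p
      z×p = trans (cross-combˡ α β _ _ _ _ p) (trans (cong (λ x → α * x + β * cross r p) (cross-self p)) (solve 2 (λ α x → α :* O :+ x := x) refl α (β * cross r p)))
      z×r : cross z r ≡ α * cross p r
      z×r = trans (cross-combˡ α β _ _ _ _ r) (trans (cong (λ x → α * cross p r + β * x) (cross-self r)) (solve 2 (λ β x → x :+ β :* O := x) refl β (α * cross p r)))
      r×p≢0 : cross r p ≢ 0#
      r×p≢0 = cross≢0 (λ e → s≢t (sym e))
      z≢0 : ¬ (proj₁ z ≡ 0# × proj₂ z ≡ 0#)
      z≢0 (e , f) = scale≢0 α (only-α β≡0) (trans (cong (inv₀ (cube (cross p r)) *_) α≡0) (zeroʳ _))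
        where
        zero× : ∀ w → cross z w ≡ 0#
        zero× w = trans (cong₂ (λ a b → cross (a , b) w) (trans e (sym (zeroˡ 0#))) (trans f (sym (zeroˡ 0#)))) (trans (cross-scaleˡ 0# 0# 0# w) (zeroˡ _))
        β≡0 = zero⇒ˡ r×p≢0 (trans (sym z×p) (zero× p))
        α≡0 = zero⇒ˡ δ≢0 (trans (sym z×r) (zero× r))
      deh = dehomogenize (proj₁ z) (proj₂ z) z≢0
      m : Maybe Carrier
      m = proj₁ deh
      k : Carrier
      k = proj₁ (proj₂ deh)
      k≢0 : k ≢ 0#
      k≢0 = proj₁ (proj₂ (proj₂ deh))
      z×≡ : ∀ w → cross z w ≡ k * cross (hom m) w
      z×≡ w = trans (cong₂ (λ a b → cross (a , b) w) (proj₁ (proj₂ (proj₂ (proj₂ deh)))) (proj₂ (proj₂ (proj₂ (proj₂ deh)))))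
        (cross-scaleˡ k (proj₁ (hom m)) (proj₂ (hom m)) w)
      mp mr : Carrier
      mp = cross (hom m) p
      mr = cross (hom m) r
      third : α * mp + β * mr ≡ 0#
      third = zero⇒ k≢0 (begin
        k * (α * mp + β * mr)           ≡⟨ solve 5 (λ k α β a b → k :* (α :* a :+ β :* b) := α :* (k :* a) :+ β :* (k :* b)) refl k α β mp mr ⟩
        α * (k * mp) + β * (k * mr)     ≡⟨ cong₂ (λ a b → α * a + β * b) (trans (sym (z×≡ p)) z×p) (trans (sym (z×≡ r)) z×r) ⟩
        α * (β * cross r p) + β * (α * cross p r) ≡⟨ cong (λ x → α * (β * cross r p) + β * (α * x)) (cross-anti p r) ⟩
        α * (β * cross r p) + β * (α * - cross r p) ≡⟨ solve 3 (λ α β x → α :* (β :* x) :+ β :* (α :* :- x) := O) refl α β (cross r p) ⟩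
        0# ∎)
        where open ≡-Reasoning
      root : c · cub (hom m) ≡ 0#
      root = zero⇒ (cube≢0 δ≢0) (trans (expand-c (cub (hom m))) (trans (cong₂ (λ a b → α * a + β * b) (dbl-cub p r (hom m)) (dbl-cub r p (hom m)))
        (trans (solve 4 (λ α β a b → α :* (a :* a :* b) :+ β :* (b :* b :* a) := a :* b :* (α :* a :+ β :* b)) refl α β mp mr) (*-zeroʳ (mp * mr) third))))
      conclude : m ≡ s ⊎ m ≡ t → ∃[ l ] (l ≢ 0# × (c ≡ l ⊙ dbl p r ⊎ c ≡ l ⊙ dbl r p))
      conclude (inj₁ m≡s) = _ , scale≢0 α (only-α β≡0) , inj₁ (only-α β≡0)
        where
        β≡0 : β ≡ 0#
        β≡0 = zero⇒ˡ r×p≢0 (trans (sym z×p) (trans (z×≡ p) (trans (cong (λ w → k * cross (hom w) p) m≡s) (*-zeroʳ k (cross-self p)))))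
      conclude (inj₂ m≡t) = _ , scale≢0 β (only-β α≡0) , inj₂ (only-β α≡0)
        where
        α≡0 : α ≡ 0#
        α≡0 = zero⇒ˡ δ≢0 (trans (sym z×r) (trans (z×≡ r) (trans (cong (λ w → k * cross (hom w) r) m≡t) (*-zeroʳ k (cross-self r)))))

  record DoubleRoot (c : V4) : Set where
    constructor doubleRoot
    field
      {double simple} : Maybe Carrier
      double≢simple : double ≢ simple
      {scalar} : Carrier
      scalar≢0 : scalar ≢ 0#
      coeff≡ : c ≡ scalar ⊙ dbl (hom double) (hom simple)

  two-points⇒doubleRoot : ∀ π → Is2CPlane π → DoubleRoot (coeff π)
  two-points⇒doubleRoot π@(c , c≢0) two = pick (tangent-at-root s≢t c c≢0 (root zero) (root (suc zero)) only)
    where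
    open Count≡ {P = λ t → c · Pt t ≡ 0#} two
    s t : Maybe Carrier
    s = elem zero
    t = elem (suc zero)
    s≢t : s ≢ t
    s≢t e = Finₚ.0≢1+n (injective zero (suc zero) e)
    root : ∀ i → c · cub (hom (elem i)) ≡ 0#
    root i = trans (cong (c ·_) (sym (Pt≡cub (elem i)))) (valid i)
    only : ∀ w → c · cub (hom w) ≡ 0# → w ≡ s ⊎ w ≡ t
    only w e = which _ (elem-index w (trans (cong (c ·_) (Pt≡cub w)) e))
      where
      which : ∀ i → w ≡ elem i → w ≡ s ⊎ w ≡ t
      which zero p = inj₁ p
      which (suc zero) p = inj₂ p
    pick : ∃[ l ] (l ≢ 0# × (c ≡ l ⊙ dbl (hom s) (hom t) ⊎ c ≡ l ⊙ dbl (hom t) (hom s))) → DoubleRoot c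
    pick (l , l≢0 , inj₁ e) = doubleRoot s≢t l≢0 e
    pick (l , l≢0 , inj₂ e) = doubleRoot (λ p → s≢t (sym p)) l≢0 e

  dbl-two-points : ∀ {s t} (s≢t : s ≢ t) → Is2CPlane (dbl (hom s) (hom t) , dbl≢0 s≢t)
  dbl-two-points {s} {t} s≢t = mkCount _≡_ {P = λ w → dbl (hom s) (hom t) · Pt w ≡ 0#} f f-root f-inj f-surj
    where
    f : Fin 2 → Maybe Carrier
    f zero = s
    f (suc zero) = t
    f-root : ∀ i → dbl (hom s) (hom t) · Pt (f i) ≡ 0#
    f-root zero = trans (cong (dbl (hom s) (hom t) ·_) (Pt≡cub s)) (dbl-cub₁ (hom s) (hom t))
    f-root (suc zero) = trans (cong (dbl (hom s) (hom t) ·_) (Pt≡cub t)) (dbl-cub₂ (hom s) (hom t))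
    f-inj : ∀ i j → f i ≡ f j → i ≡ j
    f-inj zero zero e = refl
    f-inj zero (suc zero) e = ⊥-elim (s≢t e)
    f-inj (suc zero) zero e = ⊥-elim (s≢t (sym e))
    f-inj (suc zero) (suc zero) e = refl
    f-surj : ∀ w → dbl (hom s) (hom t) · Pt w ≡ 0# → ∃[ i ] (w ≡ f i)
    f-surj w e = [ (λ p → zero , p) , (λ p → suc zero , p) ] (dbl-root {s} {t} {w} e)

  count-Maybe : CountIs _≡_ (λ (_ : Maybe Carrier) → ⊤) (suc q)
  count-Maybe = count-map _≡_ (count-⊎ (count-singleton tt) order) f (λ _ _ → tt) f-inj f-surj
    where
    f : ⊤ ⊎ Carrier → Maybe Carrier
    f (inj₁ _) = nothing
    f (inj₂ t) = just t
    f-inj : ∀ a b → [ (λ x → x ≡ tt) , (λ _ → ⊤) ] a → [ (λ x → x ≡ tt) , (λ _ → ⊤) ] b → f a ≡ f b → a ≡ b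
    f-inj (inj₁ _) (inj₁ _) _ _ e = refl
    f-inj (inj₂ x) (inj₂ y) _ _ refl = refl
    f-surj : ∀ b → ⊤ → ∃[ a ] ([ (λ x → x ≡ tt) , (λ _ → ⊤) ] a × b ≡ f a)
    f-surj nothing _ = inj₁ tt , refl , refl
    f-surj (just t) _ = inj₂ t , tt , refl

  -- The ordered pair consists of the double and the simple root. The zeros of the form recover the
  -- unordered pair, and the pairing with a tangent vector recovers its order.
  count-2C : CountIs SamePlane Is2CPlane (suc q ℕ.* q)
  count-2C = count-map SamePlane
      (count-× {P = λ _ → ⊤} {Q = λ s t → ⊤ × t ≢ s} count-Maybe (λ s _ → count-remove count-Maybe s tt))
      plane plane-valid plane-inj plane-surj
    where
    planeDec : ∀ s t → Dec (t ≡ s) → PlaneRep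
    planeDec s t (no t≢s) = dbl (hom s) (hom t) , dbl≢0 (λ p → t≢s (sym p))
    -- A default value outside the counted pairs.
    planeDec s t (yes _) = πinfV , λ p → 0≢1 (sym (cong (λ v → proj₂ (proj₂ (proj₂ v))) p))
    plane : Maybe Carrier × Maybe Carrier → PlaneRep
    plane (s , t) = planeDec s t (t ≟ᴹ s)
    plane-coeff : ∀ s t → t ≢ s → coeff (plane (s , t)) ≡ dbl (hom s) (hom t)
    plane-coeff s t t≢s = go (t ≟ᴹ s)
      where
      go : ∀ d → coeff (planeDec s t d) ≡ dbl (hom s) (hom t)
      go (yes e) = ⊥-elim (t≢s e)
      go (no _) = refl
    plane-valid : ∀ x → ⊤ × ⊤ × proj₂ x ≢ proj₁ x → Is2CPlane (plane x)
    plane-valid (s , t) (_ , _ , t≢s) = go (t ≟ᴹ s)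
      where
      go : ∀ d → Is2CPlane (planeDec s t d)
      go (yes e) = ⊥-elim (t≢s e)
      go (no t≢s′) = dbl-two-points (λ p → t≢s′ (sym p))
    plane-inj : ∀ x y → ⊤ × ⊤ × proj₂ x ≢ proj₁ x → ⊤ × ⊤ × proj₂ y ≢ proj₁ y → SamePlane (plane x) (plane y) → x ≡ y
    plane-inj (s , t) (s′ , t′) (_ , _ , t≢s) (_ , _ , t′≢s′) (l , l≢0 , e) = conclude (common (hom s′) (dbl-cub₁ (hom s′) (hom t′)) s′ refl) (common (hom t′) (dbl-cub₂ (hom s′) (hom t′)) t′ refl)
      where
      e′ : ∀ x → dbl (hom s′) (hom t′) · x ≡ l * (dbl (hom s) (hom t) · x)
      e′ x = trans (cong (_· x) (trans (sym (plane-coeff s′ t′ t′≢s′)) (trans e (cong (l ⊙_) (plane-coeff s t t≢s))))) (·-⊙ l _ x)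
      common : ∀ p → dbl (hom s′) (hom t′) · cub p ≡ 0# → ∀ w → p ≡ hom w → w ≡ s ⊎ w ≡ t
      common p z w refl = dbl-root (trans (cong (dbl (hom s) (hom t) ·_) (Pt≡cub w)) (zero⇒ l≢0 (trans (sym (e′ (cub p))) z)))
      conclude : s′ ≡ s ⊎ s′ ≡ t → t′ ≡ s ⊎ t′ ≡ t → (s , t) ≡ (s′ , t′)
      conclude (inj₁ p) (inj₂ r) = cong₂ _,_ (sym p) (sym r)
      conclude (inj₁ p) (inj₁ r) = ⊥-elim (t′≢s′ (trans r (sym p)))
      conclude (inj₂ p) (inj₂ r) = ⊥-elim (t′≢s′ (trans r (sym p)))
      -- The roots are interchanged: `tan (hom s) (hom t)` is killed by the form with double root s
      -- but not by the one with double root t.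
      conclude (inj₂ refl) (inj₁ refl) = ⊥-elim (*≢0 (*≢0 (cross≢0 s≢t) (cross≢0 s≢t)) (cross≢0 t≢s)
          (trans (sym (dbl-tan₂ (hom t) (hom s))) (trans (e′ (tan (hom s) (hom t))) (*-zeroʳ l (dbl-tan₁ (hom s) (hom t))))))
        where
        s≢t : s ≢ t
        s≢t p = t≢s (sym p)
    plane-surj : ∀ π → Is2CPlane π → ∃[ x ] ((⊤ × ⊤ × proj₂ x ≢ proj₁ x) × SamePlane π (plane x))
    plane-surj π two = (double , simple) , (tt , tt , simple≢double) , inv₀ scalar , inv₀≢0 scalar≢0 ,
        trans (plane-coeff double simple simple≢double) (⊙-unscale scalar≢0 (sym coeff≡))
      where
      open DoubleRoot (two-points⇒doubleRoot π two)
      simple≢double = λ p → double≢simple (sym p)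

-- Normal forms of lines, and Γ-planes

module Lines {q : ℕ} (F : FiniteField q) where
  open FiniteField F
  open FieldProperties F
  open Geometry F
  open Cubic F
  open Planes F

  onLine-trans : ∀ L M {x} → OnLine (gen₁ M) L → OnLine (gen₂ M) L → OnLine x M → OnLine x L
  onLine-trans L M p r x∈M = span-trans x∈M p r

  kills-span : ∀ {c u v u′ v′} → InSpan u′ u v → InSpan v′ u v → Kills c u v → Kills c u′ v′
  kills-span {c} p r (k , l) = ·-span c p k l , ·-span c r k l

  -- If φ and ψ are independent on a line, the line has a unique basis dual to them, as in a reduced
  -- echelon form with pivots φ and ψ. Used with `osc p` and `dbl r p` inside a 2_C-plane, and with
  -- coordinate functionals for lines in general.
  module Chart (φ ψ : V4) where

    minor : V4 → V4 → Carrier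
    minor u v = φ · u * (ψ · v) + - (φ · v * (ψ · u))

    record DualBasis (p y : V4) : Set where
      field
        φp : φ · p ≡ 1#
        ψp : ψ · p ≡ 0#
        φy : φ · y ≡ 0#
        ψy : ψ · y ≡ 1#

      coordinates : ∀ {a b} → φ · ((a ⊙ p) ⊕ (b ⊙ y)) ≡ a × ψ · ((a ⊙ p) ⊕ (b ⊙ y)) ≡ b
      coordinates {a} {b} =
        trans (·-comb φ a b p y) (trans (cong₂ (λ x y → a * x + b * y) φp φy) (solve 2 (λ a b → a :* I :+ b :* O := a) refl a b)) ,
        trans (·-comb ψ a b p y) (trans (cong₂ (λ x y → a * x + b * y) ψp ψy) (solve 2 (λ a b → a :* O :+ b :* I := b) refl a b))

      expand : ∀ {x} → InSpan x p y → x ≡ ((φ · x) ⊙ p) ⊕ ((ψ · x) ⊙ y)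
      expand (a , b , e) = trans e (sym (cong₂ (λ a b → (a ⊙ p) ⊕ (b ⊙ y))
        (trans (cong (φ ·_) e) (proj₁ coordinates)) (trans (cong (ψ ·_) e) (proj₂ coordinates))))

      independent : Indep p y
      independent a b e = trans (sym (proj₁ coordinates)) (trans (cong (φ ·_) e) (·-zeroV φ)) ,
        trans (sym (proj₂ coordinates)) (trans (cong (ψ ·_) e) (·-zeroV ψ))

      line : LineRep
      line = (p , y) , independent

    record Normalized (u v : V4) : Set where
      field
        {p y} : V4
        dual : DualBasis p y
        p∈ : InSpan p u v
        y∈ : InSpan y u v
        u∈ : InSpan u p y
        v∈ : InSpan v p y

    normalize : ∀ {u v} → minor u v ≢ 0# → Normalized u v
    normalize {u@(u₀ , u₁ , u₂ , u₃)} {v@(v₀ , v₁ , v₂ , v₃)} m≢0 = record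
      { dual = record
        { φp = trans (·-comb φ (i * ψv) (- (i * ψu)) u v) (trans (solve 5 (λ i a b c d → i :* d :* a :+ :- (i :* b) :* c := (a :* d :+ :- (c :* b)) :* i) refl i φu ψu φv ψv) (*-inv₀ m≢0))
        ; ψp = trans (·-comb ψ (i * ψv) (- (i * ψu)) u v) (solve 3 (λ i b d → i :* d :* b :+ :- (i :* b) :* d := O) refl i ψu ψv)
        ; φy = trans (·-comb φ (- (i * φv)) (i * φu) u v) (solve 3 (λ i a c → :- (i :* c) :* a :+ i :* a :* c := O) refl i φu φv)
        ; ψy = trans (·-comb ψ (- (i * φv)) (i * φu) u v) (trans (solve 5 (λ i a b c d → :- (i :* c) :* b :+ i :* a :* d := (a :* d :+ :- (c :* b)) :* i) refl i φu ψu φv ψv) (*-inv₀ m≢0)) }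
      ; p∈ = i * ψv , - (i * ψu) , refl
      ; y∈ = - (i * φv) , i * φu , refl
      ; u∈ = φu , ψu , ≡V4 (eu u₀ v₀) (eu u₁ v₁) (eu u₂ v₂) (eu u₃ v₃)
      ; v∈ = φv , ψv , ≡V4 (ev u₀ v₀) (ev u₁ v₁) (ev u₂ v₂) (ev u₃ v₃) }
      where
      i φu ψu φv ψv : Carrier
      i = inv₀ (minor u v)
      φu = φ · u
      ψu = ψ · u
      φv = φ · v
      ψv = ψ · v
      eu : ∀ x y → x ≡ φu * (i * ψv * x + - (i * ψu) * y) + ψu * (- (i * φv) * x + i * φu * y)
      eu x y = trans (sym (trans (cong (_* x) (*-inv₀ m≢0)) (*-identityˡ x)))
        (solve 7 (λ i a b c d x y → (a :* d :+ :- (c :* b)) :* i :* x := a :* (i :* d :* x :+ :- (i :* b) :* y) :+ b :* (:- (i :* c) :* x :+ i :* a :* y)) refl i φu ψu φv ψv x y)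
      ev : ∀ x y → y ≡ φv * (i * ψv * x + - (i * ψu) * y) + ψv * (- (i * φv) * x + i * φu * y)
      ev x y = trans (sym (trans (cong (_* y) (*-inv₀ m≢0)) (*-identityˡ y)))
        (solve 7 (λ i a b c d x y → (a :* d :+ :- (c :* b)) :* i :* y := c :* (i :* d :* x :+ :- (i :* b) :* y) :+ d :* (:- (i :* c) :* x :+ i :* a :* y)) refl i φu ψu φv ψv x y)

    -- A nonzero row of the singular matrix of values supplies the coefficients of the vector; if
    -- the matrix is zero, u itself serves.
    kernel : ∀ {u v} → Indep u v → minor u v ≡ 0# → ∃[ z ] (InSpan z u v × z ≢ zeroV × φ · z ≡ 0# × ψ · z ≡ 0#)
    kernel {u} {v} ind m≡0 = go (φ · u ≟ 0#) (φ · v ≟ 0#) (ψ · u ≟ 0#) (ψ · v ≟ 0#)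
      where
      comb : ∀ a b → ¬ (a ≡ 0# × b ≡ 0#) → a * (φ · u) + b * (φ · v) ≡ 0# → a * (ψ · u) + b * (ψ · v) ≡ 0# →
        ∃[ z ] (InSpan z u v × z ≢ zeroV × φ · z ≡ 0# × ψ · z ≡ 0#)
      comb a b ab≢0 e f = (a ⊙ u) ⊕ (b ⊙ v) , (a , b , refl) , (λ z → ab≢0 (ind a b z)) , trans (·-comb φ a b u v) e , trans (·-comb ψ a b u v) f
      0-neg : ∀ {x} → x ≢ 0# → - x ≢ 0#
      0-neg {x} x≢0 e = x≢0 (trans (solve 1 (λ x → x := :- (:- x)) refl x) (trans (cong -_ e) (solve 0 (:- O := O) refl)))
      via-φ : ¬ (- (φ · v) ≡ 0# × φ · u ≡ 0#) → ∃[ z ] (InSpan z u v × z ≢ zeroV × φ · z ≡ 0# × ψ · z ≡ 0#)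
      via-φ n = comb (- (φ · v)) (φ · u) n (solve 2 (λ a c → :- c :* a :+ a :* c := O) refl (φ · u) (φ · v))
        (trans (solve 4 (λ a b c d → :- c :* b :+ a :* d := a :* d :+ :- (c :* b)) refl (φ · u) (ψ · u) (φ · v) (ψ · v)) m≡0)
      via-ψ : ¬ (ψ · v ≡ 0# × - (ψ · u) ≡ 0#) → ∃[ z ] (InSpan z u v × z ≢ zeroV × φ · z ≡ 0# × ψ · z ≡ 0#)
      via-ψ n = comb (ψ · v) (- (ψ · u)) n
        (trans (solve 4 (λ a b c d → d :* a :+ :- b :* c := a :* d :+ :- (c :* b)) refl (φ · u) (ψ · u) (φ · v) (ψ · v)) m≡0)
        (solve 2 (λ b d → d :* b :+ :- b :* d := O) refl (ψ · u) (ψ · v))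
      go : Dec (φ · u ≡ 0#) → Dec (φ · v ≡ 0#) → Dec (ψ · u ≡ 0#) → Dec (ψ · v ≡ 0#) → ∃[ z ] (InSpan z u v × z ≢ zeroV × φ · z ≡ 0# × ψ · z ≡ 0#)
      go (no n) _ _ _ = via-φ (λ x → n (proj₂ x))
      go (yes _) (no n) _ _ = via-φ (λ x → 0-neg n (proj₁ x))
      go (yes _) (yes _) (no n) _ = via-ψ (λ x → 0-neg n (proj₂ x))
      go (yes _) (yes _) (yes _) (no n) = via-ψ (λ x → n (proj₁ x))
      go (yes φu) (yes φv) (yes ψu) (yes ψv) = comb 1# 0# (λ x → 0≢1 (sym (proj₁ x))) (comb0 1# 0# φu φv) (comb0 1# 0# ψu ψv)

  ΓV : Maybe Carrier → V4
  ΓV (just t) = oscV t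
  ΓV nothing  = πinfV

  Γ-index : ∀ π → IsΓPlane π → ∃[ τ ] (coeff π ≡ ΓV τ)
  Γ-index π (inj₁ (t , e)) = just t , e
  Γ-index π (inj₂ e) = nothing , e

  kills-Γ⇒osc : ∀ τ {u v} → Kills (ΓV τ) u v → Kills (osc (hom τ)) u v
  kills-Γ⇒osc (just t) {u} {v} = subst (λ c → Kills c u v) (oscV≡osc t)
  kills-Γ⇒osc nothing {u} {v} (k , l) = zero⇒ -1≢0 (trans (sym (·-⊙ (- 1#) _ u)) (trans (cong (_· u) (sym πinfV≡osc)) k)) ,
      zero⇒ -1≢0 (trans (sym (·-⊙ (- 1#) _ v)) (trans (cong (_· v) (sym πinfV≡osc)) l))
    where
    -1≢0 : - 1# ≢ 0#
    -1≢0 e = 0≢1 (trans (solve 0 (O := :- O) refl) (trans (cong -_ (sym e)) (solve 0 (:- (:- I) := I) refl)))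

  kills-osc⇒Γ : ∀ τ {u v} → Kills (osc (hom τ)) u v → Kills (ΓV τ) u v
  kills-osc⇒Γ (just t) {u} {v} = subst (λ c → Kills c u v) (sym (oscV≡osc t))
  kills-osc⇒Γ nothing {u} {v} (k , l) = trans (cong (_· u) πinfV≡osc) (trans (·-⊙ (- 1#) _ u) (*-zeroʳ _ k)) ,
    trans (cong (_· v) πinfV≡osc) (trans (·-⊙ (- 1#) _ v) (*-zeroʳ _ l))

  kills-scale : ∀ {c d l u v} → l ≢ 0# → d ≡ l ⊙ c → Kills d u v → Kills c u v
  kills-scale {c} {d} {l} {u} {v} l≢0 refl (k , k′) = zero⇒ l≢0 (trans (sym (·-⊙ l c u)) k) , zero⇒ l≢0 (trans (sym (·-⊙ l c v)) k′)

  kills-unscale : ∀ {c d l u v} → d ≡ l ⊙ c → Kills c u v → Kills d u v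
  kills-unscale {c} {d} {l} {u} {v} refl (k , k′) = trans (·-⊙ l c u) (*-zeroʳ l k) , trans (·-⊙ l c v) (*-zeroʳ l k′)

  ΓV-nonzero : ∀ τ → ¬ (ΓV τ ≡ zeroV)
  ΓV-nonzero (just t) e = 0≢1 (sym (cong proj₁ e))
  ΓV-nonzero nothing e = 0≢1 (sym (cong (λ v → proj₂ (proj₂ (proj₂ v))) e))

  ΓPlane : Maybe Carrier → PlaneRep
  ΓPlane τ = ΓV τ , ΓV-nonzero τ

  ΓPlane-isΓ : ∀ τ → ΓPlaneOf (ΓPlane τ)
  ΓPlane-isΓ τ = ΓPlane τ , go τ , 1# , (λ e → 0≢1 (sym e)) , sym (⊙-identity _)
    where
    go : ∀ τ → IsΓPlane (ΓPlane τ)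
    go (just t) = inj₁ (t , refl)
    go nothing = inj₂ refl

  ΓPlaneOf⇒kills-osc : ∀ L π → ΓPlaneOf π → L ⊆π π → ∃[ τ ] Kills (osc (hom τ)) (gen₁ L) (gen₂ L)
  ΓPlaneOf⇒kills-osc L π (ρ , isΓ , l , l≢0 , e) k =
    let τ , e′ = Γ-index ρ isΓ in τ , kills-Γ⇒osc τ (subst (λ c → Kills c (gen₁ L) (gen₂ L)) e′ (kills-scale l≢0 e k))

-- Base change from F to K

module Extension {q : ℕ} (2≤q : 2 ℕ.≤ q) {F : FiniteField q} (E : QuadExt F) where
  open QuadExt E using (ι; ι-+; ι-*; ι-1; ι-inj; ιV; Irrational; IsImagAxis; IsImagChord; IsEnΓ; K)
  open QuadExtProperties 2≤q E
  open FiniteField F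
  open Lines F
  private
    module KF = FiniteField K
    module KP = FieldProperties K
    module GF = Geometry F
    module CF = Cubic F
    module GK = Geometry K
    module CK = Cubic K
    module PF = Planes F
    module PK = Planes K
    module LK = Lines K

  ι-· : ∀ c x → ι (c · x) ≡ ιV c KF.· ιV x
  ι-· (a , b , c , d) (x , y , z , w) = trans (ι-+ _ _) (cong₂ KF._+_ (trans (ι-+ _ _) (cong₂ KF._+_ (trans (ι-+ _ _) (cong₂ KF._+_ (ι-* a x) (ι-* b y))) (ι-* c z))) (ι-* d w))

  ιV-comb : ∀ a b u v → ιV ((a ⊙ u) ⊕ (b ⊙ v)) ≡ (ι a KF.⊙ ιV u) KF.⊕ (ι b KF.⊙ ιV v)
  ιV-comb a b (u₀ , u₁ , u₂ , u₃) (v₀ , v₁ , v₂ , v₃) = GK.≡V4 (e u₀ v₀) (e u₁ v₁) (e u₂ v₂) (e u₃ v₃)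
    where
    e : ∀ x y → ι (a * x + b * y) ≡ ι a KF.* ι x KF.+ ι b KF.* ι y
    e x y = trans (ι-+ _ _) (cong₂ KF._+_ (ι-* a x) (ι-* b y))

  ι-span : ∀ {x u v} → InSpan x u v → KF.InSpan (ιV x) (ιV u) (ιV v)
  ι-span {u = u} {v} (a , b , e) = ι a , ι b , trans (cong ιV e) (ιV-comb a b u v)

  ι-kills : ∀ {c u v} → GF.Kills c u v → GK.Kills (ιV c) (ιV u) (ιV v)
  ι-kills {c} {u} {v} (k , l) = trans (sym (ι-· c u)) (trans (cong ι k) ι-0) , trans (sym (ι-· c v)) (trans (cong ι l) ι-0)

  ι-minor : ∀ {u v} → GF.NonzeroMinor u v → GK.NonzeroMinor (ιV u) (ιV v)
  ι-minor = go
    where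
    nz : ∀ a b c d → a * b + - (c * d) ≢ 0# → ι a KF.* ι b KF.+ KF.- (ι c KF.* ι d) ≢ KF.0#
    nz a b c d n e = n (ι-inj _ _ (trans (ι-+ _ _) (trans (cong₂ KF._+_ (ι-* a b) (trans (ι-neg _) (cong KF.-_ (ι-* c d)))) (trans e (sym ι-0)))))
    go : ∀ {u v} → GF.NonzeroMinor u v → GK.NonzeroMinor (ιV u) (ιV v)
    go (GF.m₀₁ n) = GK.m₀₁ (nz _ _ _ _ n)
    go (GF.m₀₂ n) = GK.m₀₂ (nz _ _ _ _ n)
    go (GF.m₀₃ n) = GK.m₀₃ (nz _ _ _ _ n)
    go (GF.m₁₂ n) = GK.m₁₂ (nz _ _ _ _ n)
    go (GF.m₁₃ n) = GK.m₁₃ (nz _ _ _ _ n)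
    go (GF.m₂₃ n) = GK.m₂₃ (nz _ _ _ _ n)

  ι-independent : ∀ {u v} → Indep u v → KF.Indep (ιV u) (ιV v)
  ι-independent ind = GK.minor⇒independent (ι-minor (GF.independent⇒minor ind))

  ιP : Carrier × Carrier → KF.Carrier × KF.Carrier
  ιP (x , y) = ι x , ι y

  ιP-hom : ∀ s → ιP (CF.hom s) ≡ CK.hom (Maybe.map ι s)
  ιP-hom (just t) = cong (ι t ,_) ι-1
  ιP-hom nothing = cong₂ _,_ ι-1 ι-0

  opaque
    unfolding Geometry.dbl

    ι-dbl : ∀ p r → ιV (GF.dbl p r) ≡ GK.dbl (ιP p) (ιP r)
    ι-dbl (x , y) (z , w) = GK.≡V4 (ι³ y y w)
      (trans (ι-neg _) (cong KF.-_ (trans (ι-+ _ _) (cong₂ KF._+_ (trans (ι-+ _ _) (cong₂ KF._+_ (ι³ x y w) (ι³ y x w))) (ι³ y y z)))))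
      (trans (ι-+ _ _) (cong₂ KF._+_ (trans (ι-+ _ _) (cong₂ KF._+_ (ι³ x x w) (ι³ x y z))) (ι³ y x z)))
      (trans (ι-neg _) (cong KF.-_ (ι³ x x z)))
      where
      ι³ : ∀ x y z → ι (x * y * z) ≡ ι x KF.* ι y KF.* ι z
      ι³ x y z = trans (ι-* _ z) (cong (KF._* ι z) (ι-* x y))

  ι-dbl-kills : ∀ {s t u v} → GF.Kills (GF.dbl (CF.hom s) (CF.hom t)) u v →
    GK.Kills (GK.dbl (CK.hom (Maybe.map ι s)) (CK.hom (Maybe.map ι t))) (ιV u) (ιV v)
  ι-dbl-kills {s} {t} {u} {v} k = subst (λ c → GK.Kills c (ιV u) (ιV v)) (trans (ι-dbl _ _) (cong₂ GK.dbl (ιP-hom s) (ιP-hom t))) (ι-kills {u = u} {v} k)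

  map-ι-injective : ∀ s t → Maybe.map ι s ≡ Maybe.map ι t → s ≡ t
  map-ι-injective (just s) (just t) e = cong just (ι-inj s t (just-injective e))
  map-ι-injective nothing nothing e = refl

  -- Over K the line lies in the osculating planes at σ and σ^q, which differ because the q-th power
  -- fixes only elements of F; so `dbl-plane∌axis` applies over K.
  dbl-plane∌imagAxis : ∀ {s t} L → s ≢ t → GF.Kills (GF.dbl (CF.hom s) (CF.hom t)) (gen₁ L) (gen₂ L) → ¬ IsImagAxis L
  dbl-plane∌imagAxis {s} {t} ((u , v) , ind) s≢t k (σ , irr , e₁ , e₂ , e₃ , e₄) =
    CK.dbl-plane∌axis {Maybe.map ι s} {Maybe.map ι t} {just σ} {just (σ KF.^ q)} {ιV u} {ιV v} (λ e → s≢t (map-ι-injective s t e))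
      (λ e → irrational⇒^q≢ σ irr (sym (just-injective e)))
      (ι-independent ind) (ι-dbl-kills {s} {t} {u} {v} k)
      (LK.kills-Γ⇒osc (just σ) (e₁ , e₂)) (LK.kills-Γ⇒osc (just (σ KF.^ q)) (e₃ , e₄))

  -- Over K the roots of the form are still the rational s and t, whereas a chord would make the
  -- irrational σ a root.
  dbl-plane∌imagChord : ∀ {s t} L → GF.Kills (GF.dbl (CF.hom s) (CF.hom t)) (gen₁ L) (gen₂ L) → ¬ IsImagChord L
  dbl-plane∌imagChord {s} {t} ((u , v) , ind) k (σ , irr , σ∈ , _) =
    [ rational s , rational t ] (PK.dbl-root {Maybe.map ι s} {Maybe.map ι t} {just σ}
      (GK.·-span (GK.dbl (CK.hom (Maybe.map ι s)) (CK.hom (Maybe.map ι t))) σ∈ (proj₁ kι) (proj₂ kι)))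
    where
    kι = ι-dbl-kills {s} {t} {u} {v} k
    rational : ∀ s → just σ ≡ Maybe.map ι s → ⊥
    rational (just a) e = irr (a , sym (just-injective e))

  enΓ-resp : ∀ L M → SameLine L M → IsEnΓ L → IsEnΓ M
  enΓ-resp L M (m₁ , m₂ , l₁ , l₂) (no-pt , no-Γ , no-chord , no-axis) =
    (λ t p → no-pt t (onLine-trans L M m₁ m₂ p)) ,
    (λ π isΓ k → no-Γ π isΓ (kills-span {coeff π} l₁ l₂ k)) ,
    (λ { (σ , irr , p , r) → no-chord (σ , irr , GK.span-trans p (ι-span m₁) (ι-span m₂) , GK.span-trans r (ι-span m₁) (ι-span m₂)) }) ,
    (λ ¬3∣q → λ { (σ , irr , e₁ , e₂ , e₃ , e₄) → no-axis ¬3∣q (σ , irr ,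
      GK.·-span (KF.oscV σ) (ι-span l₁) e₁ e₂ , GK.·-span (KF.oscV σ) (ι-span l₂) e₁ e₂ ,
      GK.·-span (KF.oscV (σ KF.^ q)) (ι-span l₁) e₃ e₄ , GK.·-span (KF.oscV (σ KF.^ q)) (ι-span l₂) e₃ e₄) })

  2C-plane∌realAxis : ∀ π → Is2CPlane π → ∀ L → IsRealAxis L → ¬ (L ⊆π π)
  2C-plane∌realAxis π two L@((u , v) , ind) (ρ , ρ′ , isΓ , isΓ′ , differ , k , k′) l =
    CF.dbl-plane∌axis double≢simple σ≢τ ind (kills-scale scalar≢0 coeff≡ l)
      (kills-Γ⇒osc σ (subst (λ c → GF.Kills c u v) e k)) (kills-Γ⇒osc τ (subst (λ c → GF.Kills c u v) e′ k′))
    where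
    open PF.DoubleRoot (PF.two-points⇒doubleRoot π two)
    σ τ : Maybe Carrier
    σ = proj₁ (Γ-index ρ isΓ)
    τ = proj₁ (Γ-index ρ′ isΓ′)
    e = proj₂ (Γ-index ρ isΓ)
    e′ = proj₂ (Γ-index ρ′ isΓ′)
    σ≢τ : σ ≢ τ
    σ≢τ p = differ (1# , (λ z → 0≢1 (sym z)) , trans e′ (trans (cong ΓV (sym p)) (trans (sym e) (sym (PF.⊙-identity _)))))

  2C-plane∌imagAxis : ∀ π → Is2CPlane π → ∀ L → IsImagAxis L → ¬ (L ⊆π π)
  2C-plane∌imagAxis π two L axis l = dbl-plane∌imagAxis {double} {simple} L double≢simple (kills-scale scalar≢0 coeff≡ l) axis
    where open PF.DoubleRoot (PF.two-points⇒doubleRoot π two)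

-- EnΓ-lines inside one 2_C-plane

module PlaneLines {q : ℕ} (2≤q : 2 ℕ.≤ q) {F : FiniteField q} (E : QuadExt F)
  {s t : Maybe (FiniteField.Carrier F)} (s≢t : s ≢ t) where
  open QuadExt E using (IsImagAxis; IsImagChord; IsEnΓ)
  open FiniteField F
  open FieldProperties F
  open Geometry F
  open Cubic F
  open Planes F
  open Lines F
  open Extension 2≤q E
  open Expansion s≢t
  open Chart (osc p) (dbl r p)

  r×p≢0 : cross r p ≢ 0#
  r×p≢0 = cross≢0 (λ e → s≢t (sym e))

  osc-p-r≢0 : osc p · cub r ≢ 0#
  osc-p-r≢0 e = cube≢0 r×p≢0 (trans (sym (osc-cub p r)) e)

  osc-r-p≢0 : osc r · cub p ≢ 0#
  osc-r-p≢0 e = cube≢0 δ≢0 (trans (sym (osc-cub r p)) e)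

  dbl-tan≢0 : dbl r p · tan p r ≢ 0#
  dbl-tan≢0 e = *≢0 (*≢0 δ≢0 δ≢0) r×p≢0 (trans (sym (dbl-tan₂ r p)) e)

  -- Scaled so that `osc p` is 1 on the first and `dbl r p` is 1 on the second; adding multiples of
  -- `cub p`, which both functionals kill, keeps the basis dual.
  basepoint₁ basepoint₂ : V4
  basepoint₁ = inv₀ (osc p · cub r) ⊙ cub r
  basepoint₂ = inv₀ (dbl r p · tan p r) ⊙ tan p r

  -- The plane dbl p r is spanned by cub p, cub r and tan p r; a line in it avoiding cub p has a unique basis
  -- of the form point₁ β, point₂ γ, and it avoids cub r if and only if β ≢ 0.
  point₁ point₂ : Carrier → V4
  point₁ β = basepoint₁ ⊕ (β ⊙ cub p)
  point₂ γ = basepoint₂ ⊕ (γ ⊙ cub p)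

  affine : ∀ c x β {a} → c · x ≡ a → c · cub p ≡ 0# → c · (x ⊕ (β ⊙ cub p)) ≡ a
  affine c x β {a} e f = trans (·-⊕ c x _) (trans (cong₂ _+_ e (trans (·-⊙ʳ β c (cub p)) (*-zeroʳ β f))) (+-identityʳ a))

  scaled : ∀ k c x → c · x ≡ 0# → c · (k ⊙ x) ≡ 0#
  scaled k c x e = trans (·-⊙ʳ k c x) (*-zeroʳ k e)

  normalized : ∀ c x → c · x ≢ 0# → c · (inv₀ (c · x) ⊙ x) ≡ 1#
  normalized c x n = trans (·-⊙ʳ _ c x) (trans (*-comm _ _) (*-inv₀ n))

  dual : ∀ β γ → DualBasis (point₁ β) (point₂ γ)
  dual β γ = record
    { φp = affine (osc p) basepoint₁ β (normalized (osc p) (cub r) osc-p-r≢0) (osc-self p)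
    ; ψp = affine (dbl r p) basepoint₁ β (scaled _ (dbl r p) (cub r) (dbl-cub₁ r p)) (dbl-cub₂ r p)
    ; φy = affine (osc p) basepoint₂ γ (scaled _ (osc p) (tan p r) (osc-tan₁ p r)) (osc-self p)
    ; ψy = affine (dbl r p) basepoint₂ γ (normalized (dbl r p) (tan p r) dbl-tan≢0) (dbl-cub₂ r p) }

  osc-r-point₁ : ∀ β → osc r · point₁ β ≡ β * (osc r · cub p)
  osc-r-point₁ β = trans (·-⊕ (osc r) _ _) (trans (cong₂ _+_ (scaled _ (osc r) (cub r) (osc-self r)) (·-⊙ʳ β (osc r) (cub p))) (+-identityˡ _))

  osc-r-point₂ : ∀ γ → osc r · point₂ γ ≡ γ * (osc r · cub p)
  osc-r-point₂ γ = trans (·-⊕ (osc r) _ _) (trans (cong₂ _+_ (scaled _ (osc r) (tan p r) (osc-tan₂ p r)) (·-⊙ʳ γ (osc r) (cub p))) (+-identityˡ _))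

  in-plane : ∀ β γ → Kills (dbl p r) (point₁ β) (point₂ γ)
  in-plane β γ = affine (dbl p r) basepoint₁ β (scaled _ (dbl p r) (cub r) (dbl-cub₂ p r)) (dbl-cub₁ p r) ,
    affine (dbl p r) basepoint₂ γ (scaled _ (dbl p r) (tan p r) (dbl-tan₁ p r)) (dbl-cub₁ p r)

  osc-r-on-line : ∀ β γ {x} → InSpan x (point₁ β) (point₂ γ) →
    osc r · x ≡ (osc p · x) * (β * (osc r · cub p)) + (dbl r p · x) * (γ * (osc r · cub p))
  osc-r-on-line β γ {x} x∈ = trans (cong (osc r ·_) (DualBasis.expand (dual β γ) x∈)) (trans (·-comb (osc r) _ _ _ _)
    (cong₂ (λ a b → (osc p · x) * a + (dbl r p · x) * b) (osc-r-point₁ β) (osc-r-point₂ γ)))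

  lineOf : Carrier × Carrier → LineRep
  lineOf (β , γ) = DualBasis.line (dual β γ)

  KilledByOsc : Carrier × Carrier → Maybe Carrier → Set
  KilledByOsc (β , γ) τ = Kills (osc (hom τ)) (point₁ β) (point₂ γ)

  InΓ : Carrier × Carrier → Set
  InΓ x = proj₁ x ≢ 0# × ∃[ τ ] KilledByOsc x τ

  -- Vanishing of `osc (hom τ)` at the two basis points is one linear equation each for β and γ. The
  -- plane osculating at s contains no line of the chart, and the one at t only a line with β zero;
  -- the remaining q - 1 values of τ give different lines by `dbl-plane∌axis`.
  count-InΓ : CountIs _≡_ InΓ (q ∸ 1)
  count-InΓ = count-map _≡_ (count-remove (subst (CountIs _≡_ _) (sym suc-pred-order) (count-remove count-Maybe s tt)) t (tt , λ e → s≢t (sym e)))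
      f f-valid f-inj f-surj
    where
    f : Maybe Carrier → Carrier × Carrier
    f τ = - (inv₀ (osc (hom τ) · cub p) * (osc (hom τ) · basepoint₁)) , - (inv₀ (osc (hom τ) · cub p) * (osc (hom τ) · basepoint₂))
    osc-cub≢0 : ∀ {σ τ} → τ ≢ σ → osc (hom τ) · cub (hom σ) ≢ 0#
    osc-cub≢0 {σ} {τ} n e = cube≢0 (cross≢0 (λ x → n (sym x))) (trans (sym (osc-cub (hom τ) (hom σ))) e)
    solves : ∀ τ x β → τ ≢ s → β ≡ - (inv₀ (osc (hom τ) · cub p) * (osc (hom τ) · x)) → osc (hom τ) · (x ⊕ (β ⊙ cub p)) ≡ 0#
    solves τ x β τ≢s e = trans (·-⊕ (osc (hom τ)) x _) (trans (cong (λ z → osc (hom τ) · x + z) (trans (·-⊙ʳ β (osc (hom τ)) (cub p)) (cong (_* (osc (hom τ) · cub p)) e)))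
      (trans (solve 3 (λ a i b → a :+ :- (i :* a) :* b := a :* (I :+ :- (b :* i))) refl (osc (hom τ) · x) (inv₀ (osc (hom τ) · cub p)) (osc (hom τ) · cub p))
        (*-zeroʳ _ (x≡y⇒x-y≡0 (sym (*-inv₀ (osc-cub≢0 τ≢s)))))))
    solved : ∀ τ x β → τ ≢ s → osc (hom τ) · (x ⊕ (β ⊙ cub p)) ≡ 0# → β ≡ - (inv₀ (osc (hom τ) · cub p) * (osc (hom τ) · x))
    solved τ x β τ≢s e = *-cancelˡ (osc-cub≢0 τ≢s) (x-y≡0⇒x≡y (trans (cong (λ y → b * β + - y) (trans (solve 3 (λ b i a → b :* :- (i :* a) := :- (b :* (i :* a))) refl b (inv₀ b) a) (cong -_ (x*i*y a (osc-cub≢0 τ≢s)))))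
      (trans (solve 3 (λ b β a → b :* β :+ :- (:- a) := a :+ β :* b) refl b β a)
        (trans (cong (λ z → a + z) (sym (·-⊙ʳ β (osc (hom τ)) (cub p)))) (trans (sym (·-⊕ (osc (hom τ)) x _)) e)))))
      where
      a b : Carrier
      a = osc (hom τ) · x
      b = osc (hom τ) · cub p
    killed : ∀ τ → τ ≢ s → KilledByOsc (f τ) τ
    killed τ τ≢s = solves τ basepoint₁ _ τ≢s refl , solves τ basepoint₂ _ τ≢s refl
    f-valid : ∀ τ → (⊤ × τ ≢ s) × τ ≢ t → InΓ (f τ)
    f-valid τ ((_ , τ≢s) , τ≢t) = (λ e → *≢0 (inv₀≢0 osc-p-r≢0) (osc-cub≢0 τ≢t) (trans (sym (·-⊙ʳ _ (osc (hom τ)) (cub r)))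
        (trans (sym (+-identityʳ _)) (trans (cong (λ z → osc (hom τ) · basepoint₁ + z) (sym (trans (·-⊙ʳ _ (osc (hom τ)) (cub p)) (*-zeroˡ _ e))))
          (trans (sym (·-⊕ (osc (hom τ)) basepoint₁ _)) (proj₁ (killed τ τ≢s))))))) , τ , killed τ τ≢s
    f-inj : ∀ τ τ′ → (⊤ × τ ≢ s) × τ ≢ t → (⊤ × τ′ ≢ s) × τ′ ≢ t → f τ ≡ f τ′ → τ ≡ τ′
    f-inj τ τ′ ((_ , τ≢s) , _) ((_ , τ′≢s) , _) e = go (τ ≟ᴹ τ′)
      where
      go : Dec (τ ≡ τ′) → τ ≡ τ′
      go (yes p) = p
      go (no n) = ⊥-elim (dbl-plane∌axis s≢t n (DualBasis.independent (dual _ _)) (in-plane (proj₁ (f τ)) (proj₂ (f τ))) (killed τ τ≢s)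
        (subst (λ x → KilledByOsc x τ′) (sym e) (killed τ′ τ′≢s)))
    f-surj : ∀ x → InΓ x → ∃[ τ ] (((⊤ × τ ≢ s) × τ ≢ t) × x ≡ f τ)
    f-surj (β , γ) (β≢0 , τ , k₁ , k₂) = τ , ((tt , τ≢s) , τ≢t) , cong₂ _,_ (solved τ basepoint₁ β τ≢s k₁) (solved τ basepoint₂ γ τ≢s k₂)
      where
      τ≢s : τ ≢ s
      τ≢s e = 0≢1 (trans (sym k₁) (trans (cong (λ τ → osc (hom τ) · point₁ β) e) (DualBasis.φp (dual β γ))))
      τ≢t : τ ≢ t
      τ≢t e = *≢0 β≢0 osc-r-p≢0 (trans (sym (osc-r-point₁ β)) (trans (cong (λ τ → osc (hom τ) · point₁ β) (sym e)) k₁))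

  span-scale : ∀ k {x u v} → InSpan x u v → InSpan (k ⊙ x) u v
  span-scale k {u = u₀ , u₁ , u₂ , u₃} {v₀ , v₁ , v₂ , v₃} (a , b , refl) = k * a , k * b , ≡V4 (e u₀ v₀) (e u₁ v₁) (e u₂ v₂) (e u₃ v₃)
    where
    e : ∀ u v → k * (a * u + b * v) ≡ k * a * u + k * b * v
    e u v = solve 5 (λ k a b u v → k :* (a :* u :+ b :* v) := k :* a :* u :+ k :* b :* v) refl k a b u v

  Good : Carrier × Carrier → Set
  Good x = (proj₁ x ≢ 0# × ⊤) × ¬ InΓ x

  count-Good : CountIs _≡_ Good ((q ∸ 1) ℕ.* (q ∸ 1))
  count-Good = subst (CountIs _≡_ Good) arith
      (count-∖ (Productₚ.≡-dec _≟_ _≟_) (count-× (count-≢ 0#) (λ _ _ → order)) count-InΓ (λ { x (β≢0 , _) → β≢0 , tt }))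
    where
    arith : (q ∸ 1) ℕ.* q ∸ (q ∸ 1) ≡ (q ∸ 1) ℕ.* (q ∸ 1)
    arith = subst (λ n → (q ∸ 1) ℕ.* n ∸ (q ∸ 1) ≡ (q ∸ 1) ℕ.* (q ∸ 1)) suc-pred-order
      (trans (cong (_∸ (q ∸ 1)) (ℕₚ.*-suc (q ∸ 1) (q ∸ 1))) (ℕₚ.m+n∸m≡n (q ∸ 1) _))

  good⇒enΓ : ∀ x → Good x → IsEnΓ (lineOf x)
  good⇒enΓ x@(β , γ) ((β≢0 , _) , ¬Γ) = no-point , no-Γ , dbl-plane∌imagChord {s} {t} (lineOf x) (in-plane β γ) , (λ _ → dbl-plane∌imagAxis {s} {t} (lineOf x) s≢t (in-plane β γ))
    where
    no-p : ¬ InSpan (cub p) (point₁ β) (point₂ γ)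
    no-p e = osc-r-p≢0 (trans (osc-r-on-line β γ e) (zero-sum (*-zeroˡ _ (osc-self p)) (*-zeroˡ _ (dbl-cub₂ r p))))
    no-r : ¬ InSpan (cub r) (point₁ β) (point₂ γ)
    no-r e = *≢0 osc-p-r≢0 (*≢0 β≢0 osc-r-p≢0) (trans (sym (+-identityʳ _)) (trans (cong (λ z → (osc p · cub r) * (β * (osc r · cub p)) + z) (sym (*-zeroˡ _ (dbl-cub₁ r p))))
      (trans (sym (osc-r-on-line β γ e)) (osc-self r))))
    no-point : ∀ w → ¬ OnLine (Pt w) (lineOf x)
    no-point w e = [ (λ w≡s → no-p (subst (λ z → InSpan z (point₁ β) (point₂ γ)) (trans (Pt≡cub w) (cong (λ w → cub (hom w)) w≡s)) e)) ,
      (λ w≡t → no-r (subst (λ z → InSpan z (point₁ β) (point₂ γ)) (trans (Pt≡cub w) (cong (λ w → cub (hom w)) w≡t)) e)) ]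
      (dbl-root {s} {t} {w} (·-span (dbl p r) e (proj₁ (in-plane β γ)) (proj₂ (in-plane β γ))))
    no-Γ : ∀ π → ΓPlaneOf π → ¬ (lineOf x ⊆π π)
    no-Γ π isΓ k = ¬Γ (β≢0 , ΓPlaneOf⇒kills-osc (lineOf x) π isΓ k)

  lineOf-injective : ∀ x y → SameLine (lineOf x) (lineOf y) → x ≡ y
  lineOf-injective (β , γ) (β′ , γ′) (e₁ , e₂ , _) = sym (cong₂ _,_
      (cancel (osc-r-point₁ β′) (trans (osc-r-on-line β γ e₁) (trans (cong₂ (λ a b → a * (β * (osc r · cub p)) + b * (γ * (osc r · cub p))) (DualBasis.φp (dual β′ γ′)) (DualBasis.ψp (dual β′ γ′)))
        (solve 2 (λ a b → I :* a :+ O :* b := a) refl (β * (osc r · cub p)) (γ * (osc r · cub p))))))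
      (cancel (osc-r-point₂ γ′) (trans (osc-r-on-line β γ e₂) (trans (cong₂ (λ a b → a * (β * (osc r · cub p)) + b * (γ * (osc r · cub p))) (DualBasis.φy (dual β′ γ′)) (DualBasis.ψy (dual β′ γ′)))
        (solve 2 (λ a b → O :* a :+ I :* b := b) refl (β * (osc r · cub p)) (γ * (osc r · cub p)))))))
    where
    cancel : ∀ {x a b} → x ≡ a * (osc r · cub p) → x ≡ b * (osc r · cub p) → a ≡ b
    cancel {x} {a} {b} e f = *-cancelˡ osc-r-p≢0 (trans (*-comm _ a) (trans (sym e) (trans f (*-comm b _))))

  enΓ⇒good : ∀ L → IsEnΓ L → Kills (dbl p r) (gen₁ L) (gen₂ L) → ∃[ x ] (Good x × SameLine L (lineOf x))
  enΓ⇒good L@((u , v) , ind) (no-pt , no-Γ , _) kd = go (minor u v ≟ 0#)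
    where
    off-p : ¬ InSpan (cub p) u v
    off-p e = no-pt s (subst (λ z → InSpan z u v) (sym (Pt≡cub s)) e)
    off-r : ¬ InSpan (cub r) u v
    off-r e = no-pt t (subst (λ z → InSpan z u v) (sym (Pt≡cub t)) e)
    go : Dec (minor u v ≡ 0#) → ∃[ x ] (Good x × SameLine L (lineOf x))
    -- A vector of this plane killed by `osc p` and `dbl r p` is a multiple of `cub p`, so a line
    -- outside the chart passes through the point of s.
    go (yes m≡0) = ⊥-elim (off-p (subst (λ x → InSpan x u v) (sym (⊙-unscale k≢0 (sym z≡))) (span-scale _ z∈)))
      where
      ker = kernel ind m≡0
      z : V4
      z = proj₁ ker
      z∈ : InSpan z u v
      z∈ = proj₁ (proj₂ ker)
      k : Carrier
      k = inv₀ (osc r · cub p) * (osc r · z)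
      z≡ : z ≡ k ⊙ cub p
      z≡ = coordinates-ext
        (sym (trans (·-⊙ʳ k (osc r) (cub p)) (trans (*-comm k _) (x*i*y _ osc-r-p≢0))))
        (trans (proj₁ (proj₂ (proj₂ (proj₂ ker)))) (sym (scaled k (osc p) (cub p) (osc-self p))))
        (trans (proj₂ (proj₂ (proj₂ (proj₂ ker)))) (sym (scaled k (dbl r p) (cub p) (dbl-cub₂ r p))))
        (trans (·-span (dbl p r) z∈ (proj₁ kd) (proj₂ kd)) (sym (scaled k (dbl p r) (cub p) (dbl-cub₁ p r))))
      k≢0 : k ≢ 0#
      k≢0 e = proj₁ (proj₂ (proj₂ ker)) (trans z≡ (trans (cong (_⊙ cub p) e) (0⊙ (cub p))))
    go (no m≢0) = (β , γ) , ((β≢0 , tt) , (λ { (_ , τ , kτ) → no-Γ (ΓPlane τ) (ΓPlane-isΓ τ) (kills-osc⇒Γ τ (kills-span {osc (hom τ)} u∈′ v∈′ kτ)) })) ,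
        subst (λ x → InSpan x u v) y₁≡ p∈ , subst (λ x → InSpan x u v) y₂≡ y∈ , u∈′ , v∈′
      where
      open Normalized (normalize m≢0) renaming (p to y₁; y to y₂; dual to dualₙ)
      open DualBasis dualₙ
      β γ : Carrier
      β = inv₀ (osc r · cub p) * (osc r · y₁)
      γ = inv₀ (osc r · cub p) * (osc r · y₂)
      y₁≡ : y₁ ≡ point₁ β
      y₁≡ = coordinates-ext
        (sym (trans (osc-r-point₁ β) (trans (*-comm β _) (x*i*y _ osc-r-p≢0))))
        (trans φp (sym (DualBasis.φp (dual β γ)))) (trans ψp (sym (DualBasis.ψp (dual β γ))))
        (trans (·-span (dbl p r) p∈ (proj₁ kd) (proj₂ kd)) (sym (proj₁ (in-plane β γ))))
      y₂≡ : y₂ ≡ point₂ γ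
      y₂≡ = coordinates-ext
        (sym (trans (osc-r-point₂ γ) (trans (*-comm γ _) (x*i*y _ osc-r-p≢0))))
        (trans φy (sym (DualBasis.φy (dual β γ)))) (trans ψy (sym (DualBasis.ψy (dual β γ))))
        (trans (·-span (dbl p r) y∈ (proj₁ kd) (proj₂ kd)) (sym (proj₂ (in-plane β γ))))
      u∈′ : InSpan u (point₁ β) (point₂ γ)
      u∈′ = subst₂ (InSpan u) y₁≡ y₂≡ u∈
      v∈′ : InSpan v (point₁ β) (point₂ γ)
      v∈′ = subst₂ (InSpan v) y₁≡ y₂≡ v∈
      β≢0 : β ≢ 0#
      -- For β zero, `point₁ β` is a multiple of `cub r`, and the line would pass through the point
      -- of t.
      β≢0 e = off-r (subst (λ x → InSpan x u v) r≡ (span-scale (osc p · cub r) p∈))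
        where
        r≡ : (osc p · cub r) ⊙ y₁ ≡ cub r
        r≡ = trans (cong ((osc p · cub r) ⊙_) (trans y₁≡ (coordinates-ext
            (trans (osc-r-point₁ β) (trans (*-zeroˡ _ e) (sym (scaled _ (osc r) (cub r) (osc-self r)))))
            (trans (DualBasis.φp (dual β γ)) (sym (normalized (osc p) (cub r) osc-p-r≢0)))
            (trans (DualBasis.ψp (dual β γ)) (sym (scaled _ (dbl r p) (cub r) (dbl-cub₁ r p))))
            (trans (proj₁ (in-plane β γ)) (sym (scaled _ (dbl p r) (cub r) (dbl-cub₂ p r)))))))
          (trans (⊙-⊙ _ _ (cub r)) (trans (cong (_⊙ cub r) (*-inv₀ osc-p-r≢0)) (⊙-identity (cub r))))

  count-enΓ-in-dbl : ∀ {c l} → l ≢ 0# → c ≡ l ⊙ dbl p r →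
    CountIs SameLine (λ L → IsEnΓ L × Kills c (gen₁ L) (gen₂ L)) ((q ∸ 1) ℕ.* (q ∸ 1))
  count-enΓ-in-dbl {c} l≢0 e = count-map SameLine {Q = λ L → IsEnΓ L × Kills c (gen₁ L) (gen₂ L)} count-Good lineOf
    (λ x g → good⇒enΓ x g , kills-unscale e (in-plane (proj₁ x) (proj₂ x)))
    (λ x y _ _ → lineOf-injective x y)
    (λ { L (enΓ , k) → enΓ⇒good L enΓ (kills-scale l≢0 e k) })

-- Flags of an EnΓ-line in a 2_C-plane

module PlaneCount {q : ℕ} (2≤q : 2 ℕ.≤ q) {F : FiniteField q} (E : QuadExt F) where
  open QuadExt E using (IsEnΓ; EnΓ2CFlag)
  open FiniteField F
  open Planes F
  open Lines F

  count-enΓ-in-2C : ∀ π → Is2CPlane π → CountIs SameLine (λ L → IsEnΓ L × L ⊆π π) ((q ∸ 1) ℕ.* (q ∸ 1))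
  count-enΓ-in-2C π two = PlaneLines.count-enΓ-in-dbl 2≤q E double≢simple scalar≢0 coeff≡
    where open DoubleRoot (two-points⇒doubleRoot π two)

  count-flags : CountIs SameFlag EnΓ2CFlag (suc q ℕ.* q ℕ.* ((q ∸ 1) ℕ.* (q ∸ 1)))
  count-flags = mkCount SameFlag {P = EnΓ2CFlag} flag flag-valid flag-injective flag-index
    where
    P : PlaneRep × LineRep → Set
    P (π , L) = Is2CPlane π × IsEnΓ L × L ⊆π π
    _~_ : PlaneRep × LineRep → PlaneRep × LineRep → Set
    (π , L) ~ (ρ , M) = SamePlane π ρ × SameLine L M
    counted : CountIs _~_ P (suc q ℕ.* q ℕ.* ((q ∸ 1) ℕ.* (q ∸ 1)))
    counted = count-Σ SamePlane SameLine {P = Is2CPlane} {Q = λ π L → IsEnΓ L × L ⊆π π} count-2C count-enΓ-in-2C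
      (λ { π ρ L (l , l≢0 , e) (enΓ , k) → enΓ , kills-unscale e k })
    open Count {_~_ = _~_} {P = P} counted
    flag : Fin (suc q ℕ.* q ℕ.* ((q ∸ 1) ℕ.* (q ∸ 1))) → LineRep × PlaneRep
    flag i = proj₂ (elem i) , proj₁ (elem i)
    flag-valid : ∀ i → EnΓ2CFlag (flag i)
    flag-valid i = proj₁ (proj₂ (valid i)) , proj₁ (valid i) , proj₂ (proj₂ (valid i))
    flag-injective : ∀ i j → SameFlag (flag i) (flag j) → i ≡ j
    flag-injective i j (l , p) = injective i j (p , l)
    flag-index : ∀ x → EnΓ2CFlag x → ∃[ i ] SameFlag x (flag i)
    flag-index (L , π) (enΓ , two , k) = index (π , L) (two , enΓ , k) ,
      proj₂ (elem-index (π , L) (two , enΓ , k)) , proj₁ (elem-index (π , L) (two , enΓ , k))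

-- Coordinates for the lines off P(∞)

-- The lines off the plane x₃ = 0 and off P(∞), in reduced form. The pencil of cubic forms through the line
-- (p₀ , a , 1 , 0) , (y₀ , b , 0 , 1) is spanned by g = x² - a x - b and x g + c x + d, where
-- p₀ = a² + b - c and y₀ = a b - d; its base points are governed by the resultant of g and c x + d.
-- The pencil through (p₀ , 1 , 0 , 0) , (y₀ , 0 , e , 1) is spanned by x - e and a monic cubic, whose value at e is k.
module Charts {q : ℕ} (F : FiniteField q) where
  open FiniteField F
  open FieldProperties F
  open Geometry F
  open Planes F
  open Lines F
  private
    T : ∀ {n} → Polynomial n
    T = I :+ I :+ I

  Quadratic Linear : Set
  Quadratic = Carrier × Carrier × Carrier × Carrier
  Linear = Carrier × Carrier × Carrier

  quadP quadY : Quadratic → V4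
  quadP (c , d , a , b) = a * a + b + - c , a , 1# , 0#
  quadY (c , d , a , b) = a * b + - d , b , 0# , 1#

  linP linY : Linear → V4
  linP (e , p , k) = p , 1# , 0# , 0#
  linY (e , p , k) = e * e * e + - (p * (e * e)) + - k , 0# , e , 1#

  resultant : Quadratic → Carrier
  resultant (c , d , a , b) = d * d + a * c * d + - (b * (c * c))

  -- For A = t + u and B = t u this is the pencil spanned by (x - t)³ and (x - u)³: their difference
  -- divided by - 3 (t - u) is the monic x² - A x + (A² - B) / 3, whence b. Being symmetric in t and
  -- u, the formula also makes sense for irreducible x² - A x + B.
  axis : Carrier → Carrier → Quadratic
  axis A B = A * A + b + - (3# * B) , A * b + A * B , A , b
    where b = - (inv₀ 3# * (A * A + - B))

  e₁ e₂ e₃ : V4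
  e₁ = 0# , 1# , 0# , 0#
  e₂ = 0# , 0# , 1# , 0#
  e₃ = 0# , 0# , 0# , 1#

  e₁· : ∀ x y z w → e₁ · (x , y , z , w) ≡ y
  e₁· = solve 4 (λ x y z w → O :* x :+ I :* y :+ O :* z :+ O :* w := y) refl
  e₂· : ∀ x y z w → e₂ · (x , y , z , w) ≡ z
  e₂· = solve 4 (λ x y z w → O :* x :+ O :* y :+ I :* z :+ O :* w := z) refl
  e₃· : ∀ x y z w → e₃ · (x , y , z , w) ≡ w
  e₃· = solve 4 (λ x y z w → O :* x :+ O :* y :+ O :* z :+ I :* w := w) refl

  quad-dual : ∀ x → Chart.DualBasis e₂ e₃ (quadP x) (quadY x)
  quad-dual x = record { φp = e₂· _ _ _ _ ; ψp = e₃· _ _ _ _ ; φy = e₂· _ _ _ _ ; ψy = e₃· _ _ _ _ }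

  lin-dual : ∀ x → Chart.DualBasis e₁ e₃ (linP x) (linY x)
  lin-dual x = record { φp = e₁· _ _ _ _ ; ψp = e₃· _ _ _ _ ; φy = e₁· _ _ _ _ ; ψy = e₃· _ _ _ _ }

  quadLine : Quadratic → LineRep
  quadLine x = Chart.DualBasis.line (quad-dual x)

  linLine : Linear → LineRep
  linLine x = Chart.DualBasis.line (lin-dual x)

  -- The coordinates of the point say that t is a common root of g and c x + d, and the resultant is
  -- a combination of g(t) and c t + d. Over K the same lemma handles chords.
  point∈quad⇒resultant≡0 : ∀ x t → InSpan (Pt (just t)) (quadP x) (quadY x) → resultant x ≡ 0#
  point∈quad⇒resultant≡0 (c , d , a , b) t (α , β , e) =
    trans (solve 5 (λ a b c d t → d :* d :+ a :* c :* d :+ :- (b :* (c :* c))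
        := (d :+ (a :+ :- t) :* c) :* (c :* t :+ d) :+ (c :* c) :* (t :* t :+ :- (a :* t :+ b))) refl a b c d t)
      (comb0 _ _ ct+d≡0 (x≡y⇒x-y≡0 t²≡))
    where
    t≡α : t ≡ α
    t≡α = trans (cong (λ v → proj₁ (proj₂ (proj₂ v))) e) (solve 2 (λ α β → α :* I :+ β :* O := α) refl α β)
    1≡β : 1# ≡ β
    1≡β = trans (cong (λ v → proj₂ (proj₂ (proj₂ v))) e) (solve 2 (λ α β → α :* O :+ β :* I := β) refl α β)
    t²≡ : t * t ≡ a * t + b
    t²≡ = trans (solve 1 (λ t → t :* t := t :* (t :* I)) refl t) (trans (cong (λ v → proj₁ (proj₂ v)) e)
      (trans (cong₂ (λ α β → α * a + β * b) (sym t≡α) (sym 1≡β)) (solve 3 (λ a b t → t :* a :+ I :* b := a :* t :+ b) refl a b t)))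
    t³≡ : t * (t * (t * 1#)) ≡ t * (a * a + b + - c) + 1# * (a * b + - d)
    t³≡ = trans (cong proj₁ e) (cong₂ (λ α β → α * (a * a + b + - c) + β * (a * b + - d)) (sym t≡α) (sym 1≡β))
    ct+d≡0 : c * t + d ≡ 0#
    ct+d≡0 = trans (solve 5 (λ a b c d t → c :* t :+ d := I :* (t :* (t :* (t :* I)) :+ :- (t :* (a :* a :+ b :+ :- c) :+ I :* (a :* b :+ :- d)))
        :+ (:- (t :+ a)) :* (t :* t :+ :- (a :* t :+ b))) refl a b c d t)
      (comb0 _ _ (x≡y⇒x-y≡0 t³≡) (x≡y⇒x-y≡0 t²≡))

  root⇒point∈quad : ∀ c d a b t → t * t ≡ a * t + b → c * t + d ≡ 0# → InSpan (Pt (just t)) (quadP (c , d , a , b)) (quadY (c , d , a , b))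
  root⇒point∈quad c d a b t t²≡ ct+d≡0 = t , 1# , ≡V4
    (x-y≡0⇒x≡y (trans (solve 5 (λ a b c d t → t :* (t :* (t :* I)) :+ :- (t :* (a :* a :+ b :+ :- c) :+ I :* (a :* b :+ :- d))
        := I :* (c :* t :+ d) :+ (t :+ a) :* (t :* t :+ :- (a :* t :+ b))) refl a b c d t) (comb0 _ _ ct+d≡0 (x≡y⇒x-y≡0 t²≡))))
    (trans (solve 1 (λ t → t :* (t :* I) := t :* t) refl t) (trans t²≡ (solve 3 (λ a b t → a :* t :+ b := t :* a :+ I :* b) refl a b t)))
    (solve 1 (λ t → t := t :* I :+ I :* O) refl t)
    (solve 1 (λ t → I := t :* O :+ I :* I) refl t)

  ∞∉quad : ∀ x → ¬ InSpan (Pt nothing) (quadP x) (quadY x)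
  ∞∉quad x (α , β , e) = 0≢1 (sym (trans (cong proj₁ e) (trans (cong₂ (λ α β → α * proj₁ (quadP x) + β * proj₁ (quadY x)) α≡0 β≡0)
      (solve 2 (λ a b → O :* a :+ O :* b := O) refl (proj₁ (quadP x)) (proj₁ (quadY x))))))
    where
    α≡0 : α ≡ 0#
    α≡0 = trans (solve 2 (λ α β → α := α :* I :+ β :* O) refl α β) (sym (cong (λ v → proj₁ (proj₂ (proj₂ v))) e))
    β≡0 : β ≡ 0#
    β≡0 = trans (solve 2 (λ α β → β := α :* O :+ β :* I) refl α β) (sym (cong (λ v → proj₂ (proj₂ (proj₂ v))) e))

  ∞∉lin : ∀ x → ¬ InSpan (Pt nothing) (linP x) (linY x)
  ∞∉lin x (α , β , e) = 0≢1 (sym (trans (cong proj₁ e) (trans (cong₂ (λ α β → α * proj₁ (linP x) + β * proj₁ (linY x)) α≡0 β≡0)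
      (solve 2 (λ a b → O :* a :+ O :* b := O) refl (proj₁ (linP x)) (proj₁ (linY x))))))
    where
    α≡0 : α ≡ 0#
    α≡0 = trans (solve 2 (λ α β → α := α :* I :+ β :* O) refl α β) (sym (cong (λ v → proj₁ (proj₂ v)) e))
    β≡0 : β ≡ 0#
    β≡0 = trans (solve 2 (λ α β → β := α :* O :+ β :* I) refl α β) (sym (cong (λ v → proj₂ (proj₂ (proj₂ v))) e))

  point∈lin⇒k≡0 : ∀ e p k t → InSpan (Pt (just t)) (linP (e , p , k)) (linY (e , p , k)) → k ≡ 0#
  point∈lin⇒k≡0 e p k t (α , β , eq) = trans (solve 3 (λ p k t → k := (t :* (t :* (t :* I)) :+ :- (t :* (t :* I) :* p :+ I :* (t :* t :* t :+ :- (p :* (t :* t)) :+ :- k)))) refl p k t)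
      (x≡y⇒x-y≡0 (trans (cong proj₁ eq) (trans (cong₂ (λ α β → α * p + β * (e * e * e + - (p * (e * e)) + - k)) (sym t²≡α) (sym 1≡β))
        (cong (λ e → t * (t * 1#) * p + 1# * (e * e * e + - (p * (e * e)) + - k)) (sym t≡e)))))
    where
    1≡β : 1# ≡ β
    1≡β = trans (cong (λ v → proj₂ (proj₂ (proj₂ v))) eq) (solve 2 (λ α β → α :* O :+ β :* I := β) refl α β)
    t²≡α : t * (t * 1#) ≡ α
    t²≡α = trans (cong (λ v → proj₁ (proj₂ v)) eq) (solve 2 (λ α β → α :* I :+ β :* O := α) refl α β)
    t≡e : t ≡ e
    t≡e = trans (cong (λ v → proj₁ (proj₂ (proj₂ v))) eq) (trans (cong (λ β → α * 0# + β * e) (sym 1≡β)) (solve 2 (λ α e → α :* O :+ I :* e := e) refl α e))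

  k≡0⇒point∈lin : ∀ e p k → k ≡ 0# → InSpan (Pt (just e)) (linP (e , p , k)) (linY (e , p , k))
  k≡0⇒point∈lin e p k refl = e * e , 1# , ≡V4
    (solve 2 (λ e p → e :* (e :* (e :* I)) := e :* e :* p :+ I :* (e :* e :* e :+ :- (p :* (e :* e)) :+ :- O)) refl e p)
    (solve 1 (λ e → e :* (e :* I) := e :* e :* I :+ I :* O) refl e)
    (solve 1 (λ e → e := e :* e :* O :+ I :* e) refl e)
    (solve 1 (λ e → I := e :* e :* O :+ I :* I) refl e)

  -- The remainder of (x - t)³ modulo g = x² - a x - b is `oscC t a b` times x plus `oscD t a b`;
  -- the pencil contains the cube exactly when c x + d is this remainder.
  oscC oscD : Carrier → Carrier → Carrier → Carrier
  oscC t a b = a * a + b + - (3# * (t * a)) + 3# * (t * t)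
  oscD t a b = a * b + - cube t + - (3# * (t * b))

  osc-quad₁ : ∀ c d a b t → oscV t · quadP (c , d , a , b) ≡ oscC t a b + - c
  osc-quad₁ c d a b t = solve 4 (λ a b c t → I :* (a :* a :+ b :+ :- c) :+ :- (T :* t) :* a :+ T :* (t :* (t :* I)) :* I :+ :- (t :* (t :* (t :* I))) :* O
    := a :* a :+ b :+ :- (T :* (t :* a)) :+ T :* (t :* t) :+ :- c) refl a b c t

  osc-quad₂ : ∀ c d a b t → oscV t · quadY (c , d , a , b) ≡ oscD t a b + - d
  osc-quad₂ c d a b t = solve 4 (λ a b d t → I :* (a :* b :+ :- d) :+ :- (T :* t) :* b :+ T :* (t :* (t :* I)) :* O :+ :- (t :* (t :* (t :* I))) :* I
    := a :* b :+ :- (t :* t :* t) :+ :- (T :* (t :* b)) :+ :- d) refl a b d t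

  kills-quad⇒ : ∀ {c d a b} t → Kills (oscV t) (quadP (c , d , a , b)) (quadY (c , d , a , b)) → oscC t a b ≡ c × oscD t a b ≡ d
  kills-quad⇒ {c} {d} {a} {b} t (k , l) = x-y≡0⇒x≡y (trans (sym (osc-quad₁ c d a b t)) k) , x-y≡0⇒x≡y (trans (sym (osc-quad₂ c d a b t)) l)

  kills-quad⇐ : ∀ {c d a b} t → oscC t a b ≡ c → oscD t a b ≡ d → Kills (oscV t) (quadP (c , d , a , b)) (quadY (c , d , a , b))
  kills-quad⇐ {c} {d} {a} {b} t k l = trans (osc-quad₁ c d a b t) (x≡y⇒x-y≡0 k) , trans (osc-quad₂ c d a b t) (x≡y⇒x-y≡0 l)

  osc-lin₁ : ∀ e p k t → oscV t · linP (e , p , k) ≡ p + - (3# * t)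
  osc-lin₁ e p k t = solve 2 (λ p t → I :* p :+ :- (T :* t) :* I :+ T :* (t :* (t :* I)) :* O :+ :- (t :* (t :* (t :* I))) :* O := p :+ :- (T :* t)) refl p t

  osc-lin₂ : ∀ e p k t → p ≡ 3# * t → oscV t · linY (e , p , k) ≡ cube (e + - t) + - k
  osc-lin₂ e p k t refl = solve 3 (λ e k t → I :* (e :* e :* e :+ :- (T :* t :* (e :* e)) :+ :- k) :+ :- (T :* t) :* O :+ T :* (t :* (t :* I)) :* e :+ :- (t :* (t :* (t :* I))) :* I
    := (e :+ :- t) :* (e :+ :- t) :* (e :+ :- t) :+ :- k) refl e k t

  kills-lin⇒ : ∀ {e p k} t → Kills (oscV t) (linP (e , p , k)) (linY (e , p , k)) → p ≡ 3# * t × cube (e + - t) ≡ k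
  kills-lin⇒ {e} {p} {k} t (m , l) = p≡ , x-y≡0⇒x≡y (trans (sym (osc-lin₂ e p k t p≡)) l)
    where
    p≡ : p ≡ 3# * t
    p≡ = x-y≡0⇒x≡y (trans (sym (osc-lin₁ e p k t)) m)

  kills-lin⇐ : ∀ {e p k} t → p ≡ 3# * t → cube (e + - t) ≡ k → Kills (oscV t) (linP (e , p , k)) (linY (e , p , k))
  kills-lin⇐ {e} {p} {k} t m l = trans (osc-lin₁ e p k t) (x≡y⇒x-y≡0 m) , trans (osc-lin₂ e p k t m) (x≡y⇒x-y≡0 l)

  -- The resultant with g only depends on the cubic modulo g, and that of g and (x - t)³ is g(t)³.
  resultant-osc : ∀ a b t → resultant (oscC t a b , oscD t a b , a , b) ≡ cube (t * t + - (a * t) + - b)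
  resultant-osc a b t = solve 3 (λ a b t →
    let c = a :* a :+ b :+ :- (T :* (t :* a)) :+ T :* (t :* t)
        d = a :* b :+ :- (t :* t :* t) :+ :- (T :* (t :* b))
        g = t :* t :+ :- (a :* t) :+ :- b
    in d :* d :+ a :* c :* d :+ :- (b :* (c :* c)) := g :* g :* g) refl a b t

  module _ (3≢0 : 3# ≢ 0#) where

    axis-b : ∀ A B → 3# * - (inv₀ 3# * (A * A + - B)) ≡ - (A * A + - B)
    axis-b A B = trans (solve 3 (λ c i x → c :* :- (i :* x) := :- (c :* (i :* x))) refl 3# (inv₀ 3#) (A * A + - B)) (cong -_ (x*i*y _ 3≢0))

    -- After reduction by t² = A t - B the letter t disappears, so both roots of the quadratic give
    -- the same pencil; likewise in `axis-d`.
    axis-c : ∀ A B t → t * t ≡ A * t + - B → let b = - (inv₀ 3# * (A * A + - B)) in oscC t A b ≡ A * A + b + - (3# * B)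
    axis-c A B t e = x-y≡0⇒x≡y (trans (solve 4 (λ A B b t → A :* A :+ b :+ :- (T :* (t :* A)) :+ T :* (t :* t) :+ :- (A :* A :+ b :+ :- (T :* B)) := T :* (t :* t :+ :- (A :* t :+ :- B)))
      refl A B (- (inv₀ 3# * (A * A + - B))) t) (*-zeroʳ 3# (x≡y⇒x-y≡0 e)))

    axis-d : ∀ A B t → t * t ≡ A * t + - B → let b = - (inv₀ 3# * (A * A + - B)) in oscD t A b ≡ A * b + A * B
    axis-d A B t e = x-y≡0⇒x≡y (trans (solve 5 (λ A B b t u → A :* b :+ :- (t :* t :* t) :+ :- (u :* (t :* b)) :+ :- (A :* b :+ A :* B)
        := (:- t) :* (u :* b :+ :- (:- (A :* A :+ :- B))) :+ (:- (t :+ A)) :* (t :* t :+ :- (A :* t :+ :- B)))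
      refl A B b t 3#) (comb0 _ _ (x≡y⇒x-y≡0 (axis-b A B)) (x≡y⇒x-y≡0 e)))
      where
      b : Carrier
      b = - (inv₀ 3# * (A * A + - B))

    root⇒osc-kills-axis : ∀ A B t → t * t ≡ A * t + - B → Kills (oscV t) (quadP (axis A B)) (quadY (axis A B))
    root⇒osc-kills-axis A B t e = kills-quad⇐ t (axis-c A B t e) (axis-d A B t e)

    osc-kills-axis⇒root : ∀ A B t → Kills (oscV t) (quadP (axis A B)) (quadY (axis A B)) → t * t ≡ A * t + - B
    osc-kills-axis⇒root A B t k = x-y≡0⇒x≡y (zero⇒ 3≢0 (trans (solve 4 (λ A B b t → T :* (t :* t :+ :- (A :* t :+ :- B))
      := A :* A :+ b :+ :- (T :* (t :* A)) :+ T :* (t :* t) :+ :- (A :* A :+ b :+ :- (T :* B))) refl A B (- (inv₀ 3# * (A * A + - B))) t)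
      (x≡y⇒x-y≡0 (proj₁ (kills-quad⇒ t k)))))

    root-sum-product : ∀ t u → t * t ≡ (t + u) * t + - (t * u)
    root-sum-product = solve 2 (λ t u → t :* t := (t :+ u) :* t :+ :- (t :* u)) refl

    -- By `resultant-osc` the resultant is g(t)³, and here 3 g(t) = (t - u)².
    resultant-axis : ∀ t u → t ≢ u → resultant (axis (t + u) (t * u)) ≢ 0#
    resultant-axis t u t≢u e = t≢u (x-y≡0⇒x≡y (square≡0 (begin
        (t + - u) * (t + - u)                     ≡⟨ solve 2 (λ t u → (t :+ :- u) :* (t :+ :- u) := T :* (t :* t :+ :- ((t :+ u) :* t)) :+ :- (:- ((t :+ u) :* (t :+ u) :+ :- (t :* u)))) refl t u ⟩
        3# * (t * t + - (A * t)) + - (- (A * A + - B)) ≡⟨ cong (λ x → 3# * (t * t + - (A * t)) + - x) (sym (axis-b A B)) ⟩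
        3# * (t * t + - (A * t)) + - (3# * b)     ≡⟨ solve 4 (λ c t A b → c :* (t :* t :+ :- (A :* t)) :+ :- (c :* b) := c :* (t :* t :+ :- (A :* t) :+ :- b)) refl 3# t A b ⟩
        3# * (t * t + - (A * t) + - b)            ≡⟨ *-zeroʳ 3# (cube≡0 (trans (sym (resultant-osc A b t)) (trans (cong₂ (λ c d → resultant (c , d , A , b)) (axis-c A B t (root-sum-product t u)) (axis-d A B t (root-sum-product t u))) e))) ⟩
        0# ∎)))
      where
      open ≡-Reasoning
      A B b : Carrier
      A = t + u
      B = t * u
      b = - (inv₀ 3# * (A * A + - B))

    -- Subtracting the two equations for c leaves 3 (t - u) (t + u - a) = 0, and those for d give 3
    -- b = - (A² - B). So a and b are forced, and with them c and d.
    two-kills⇒axis : ∀ {x t u} → t ≢ u → Kills (oscV t) (quadP x) (quadY x) → Kills (oscV u) (quadP x) (quadY x) → x ≡ axis (t + u) (t * u)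
    two-kills⇒axis {c , d , a , b} {t} {u} t≢u kt ku = cong₂ _,_ c≡axis (cong₂ _,_ d≡axis (cong₂ _,_ a≡ b≡))
      where
      A B β : Carrier
      A = t + u
      B = t * u
      β = - (inv₀ 3# * (A * A + - B))
      c≡ : oscC t a b ≡ c
      c≡ = proj₁ (kills-quad⇒ t kt)
      d≡ : oscD t a b ≡ d
      d≡ = proj₂ (kills-quad⇒ t kt)
      c≡′ : oscC u a b ≡ c
      c≡′ = proj₁ (kills-quad⇒ u ku)
      d≡′ : oscD u a b ≡ d
      d≡′ = proj₂ (kills-quad⇒ u ku)
      t-u≢0 : t + - u ≢ 0#
      t-u≢0 e = t≢u (x-y≡0⇒x≡y e)
      a≡ : a ≡ A
      a≡ = sym (x-y≡0⇒x≡y (zero⇒ (*≢0 3≢0 t-u≢0) (trans (solve 4 (λ a b t u → T :* (t :+ :- u) :* (t :+ u :+ :- a)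
          := a :* a :+ b :+ :- (T :* (t :* a)) :+ T :* (t :* t) :+ :- (a :* a :+ b :+ :- (T :* (u :* a)) :+ T :* (u :* u))) refl a b t u)
        (x≡y⇒x-y≡0 (trans c≡ (sym c≡′))))))
      b≡ : b ≡ β
      b≡ = *-cancelˡ 3≢0 (trans (x-y≡0⇒x≡y (zero⇒ t-u≢0 (trans (solve 4 (λ a b t u → (t :+ :- u) :* (T :* b :+ :- (:- ((t :+ u) :* (t :+ u) :+ :- (t :* u))))
          := :- (a :* b :+ :- (t :* t :* t) :+ :- (T :* (t :* b)) :+ :- (a :* b :+ :- (u :* u :* u) :+ :- (T :* (u :* b))))) refl a b t u)
        (trans (cong -_ (x≡y⇒x-y≡0 (trans d≡ (sym d≡′)))) (solve 0 (:- O := O) refl))))) (sym (axis-b A B)))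
      c≡axis : c ≡ A * A + β + - (3# * B)
      c≡axis = trans (sym c≡) (trans (cong₂ (oscC t) a≡ b≡) (axis-c A B t (root-sum-product t u)))
      d≡axis : d ≡ A * β + A * B
      d≡axis = trans (sym d≡) (trans (cong₂ (oscD t) a≡ b≡) (axis-d A B t (root-sum-product t u)))

    two-kills-lin : ∀ {x t u} → Kills (oscV t) (linP x) (linY x) → Kills (oscV u) (linP x) (linY x) → t ≡ u
    two-kills-lin {x} {t} {u} kt ku = *-cancelˡ 3≢0 (trans (sym (proj₁ (kills-lin⇒ t kt))) (proj₁ (kills-lin⇒ u ku)))

  module _ (3≡0 : 3# ≡ 0#) where

    cube-injective : ∀ {t u} → cube t ≡ cube u → t ≡ u
    cube-injective {t} {u} e = x-y≡0⇒x≡y (cube≡0 (trans (solve 2 (λ t u → (t :+ :- u) :* (t :+ :- u) :* (t :+ :- u)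
      := (t :* t :* t :+ :- (u :* u :* u)) :+ T :* (t :* u :* :- (t :+ :- u))) refl t u) (zero-sum (x≡y⇒x-y≡0 e) (*-zeroˡ _ 3≡0))))

    oscD-char3 : ∀ t a b → oscD t a b ≡ a * b + - cube t
    oscD-char3 t a b = trans (cong (λ y → a * b + - cube t + - (y * (t * b))) 3≡0) (solve 2 (λ x y → x :+ :- (O :* y) := x) refl (a * b + - cube t) (t * b))

    -- The equation for d becomes d = a b - t³, and cubing is injective.
    two-kills-quad-char3 : ∀ {x t u} → Kills (oscV t) (quadP x) (quadY x) → Kills (oscV u) (quadP x) (quadY x) → t ≡ u
    two-kills-quad-char3 {c , d , a , b} {t} {u} kt ku = cube-injective (x-y≡0⇒x≡y (trans
      (solve 3 (λ x t u → t :+ :- u := (x :+ :- u) :+ :- (x :+ :- t)) refl (a * b) (cube t) (cube u))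
      (x≡y⇒x-y≡0 (trans (sym (oscD-char3 u a b)) (trans (proj₂ (kills-quad⇒ u ku)) (trans (sym (proj₂ (kills-quad⇒ t kt))) (oscD-char3 t a b)))))))

    two-kills-lin-char3 : ∀ {x t u} → Kills (oscV t) (linP x) (linY x) → Kills (oscV u) (linP x) (linY x) → t ≡ u
    two-kills-lin-char3 {e , p , k} {t} {u} kt ku = trans (solve 2 (λ e t → t := e :+ :- (e :+ :- t)) refl e t)
      (trans (cong (λ y → e + - y) (cube-injective (trans (proj₂ (kills-lin⇒ t kt)) (sym (proj₂ (kills-lin⇒ u ku)))))) (solve 2 (λ e u → e :+ :- (e :+ :- u) := u) refl e u))

-- Counting pencils by their parameters

module ParameterCount {q : ℕ} (F : FiniteField q) where
  open FiniteField F
  open FieldProperties F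
  open Geometry F
  open Planes F
  open Lines F
  open Charts F

  Parameter : Set
  Parameter = Quadratic ⊎ Linear

  infix 4 _≟Q_ _≟P_
  _≟Q_ : DecidableEquality Quadratic
  _≟Q_ = Productₚ.≡-dec _≟_ (Productₚ.≡-dec _≟_ (Productₚ.≡-dec _≟_ _≟_))

  _≟P_ : DecidableEquality Parameter
  _≟P_ = Sumₚ.≡-dec _≟Q_ (Productₚ.≡-dec _≟_ (Productₚ.≡-dec _≟_ _≟_))

  Valid : Parameter → Set
  Valid (inj₁ x) = resultant x ≢ 0#
  Valid (inj₂ (_ , _ , k)) = k ≢ 0#

  OscKills : Carrier → Parameter → Set
  OscKills t (inj₁ x) = Kills (oscV t) (quadP x) (quadY x)
  OscKills t (inj₂ x) = Kills (oscV t) (linP x) (linY x)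

  oscKills? : ∀ t x → Dec (OscKills t x)
  oscKills? t (inj₁ x) = (_ ≟ _) ×-dec (_ ≟ _)
  oscKills? t (inj₂ x) = (_ ≟ _) ×-dec (_ ≟ _)

  #valid : ℕ
  #valid = (1 ℕ.* ((q ∸ 1) ℕ.* (q ℕ.* q)) ℕ.+ (q ∸ 1) ℕ.* (q ℕ.* (q ℕ.* (q ∸ 1)))) ℕ.+ q ℕ.* (q ℕ.* (q ∸ 1))

  -- For nonzero c the resultant is linear in b with coefficient - c², so exactly one b is excluded;
  -- for c zero it is d².
  count-resultant : CountIs _≡_ (λ x → resultant x ≢ 0#) (1 ℕ.* ((q ∸ 1) ℕ.* (q ℕ.* q)) ℕ.+ (q ∸ 1) ℕ.* (q ℕ.* (q ℕ.* (q ∸ 1))))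
  count-resultant = count-cong
      (count-∪ _≟Q_
        (count-× {P = _≡ 0#} {Q = λ _ x → proj₁ x ≢ 0# × ⊤ × ⊤} (count-singleton 0#) (λ _ _ → count-× (count-≢ 0#) (λ _ _ → count-× order (λ _ _ → order))))
        (count-× {P = _≢ 0#} {Q = λ c x → ⊤ × ⊤ × proj₂ (proj₂ x) ≢ b₀ c (proj₁ x) (proj₁ (proj₂ x))} (count-≢ 0#)
          (λ c _ → count-× {P = λ _ → ⊤} {Q = λ d x → ⊤ × proj₂ x ≢ b₀ c d (proj₁ x)} order (λ d _ → count-× {P = λ _ → ⊤} {Q = λ a b → b ≢ b₀ c d a} order (λ a _ → count-≢ (b₀ c d a)))))
        (λ { _ (c≡0 , _) (c≢0 , _) → c≢0 c≡0 }))
      to from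
    where
    b₀ : Carrier → Carrier → Carrier → Carrier
    b₀ c d a = inv₀ (c * c) * (d * d + a * c * d)
    Split : Quadratic → Set
    Split (c , d , a , b) = (c ≡ 0# × d ≢ 0# × ⊤ × ⊤) ⊎ (c ≢ 0# × ⊤ × ⊤ × b ≢ b₀ c d a)
    to : ∀ x → Split x → resultant x ≢ 0#
    to (c , d , a , b) (inj₁ (refl , d≢0 , _)) e = d≢0 (square≡0 (trans (solve 3 (λ d a b → d :* d := d :* d :+ a :* O :* d :+ :- (b :* (O :* O))) refl d a b) e))
    to (c , d , a , b) (inj₂ (c≢0 , _ , _ , b≢)) e = b≢ (*-cancelˡ (*≢0 c≢0 c≢0) (trans (trans (*-comm (c * c) b) (sym (x-y≡0⇒x≡y e))) (sym (x*i*y _ (*≢0 c≢0 c≢0)))))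
    from : ∀ x → resultant x ≢ 0# → Split x
    from (c , d , a , b) n = go (c ≟ 0#)
      where
      go : Dec (c ≡ 0#) → Split (c , d , a , b)
      go (yes c≡0) = inj₁ (c≡0 , (λ d≡0 → n (trans (cong₂ (λ c d → resultant (c , d , a , b)) c≡0 d≡0)
        (solve 2 (λ a b → O :* O :+ a :* O :* O :+ :- (b :* (O :* O)) := O) refl a b))) , tt , tt)
      go (no c≢0) = inj₂ (c≢0 , tt , tt , λ b≡ → n (x≡y⇒x-y≡0 (sym (trans (*-comm b _) (trans (cong (c * c *_) b≡) (x*i*y _ (*≢0 c≢0 c≢0)))))))

  count-valid : CountIs _≡_ Valid #valid
  count-valid = count-cong (count-⊎ count-resultant (count-× {P = λ _ → ⊤} {Q = λ e x → ⊤ × proj₂ x ≢ 0#} order (λ _ _ → count-× {P = λ _ → ⊤} {Q = λ _ k → k ≢ 0#} order (λ _ _ → count-≢ 0#))))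
    (λ { (inj₁ x) v → v ; (inj₂ x) v → proj₂ (proj₂ v) }) (λ { (inj₁ x) v → v ; (inj₂ x) v → tt , tt , v })

  #incident : ℕ
  #incident = q ℕ.* (q ℕ.* (q ∸ 1)) ℕ.+ q ℕ.* (q ∸ 1)

  Incident : Carrier × Parameter → Set
  Incident (t , x) = Valid x × OscKills t x

  -- A cube (x - t)³ and a monic form g of degree 1 or 2 with g(t) ≢ 0 determine the pencil containing both.
  count-incident : CountIs _≡_ Incident #incident
  count-incident = count-map _≡_
      (count-⊎ (count-× {P = λ _ → ⊤} {Q = λ t x → ⊤ × proj₂ x ≢ t * t + - (proj₁ x * t)} order (λ t _ → count-× {P = λ _ → ⊤} {Q = λ a b → b ≢ t * t + - (a * t)} order (λ a _ → count-≢ _)))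
        (count-× {P = λ _ → ⊤} {Q = λ t e → e ≢ t} order (λ t _ → count-≢ t)))
      f f-valid f-inj f-surj
    where
    Source : (Carrier × Carrier × Carrier) ⊎ (Carrier × Carrier) → Set
    Source = [ (λ { (t , a , b) → ⊤ × ⊤ × b ≢ t * t + - (a * t) }) , (λ { (t , e) → ⊤ × e ≢ t }) ]
    f : (Carrier × Carrier × Carrier) ⊎ (Carrier × Carrier) → Carrier × Parameter
    f (inj₁ (t , a , b)) = t , inj₁ (oscC t a b , oscD t a b , a , b)
    f (inj₂ (t , e)) = t , inj₂ (e , 3# * t , cube (e + - t))
    f-valid : ∀ s → Source s → Incident (f s)
    f-valid (inj₁ (t , a , b)) (_ , _ , n) =
      (λ e → n (sym (x-y≡0⇒x≡y (cube≡0 (trans (sym (resultant-osc a b t)) e))))) , kills-quad⇐ t refl refl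
    f-valid (inj₂ (t , e)) (_ , n) = cube≢0 (λ z → n (x-y≡0⇒x≡y z)) , kills-lin⇐ t refl refl
    f-inj : ∀ s s′ → Source s → Source s′ → f s ≡ f s′ → s ≡ s′
    f-inj (inj₁ (t , a , b)) (inj₁ (t′ , a′ , b′)) _ _ e = cong inj₁ (cong₂ _,_ (cong proj₁ e) (cong (λ x → proj₂ (proj₂ x)) (Sumₚ.inj₁-injective (cong proj₂ e))))
    f-inj (inj₂ (t , u)) (inj₂ (t′ , u′)) _ _ e = cong inj₂ (cong₂ _,_ (cong proj₁ e) (cong proj₁ (Sumₚ.inj₂-injective (cong proj₂ e))))
    f-inj (inj₁ _) (inj₂ _) _ _ e = ⊥-elim (disjoint (cong proj₂ e))
      where
      disjoint : ∀ {x : Quadratic} {y : Linear} → ¬ (inj₁ x ≡ inj₂ y)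
      disjoint ()
    f-inj (inj₂ _) (inj₁ _) _ _ e = ⊥-elim (disjoint (cong proj₂ e))
      where
      disjoint : ∀ {x : Quadratic} {y : Linear} → ¬ (inj₂ y ≡ inj₁ x)
      disjoint ()
    f-surj : ∀ y → Incident y → ∃[ s ] (Source s × y ≡ f s)
    f-surj (t , inj₁ (c , d , a , b)) (v , k) = inj₁ (t , a , b) , (tt , tt , n) , cong (t ,_) (cong inj₁ (cong₂ _,_ (sym c≡) (cong (_, a , b) (sym d≡))))
      where
      c≡ : oscC t a b ≡ c
      c≡ = proj₁ (kills-quad⇒ t k)
      d≡ : oscD t a b ≡ d
      d≡ = proj₂ (kills-quad⇒ t k)
      n : b ≢ t * t + - (a * t)
      n e = v (trans (cong₂ (λ c d → resultant (c , d , a , b)) (sym c≡) (sym d≡)) (trans (resultant-osc a b t)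
        (trans (cong cube (x≡y⇒x-y≡0 (sym e))) (solve 0 (O :* O :* O := O) refl))))
    f-surj (t , inj₂ (e , p , k)) (v , kt) = inj₂ (t , e) , (tt , n) , cong (t ,_) (cong inj₂ (cong (e ,_) (cong₂ _,_ p≡ (sym k≡))))
      where
      p≡ : p ≡ 3# * t
      p≡ = proj₁ (kills-lin⇒ t kt)
      k≡ : cube (e + - t) ≡ k
      k≡ = proj₂ (kills-lin⇒ t kt)
      n : e ≢ t
      n e≡t = v (trans (sym k≡) (trans (cong cube (x≡y⇒x-y≡0 e≡t)) (solve 0 (O :* O :* O := O) refl)))

  InΓ : Parameter → Set
  InΓ x = Valid x × ∃[ t ] OscKills t x

  #enΓ : ℕ
  #enΓ = suc q ℕ.* q ℕ.* ((q ∸ 1) ℕ.* (q ∸ 1))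

  -- With q = k + 1 this is the polynomial identity `#valid` = `#incident` + `#enΓ` in k, free of
  -- truncated subtraction.
  valid∸incident : #valid ∸ #incident ≡ #enΓ
  valid∸incident = subst (λ n → ((1 ℕ.* ((q ∸ 1) ℕ.* (n ℕ.* n)) ℕ.+ (q ∸ 1) ℕ.* (n ℕ.* (n ℕ.* (q ∸ 1)))) ℕ.+ n ℕ.* (n ℕ.* (q ∸ 1))) ∸ (n ℕ.* (n ℕ.* (q ∸ 1)) ℕ.+ n ℕ.* (q ∸ 1))
      ≡ suc n ℕ.* n ℕ.* ((q ∸ 1) ℕ.* (q ∸ 1))) suc-pred-order
    (trans (cong (_∸ (suc k ℕ.* (suc k ℕ.* k) ℕ.+ suc k ℕ.* k)) (identity k)) (ℕₚ.m+n∸m≡n (suc k ℕ.* (suc k ℕ.* k) ℕ.+ suc k ℕ.* k) _))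
    where
    k : ℕ
    k = q ∸ 1
    identity : ∀ k → (1 ℕ.* (k ℕ.* (suc k ℕ.* suc k)) ℕ.+ k ℕ.* (suc k ℕ.* (suc k ℕ.* k))) ℕ.+ suc k ℕ.* (suc k ℕ.* k)
      ≡ (suc k ℕ.* (suc k ℕ.* k) ℕ.+ suc k ℕ.* k) ℕ.+ suc (suc k) ℕ.* suc k ℕ.* (k ℕ.* k)
    identity = ℕsolve 1 (λ k → let s = ℕcon 1 ⊕′ k in
        (ℕcon 1 ⊗ (k ⊗ (s ⊗ s)) ⊕′ k ⊗ (s ⊗ (s ⊗ k))) ⊕′ s ⊗ (s ⊗ k) ⊜ (s ⊗ (s ⊗ k) ⊕′ s ⊗ k) ⊕′ (ℕcon 1 ⊕′ s) ⊗ s ⊗ (k ⊗ k)) refl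
      where open +-*-Solver renaming (solve to ℕsolve; con to ℕcon; _:+_ to _⊕′_; _:*_ to _⊗_; _:=_ to _⊜_)

  module CharacteristicThree (3≡0 : 3# ≡ 0#) where

    count-InΓ : CountIs _≡_ InΓ #incident
    count-InΓ = count-map _≡_ count-incident proj₂ (λ { (t , x) (v , k) → v , t , k })
      (λ { (t , x) (u , .x) (_ , k) (_ , l) refl → cong (_, x) (unique x k l) })
      (λ { x (v , t , k) → (t , x) , (v , k) , refl })
      where
      unique : ∀ x {t u} → OscKills t x → OscKills u x → t ≡ u
      unique (inj₁ x) = two-kills-quad-char3 3≡0
      unique (inj₂ x) = two-kills-lin-char3 3≡0

    count-enΓ : CountIs _≡_ (λ x → Valid x × ¬ InΓ x) #enΓ
    count-enΓ = subst (CountIs _≡_ _) valid∸incident (count-∖ _≟P_ count-valid count-InΓ (λ _ → proj₁))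

  HasRoot : Carrier × Carrier → Set
  HasRoot (A , B) = ∃[ t ] (t * t ≡ A * t + - B)

  -- For an irreducible x² - A x + B the pencil meant here is that of an imaginary axis.
  Imaginary : Parameter → Set
  Imaginary x = ∃[ AB ] (¬ HasRoot AB × x ≡ inj₁ (axis (proj₁ AB) (proj₂ AB)))

  -- The argument `imaginary-valid` is supplied later, since its proof uses the conjugate roots in K
  -- and this module stays over F.
  module CharacteristicNotThree (3≢0 : 3# ≢ 0#) (imaginary-valid : ∀ x → Imaginary x → Valid x) where

    -- An auxiliary linear order, given by the place in the enumeration; it selects a representative
    -- of each unordered pair.
    position : Carrier → ℕ
    position t = toℕ (Count≡.index {P = λ _ → ⊤} order t tt)

    position-injective : ∀ {t u} → position t ≡ position u → t ≡ u
    position-injective {t} {u} e = trans (elem-index t tt) (trans (cong elem (Finₚ.toℕ-injective e)) (sym (elem-index u tt)))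
      where open Count≡ {P = λ _ → ⊤} order

    infix 4 _≺_ _≺?_
    _≺_ : Carrier → Carrier → Set
    t ≺ u = position t ℕ.< position u

    _≺?_ : ∀ t u → Dec (t ≺ u)
    t ≺? u = position t ℕ.<? position u

    Increasing : Carrier × Carrier → Set
    Increasing (t , u) = t ≺ u

    count-all : CountIs {Carrier × Carrier} _≡_ (λ _ → ⊤ × ⊤) (q ℕ.* q)
    count-all = count-× {P = λ _ → ⊤} {Q = λ _ _ → ⊤} order (λ _ _ → order)

    filtered : ∃[ n ] CountIs _≡_ (λ x → (⊤ × ⊤) × ¬ Increasing x) n
    filtered = count-filter (Productₚ.≡-dec _≟_ _≟_) {Q = λ x → ¬ Increasing x} count-all (λ { (t , u) → ¬? (t ≺? u) })

    #weaklyDecreasing #increasing : ℕ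
    #weaklyDecreasing = proj₁ filtered
    #increasing = q ℕ.* q ∸ #weaklyDecreasing

    count-increasing : CountIs _≡_ Increasing #increasing
    count-increasing = count-cong (count-∖ (Productₚ.≡-dec _≟_ _≟_) count-all (proj₂ filtered) (λ _ → proj₁))
      (λ { (t , u) (_ , n) → decidable-stable (t ≺? u) (λ ¬< → n (_ , ¬<)) }) (λ { (t , u) lt → _ , λ { (_ , ¬lt) → ¬lt lt } })

    -- Vieta: a monic quadratic with one root t has the second root A - t, and the two roots form
    -- exactly one weakly decreasing pair.
    count-HasRoot : CountIs _≡_ HasRoot #weaklyDecreasing
    count-HasRoot = count-map _≡_ (proj₂ filtered) f (λ { (t , u) _ → t , root-sum-product 3≢0 t u }) f-inj f-surj
      where
      f : Carrier × Carrier → Carrier × Carrier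
      f (t , u) = t + u , t * u
      f-inj : ∀ x y → (⊤ × ⊤) × ¬ Increasing x → (⊤ × ⊤) × ¬ Increasing y → f x ≡ f y → x ≡ y
      f-inj (t , u) (t′ , u′) (_ , t≮u) (_ , t′≮u′) e = [ same , swapped ] (noZeroDivisors (t + - t′) (t + - u′) product≡0)
        where
        sum≡ : t + u ≡ t′ + u′
        sum≡ = cong proj₁ e
        product≡0 : (t + - t′) * (t + - u′) ≡ 0#
        product≡0 = trans (solve 4 (λ t u t′ u′ → (t :+ :- t′) :* (t :+ :- u′) := t :* ((t :+ u) :+ :- (t′ :+ u′)) :+ (:- I) :* (t :* u :+ :- (t′ :* u′))) refl t u t′ u′)
          (comb0 t (- 1#) (x≡y⇒x-y≡0 sum≡) (x≡y⇒x-y≡0 (cong proj₂ e)))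
        other : ∀ {t u t′ u′} → t ≡ t′ → t + u ≡ t′ + u′ → u ≡ u′
        other {t} {u} {.t} {u′} refl e = trans (solve 2 (λ t u → u := :- t :+ (t :+ u)) refl t u) (trans (cong (λ y → - t + y) e) (solve 2 (λ t u → :- t :+ (t :+ u) := u) refl t u′))
        same : t + - t′ ≡ 0# → (t , u) ≡ (t′ , u′)
        same z = cong₂ _,_ (x-y≡0⇒x≡y z) (other (x-y≡0⇒x≡y z) sum≡)
        swapped : t + - u′ ≡ 0# → (t , u) ≡ (t′ , u′)
        swapped z = cong₂ _,_ (trans t≡u u≡t′) (trans (sym t≡u) t≡u′)
          where
          t≡u′ : t ≡ u′
          t≡u′ = x-y≡0⇒x≡y z
          u≡t′ : u ≡ t′
          u≡t′ = other t≡u′ (trans sum≡ (+-comm t′ u′))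
          t≡u : t ≡ u
          t≡u = position-injective (ℕₚ.≤-antisym (subst₂ (λ a b → position a ℕ.≤ position b) (sym t≡u′) (sym u≡t′) (ℕₚ.≮⇒≥ t′≮u′)) (ℕₚ.≮⇒≥ t≮u))
      f-surj : ∀ x → HasRoot x → ∃[ y ] (((⊤ × ⊤) × ¬ Increasing y) × x ≡ f y)
      f-surj (A , B) (t , e) = go (t ≺? u)
        where
        u : Carrier
        u = A + - t
        A≡ : A ≡ t + u
        A≡ = solve 2 (λ A t → A := t :+ (A :+ :- t)) refl A t
        B≡ : B ≡ t * u
        B≡ = sym (x-y≡0⇒x≡y (trans (solve 3 (λ A B t → t :* (A :+ :- t) :+ :- B := :- (t :* t :+ :- (A :* t :+ :- B))) refl A B t)
          (trans (cong -_ (x≡y⇒x-y≡0 e)) (solve 0 (:- O := O) refl))))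
        go : Dec (t ≺ u) → ∃[ y ] (((⊤ × ⊤) × ¬ Increasing y) × (A , B) ≡ f y)
        go (yes lt) = (u , t) , (_ , ℕₚ.<-asym lt) , cong₂ _,_ (trans A≡ (+-comm t u)) (trans B≡ (*-comm t u))
        go (no nlt) = (t , u) , (_ , nlt) , cong₂ _,_ A≡ B≡

    axis-injective : ∀ A B A′ B′ → inj₁ {B = Linear} (axis A B) ≡ inj₁ (axis A′ B′) → A ≡ A′ × B ≡ B′
    axis-injective A B A′ B′ e = A≡ , trans (recover A B) (trans (cong₂ (λ A b → A * A + 3# * b) A≡ (cong (λ x → proj₂ (proj₂ (proj₂ x))) (Sumₚ.inj₁-injective e))) (sym (recover A′ B′)))
      where
      A≡ : A ≡ A′
      A≡ = cong (λ x → proj₁ (proj₂ (proj₂ x))) (Sumₚ.inj₁-injective e)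
      recover : ∀ A B → B ≡ A * A + 3# * - (inv₀ 3# * (A * A + - B))
      recover A B = trans (solve 2 (λ A B → B := A :+ :- (A :+ :- B)) refl (A * A) B) (cong (λ y → A * A + y) (sym (axis-b 3≢0 A B)))

    -- Removing the split ones from the q² monic quadratics leaves as many as there are strictly
    -- increasing pairs, and neither number has to be known.
    count-imaginary : CountIs _≡_ Imaginary #increasing
    count-imaginary = count-map _≡_ (count-∖ (Productₚ.≡-dec _≟_ _≟_) count-all count-HasRoot (λ _ _ → _))
      (λ x → inj₁ (axis (proj₁ x) (proj₂ x))) (λ { x (_ , irr) → x , irr , refl })
      (λ { (A , B) (A′ , B′) _ _ e → let A≡ , B≡ = axis-injective A B A′ B′ e in cong₂ _,_ A≡ B≡ })
      (λ { x (AB , irr , e) → AB , (_ , irr) , e })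

    -- The pencil contains a cube earlier than the one at t. Deleting these incidences leaves
    -- exactly the first one of each pencil in Γ.
    Repeated : Carrier × Parameter → Set
    Repeated (t , x) = Incident (t , x) × ∃[ u ] (u ≺ t × OscKills u x)

    two-kills : ∀ x {t u} → t ≢ u → OscKills t x → OscKills u x → x ≡ inj₁ (axis (t + u) (t * u))
    two-kills (inj₁ x) t≢u k l = cong inj₁ (two-kills⇒axis 3≢0 t≢u k l)
    two-kills (inj₂ x) t≢u k l = ⊥-elim (t≢u (two-kills-lin 3≢0 k l))

    ≺⇒≢ : ∀ {u t} → u ≺ t → t ≢ u
    ≺⇒≢ lt refl = ℕₚ.<-irrefl refl lt

    third-kill : ∀ x {t u w} → t ≢ u → t ≢ w → OscKills t x → OscKills u x → OscKills w x → u ≡ w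
    third-kill x {t} {u} {w} t≢u t≢w k l m = trans (solve 2 (λ t u → u := :- t :+ (t :+ u)) refl t u)
      (trans (cong (λ y → - t + y) (proj₁ (axis-injective _ _ _ _ (trans (sym (two-kills x t≢u k l)) (two-kills x t≢w k m))))) (solve 2 (λ t u → :- t :+ (t :+ u) := u) refl t w))

    -- By `two-kills` an increasing pair (u , t) determines the pencil, and t together with the sum
    -- t + u read off from the pencil recovers u.
    count-repeated : CountIs _≡_ Repeated #increasing
    count-repeated = count-map _≡_ count-increasing f f-valid f-inj f-surj
      where
      f : Carrier × Carrier → Carrier × Parameter
      f (u , t) = t , inj₁ (axis (t + u) (t * u))
      f-valid : ∀ x → Increasing x → Repeated (f x)
      f-valid (u , t) lt = (resultant-axis 3≢0 t u (≺⇒≢ lt) , root⇒osc-kills-axis 3≢0 _ _ t (root-sum-product 3≢0 t u)) ,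
        u , lt , root⇒osc-kills-axis 3≢0 _ _ u (solve 2 (λ t u → u :* u := (t :+ u) :* u :+ :- (t :* u)) refl t u)
      f-inj : ∀ x y → Increasing x → Increasing y → f x ≡ f y → x ≡ y
      f-inj (u , t) (u′ , t′) lt lt′ e = cong₂ _,_ (trans (solve 2 (λ t u → u := :- t :+ (t :+ u)) refl t u)
          (trans (cong₂ (λ t A → - t + A) t≡ (proj₁ (axis-injective _ _ _ _ (cong proj₂ e)))) (solve 2 (λ t u → :- t :+ (t :+ u) := u) refl t′ u′))) t≡
        where
        t≡ : t ≡ t′
        t≡ = cong proj₁ e
      f-surj : ∀ y → Repeated y → ∃[ x ] (Increasing x × y ≡ f x)
      f-surj (t , x) ((v , k) , u , lt , l) = (u , t) , lt , cong (t ,_) (two-kills x (≺⇒≢ lt) k l)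

    repeated? : ∀ t x → Dec (∃[ u ] (u ≺ t × OscKills u x))
    repeated? t x = search order (λ u → (u ≺? t) ×-dec oscKills? u x)

    count-InΓ : CountIs _≡_ InΓ (#incident ∸ #increasing)
    count-InΓ = count-map _≡_ (count-∖ (Productₚ.≡-dec _≟_ _≟P_) count-incident count-repeated (λ _ → proj₁)) proj₂
        (λ { (t , x) ((v , k) , _) → v , t , k }) f-inj f-surj
      where
      f-inj : ∀ y y′ → Incident y × ¬ Repeated y → Incident y′ × ¬ Repeated y′ → proj₂ y ≡ proj₂ y′ → y ≡ y′
      f-inj (t , x) (u , .x) ((v , k) , ¬r) ((_ , l) , ¬r′) refl = cong (_, x) (position-injective
        (ℕₚ.≤-antisym (ℕₚ.≮⇒≥ (λ lt → ¬r ((v , k) , u , lt , l))) (ℕₚ.≮⇒≥ (λ lt → ¬r′ ((v , l) , t , lt , k)))))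
      f-surj : ∀ x → InΓ x → ∃[ y ] ((Incident y × ¬ Repeated y) × x ≡ proj₂ y)
      f-surj x (v , t , k) = go (repeated? t x)
        where
        go : Dec (∃[ u ] (u ≺ t × OscKills u x)) → ∃[ y ] ((Incident y × ¬ Repeated y) × x ≡ proj₂ y)
        go (no n) = (t , x) , ((v , k) , λ { (_ , r) → n r }) , refl
        -- Here u is the first cube of the pencil: an even earlier w would make three different
        -- cubes in it, against `third-kill`.
        go (yes (u , u≺t , l)) = (u , x) , ((v , l) , λ { (_ , w , w≺u , m) →
          ≺⇒≢ w≺u (third-kill x (≺⇒≢ u≺t) (≺⇒≢ (ℕₚ.<-trans w≺u u≺t)) k l m) }) , refl

    count-enΓ : CountIs _≡_ (λ x → Valid x × ¬ (InΓ x ⊎ Imaginary x)) #enΓ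
    count-enΓ = subst (CountIs _≡_ _) (trans (cong (#valid ∸_) (ℕₚ.m∸n+n≡m increasing≤incident)) valid∸incident)
        (count-∖ _≟P_ count-valid (count-∪ _≟P_ count-InΓ count-imaginary disjoint) (λ { x (inj₁ (v , _)) → v ; x (inj₂ i) → imaginary-valid x i }))
      where
      -- Subtracting and adding back `#increasing` restores `#incident` only under this bound, as
      -- subtraction is truncated.
      increasing≤incident : #increasing ℕ.≤ #incident
      increasing≤incident = count-≤ count-repeated count-incident (λ y → y) (λ _ → proj₁) (λ _ _ _ _ e → e)
      disjoint : ∀ x → InΓ x → ¬ Imaginary x
      disjoint x (v , t , k) ((A , B) , irr , refl) = irr (t , osc-kills-axis⇒root 3≢0 A B t k)

-- Characteristic 3 and divisibility of q by 3

module Characteristic {q : ℕ} (F : FiniteField q) where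
  open FiniteField F
  open FieldProperties F

  multiple-+ : ∀ m n → multiple (m ℕ.+ n) ≡ multiple m + multiple n
  multiple-+ zero n = sym (+-identityˡ _)
  multiple-+ (suc m) n = trans (cong (λ x → 1# + x) (multiple-+ m n)) (sym (+-assoc 1# _ _))

  multiple-* : ∀ m n → multiple (m ℕ.* n) ≡ multiple m * multiple n
  multiple-* zero n = sym (zeroˡ _)
  multiple-* (suc m) n = trans (multiple-+ n (m ℕ.* n)) (trans (cong (λ x → multiple n + x) (multiple-* m n))
    (solve 2 (λ x y → y :+ x :* y := (I :+ x) :* y) refl (multiple m) (multiple n)))

  multiple-3 : multiple 3 ≡ 3#
  multiple-3 = solve 0 (I :+ (I :+ (I :+ O)) := I :+ I :+ I) refl

  -- When 3 vanishes, q · 1 = 0 reduces to the multiple of 1 by the remainder of q modulo 3.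
  -- Remainder 1 contradicts 1 ≠ 0, and so does remainder 2 in combination with 3 = 0.
  3≡0⇒3∣q : 3# ≡ 0# → q ℕ.% 3 ≡ 0
  3≡0⇒3∣q 3≡0 = remainder (q ℕ.% 3) (m%n<n q 3) (begin
      multiple (q ℕ.% 3)                                  ≡⟨ sym (+-identityʳ _) ⟩
      multiple (q ℕ.% 3) + 0#                             ≡⟨ cong (λ x → multiple (q ℕ.% 3) + x) (sym (trans (cong (λ x → multiple (q ℕ./ 3) * x) (trans multiple-3 3≡0)) (zeroʳ _))) ⟩
      multiple (q ℕ.% 3) + multiple (q ℕ./ 3) * multiple 3 ≡⟨ cong (λ x → multiple (q ℕ.% 3) + x) (sym (multiple-* (q ℕ./ 3) 3)) ⟩
      multiple (q ℕ.% 3) + multiple (q ℕ./ 3 ℕ.* 3)       ≡⟨ sym (multiple-+ (q ℕ.% 3) (q ℕ./ 3 ℕ.* 3)) ⟩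
      multiple (q ℕ.% 3 ℕ.+ q ℕ./ 3 ℕ.* 3)                ≡⟨ cong multiple (sym (m≡m%n+[m/n]*n q 3)) ⟩
      multiple q                                          ≡⟨ multiple-order ⟩
      0# ∎)
    where
    open ≡-Reasoning
    remainder : ∀ r → r ℕ.< 3 → multiple r ≡ 0# → r ≡ 0
    remainder 0 _ _ = refl
    remainder 1 _ e = ⊥-elim (0≢1 (sym (trans (sym (+-identityʳ 1#)) e)))
    remainder 2 _ e = ⊥-elim (0≢1 (trans (sym 3≡0) (trans (solve 0 (I :+ I :+ I := I :+ (I :+ (I :+ O))) refl)
      (trans (cong (λ x → 1# + x) e) (+-identityʳ 1#)))))
    remainder (suc (suc (suc r))) (s≤s (s≤s (s≤s ()))) _

  -- A prime power divisible by 3 is a power of 3, and 3^k · 1 = 0 yields 3 = 0 in a field. This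
  -- ties the condition on q modulo 3 in the definition of EnΓ-lines to the characteristic.
  3∣q⇒3≡0 : IsPrimePower q → q ℕ.% 3 ≡ 0 → 3# ≡ 0#
  3∣q⇒3≡0 (p , k , p-prime , _ , q≡p^k) 3∣q = power-zero k (trans (cong (λ p → multiple (p ℕ.^ k)) 3≡p) (trans (cong multiple (sym q≡p^k)) multiple-order))
    where
    3∣p^ : ∀ k → 3 ∣ p ℕ.^ k → 3 ∣ p
    3∣p^ zero d with ∣1⇒≡1 d
    ... | ()
    3∣p^ (suc k) d = [ (λ e → e) , 3∣p^ k ] (euclidsLemma p (p ℕ.^ k) (from-yes (prime? 3)) d)
    3≡p : 3 ≡ p
    3≡p with prime⇒irreducible p-prime (3∣p^ k (subst (3 ∣_) q≡p^k (m%n≡0⇒n∣m q 3 3∣q)))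
    ... | inj₂ e = e
    power-zero : ∀ k → multiple (3 ℕ.^ k) ≡ 0# → 3# ≡ 0#
    power-zero zero e = ⊥-elim (0≢1 (sym (trans (sym (+-identityʳ 1#)) e)))
    power-zero (suc k) e = [ trans (sym multiple-3) , power-zero k ] (noZeroDivisors (multiple 3) (multiple (3 ℕ.^ k)) (trans (sym (multiple-* 3 (3 ℕ.^ k))) e))

-- From parameters to EnΓ-lines

module Parametrization {q : ℕ} (2≤q : 2 ℕ.≤ q) {F : FiniteField q} (E : QuadExt F) where
  open QuadExt E using (ι; ι-+; ι-*; ι-1; ι-inj; ιV; Irrational; IsImagAxis; IsImagChord; IsEnΓ; K)
  open QuadExtProperties 2≤q E
  open Extension 2≤q E
  open FiniteField F
  open FieldProperties F
  open Geometry F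
  open Planes F
  open Lines F
  open Charts F
  open ParameterCount F
  private
    module KF = FiniteField K
    module KP = FieldProperties K
    module GK = Geometry K
    module PK = Planes K
    module CK = Charts K

  lineOf : Parameter → LineRep
  lineOf (inj₁ x) = quadLine x
  lineOf (inj₂ x) = linLine x

  ι-sub : ∀ x y → ι (x + - y) ≡ ι x KF.+ KF.- ι y
  ι-sub x y = trans (ι-+ x (- y)) (cong (ι x KF.+_) (ι-neg y))

  ιQ : Quadratic → CK.Quadratic
  ιQ (c , d , a , b) = ι c , ι d , ι a , ι b

  ιL : Linear → CK.Linear
  ιL (e , p , k) = ι e , ι p , ι k

  ιQ-injective : ∀ x y → ιQ x ≡ ιQ y → x ≡ y
  ιQ-injective x y e = cong₂ _,_ (ι-inj _ _ (cong proj₁ e)) (cong₂ _,_ (ι-inj _ _ (cong (λ v → proj₁ (proj₂ v)) e))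
    (cong₂ _,_ (ι-inj _ _ (cong (λ v → proj₁ (proj₂ (proj₂ v))) e)) (ι-inj _ _ (cong (λ v → proj₂ (proj₂ (proj₂ v))) e))))

  ι-quadP : ∀ x → ιV (quadP x) ≡ CK.quadP (ιQ x)
  ι-quadP (c , d , a , b) = GK.≡V4 (trans (ι-sub _ c) (cong (KF._+ KF.- ι c) (trans (ι-+ _ b) (cong (KF._+ ι b) (ι-* a a))))) refl ι-1 ι-0

  ι-quadY : ∀ x → ιV (quadY x) ≡ CK.quadY (ιQ x)
  ι-quadY (c , d , a , b) = GK.≡V4 (trans (ι-sub _ d) (cong (KF._+ KF.- ι d) (ι-* a b))) refl ι-0 ι-1

  ι-linP : ∀ x → ιV (linP x) ≡ CK.linP (ιL x)
  ι-linP (e , p , k) = GK.≡V4 refl ι-1 ι-0 ι-0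

  ι-linY : ∀ x → ιV (linY x) ≡ CK.linY (ιL x)
  ι-linY (e , p , k) = GK.≡V4 (trans (ι-sub _ k) (cong (KF._+ KF.- ι k) (trans (ι-sub _ _)
    (cong₂ (λ x y → x KF.+ KF.- y) (trans (ι-* _ e) (cong (KF._* ι e) (ι-* e e))) (trans (ι-* p _) (cong (ι p KF.*_) (ι-* e e))))))) ι-0 refl ι-1

  ι-resultant : ∀ x → ι (resultant x) ≡ CK.resultant (ιQ x)
  ι-resultant (c , d , a , b) = trans (ι-sub _ _) (cong₂ (λ x y → x KF.+ KF.- y)
    (trans (ι-+ _ _) (cong₂ KF._+_ (ι-* d d) (trans (ι-* _ d) (cong (KF._* ι d) (ι-* a c)))))
    (trans (ι-* b _) (cong (ι b KF.*_) (ι-* c c))))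

  ι-nonzero : ∀ {x} → ι x ≡ KF.0# → x ≡ 0#
  ι-nonzero e = ι-inj _ _ (trans e (sym ι-0))

  ι-3 : ι 3# ≡ KF.3#
  ι-3 = trans (ι-+ _ _) (cong₂ KF._+_ (trans (ι-+ _ _) (cong₂ KF._+_ ι-1 ι-1)) ι-1)

  valid⇒no-point : ∀ x → Valid x → ∀ t → ¬ OnLine (Pt t) (lineOf x)
  valid⇒no-point (inj₁ x) v (just t) e = v (point∈quad⇒resultant≡0 x t e)
  valid⇒no-point (inj₁ x) v nothing e = ∞∉quad x e
  valid⇒no-point (inj₂ (a , p , k)) v (just t) e = v (point∈lin⇒k≡0 a p k t e)
  valid⇒no-point (inj₂ x) v nothing e = ∞∉lin x e

  -- The resultant, or k in the linear case, keeps its nonzero value over K, where it excludes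
  -- points of the cubic at irrational parameters too.
  valid⇒no-chord : ∀ x → Valid x → ¬ IsImagChord (lineOf x)
  valid⇒no-chord (inj₁ x) v (σ , _ , σ∈ , _) = v (ι-nonzero (trans (ι-resultant x)
    (CK.point∈quad⇒resultant≡0 (ιQ x) σ (subst₂ (KF.InSpan (KF.Pt (just σ))) (ι-quadP x) (ι-quadY x) σ∈))))
  valid⇒no-chord (inj₂ x@(e , p , k)) v (σ , _ , σ∈ , _) = v (ι-nonzero
    (CK.point∈lin⇒k≡0 (ι e) (ι p) (ι k) σ (subst₂ (KF.InSpan (KF.Pt (just σ))) (ι-linP x) (ι-linY x) σ∈)))

  off-infinity : ∀ x → ¬ Kills πinfV (gen₁ (lineOf x)) (gen₂ (lineOf x))
  off-infinity (inj₁ x) (_ , e) = 0≢1 (trans (sym e) (e₃· _ _ _ _))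
  off-infinity (inj₂ x) (_ , e) = 0≢1 (trans (sym e) (e₃· _ _ _ _))

  oscKills⇒kills : ∀ t x → OscKills t x → Kills (oscV t) (gen₁ (lineOf x)) (gen₂ (lineOf x))
  oscKills⇒kills t (inj₁ x) k = k
  oscKills⇒kills t (inj₂ x) k = k

  kills⇒oscKills : ∀ t x → Kills (oscV t) (gen₁ (lineOf x)) (gen₂ (lineOf x)) → OscKills t x
  kills⇒oscKills t (inj₁ x) k = k
  kills⇒oscKills t (inj₂ x) k = k

  valid⇒enΓ : ∀ x → Valid x → ¬ (∃[ t ] OscKills t x) → (¬ (q ℕ.% 3 ≡ 0) → ¬ IsImagAxis (lineOf x)) → IsEnΓ (lineOf x)
  valid⇒enΓ x v no-osc no-axis = valid⇒no-point x v , no-Γ , valid⇒no-chord x v , no-axis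
    where
    no-Γ : ∀ π → ΓPlaneOf π → ¬ (lineOf x ⊆π π)
    no-Γ π isΓ k = go (proj₁ killed) (kills-osc⇒Γ (proj₁ killed) (proj₂ killed))
      where
      killed = ΓPlaneOf⇒kills-osc (lineOf x) π isΓ k
      go : ∀ τ → Kills (ΓV τ) (gen₁ (lineOf x)) (gen₂ (lineOf x)) → ⊥
      go (just t) l = no-osc (t , kills⇒oscKills t x l)
      go nothing l = off-infinity x l

  enΓ⇒not-oscKills : ∀ x → IsEnΓ (lineOf x) → ¬ (∃[ t ] OscKills t x)
  enΓ⇒not-oscKills x (_ , no-Γ , _) (t , k) = no-Γ (ΓPlane (just t)) (ΓPlane-isΓ (just t)) (oscKills⇒kills t x k)

  -- The sum and product of the conjugate roots turn formulas in A and B over F into formulas in two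
  -- distinct elements of K.
  record Conjugates (A B : Carrier) : Set where
    field
      σ : KF.Carrier
      irrational : Irrational σ
      equation : σ KF.* σ ≡ ι A KF.* σ KF.+ KF.- ι B
      sum : σ KF.+ (σ KF.^ q) ≡ ι A
      product : σ KF.* (σ KF.^ q) ≡ ι B
      distinct : σ ≢ σ KF.^ q

  conjugates : ∀ A B → ¬ HasRoot (A , B) → Conjugates A B
  conjugates A B irr = record
    { σ = σ ; irrational = irrational
    ; equation = equation
    ; sum = trans (cong (σ KF.+_) conj) (KP.solve 2 (λ s a → s KP.:+ (a KP.:+ KP.:- s) KP.:= a) refl σ (ι A))
    ; product = trans (cong (σ KF.*_) conj) (KP.x-y≡0⇒x≡y (trans (KP.solve 3 (λ s a b → s KP.:* (a KP.:+ KP.:- s) KP.:+ KP.:- b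
        KP.:= KP.:- (s KP.:* s KP.:+ KP.:- (a KP.:* s KP.:+ KP.:- b))) refl σ (ι A) (ι B)) (trans (cong KF.-_ (KP.x≡y⇒x-y≡0 equation)) (KP.solve 0 (KP.:- KP.O KP.:= KP.O) refl))))
    ; distinct = λ e → irrational⇒^q≢ σ irrational (sym e) }
    where
    σ : KF.Carrier
    σ = proj₁ (quadratic-root A (- B))
    root : σ KF.* σ ≡ ι A KF.* σ KF.+ ι (- B)
    root = proj₂ (quadratic-root A (- B))
    equation : σ KF.* σ ≡ ι A KF.* σ KF.+ KF.- ι B
    equation = trans root (cong (λ y → ι A KF.* σ KF.+ y) (ι-neg B))
    irrational : Irrational σ
    irrational (z , e) = irr (z , ι-inj _ _ (trans (ι-* z z) (trans (cong₂ KF._*_ e e) (trans root (trans (cong (λ s → ι A KF.* s KF.+ ι (- B)) (sym e))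
      (sym (trans (ι-+ _ _) (cong (KF._+ ι (- B)) (ι-* A z)))))))))
    conj : σ KF.^ q ≡ ι A KF.+ KF.- σ
    conj = irrational⇒conjugate A (- B) σ irrational root

  -- A zero resultant means a common root of g and c x + d. If c is nonzero, this is the rational -
  -- d / c; otherwise d vanishes too, and every root of g gives a point of the line, possibly only
  -- over K.
  valid-of-enΓ : ∀ x → IsEnΓ (lineOf x) → Valid x
  valid-of-enΓ (inj₂ (e , p , k)) (no-pt , _) k≡0 = no-pt (just e) (k≡0⇒point∈lin e p k k≡0)
  valid-of-enΓ (inj₁ x@(c , d , a , b)) (no-pt , _ , no-chord , _) res≡0 = go (c ≟ 0#)
    where
    rational : ∀ t → t * t ≡ a * t + b → c * t + d ≡ 0# → ⊥
    rational t e f = no-pt (just t) (root⇒point∈quad c d a b t e f)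
    go : Dec (c ≡ 0#) → ⊥
    go (no c≢0) = rational t t²≡ ct+d≡0
      where
      t : Carrier
      t = - (inv₀ c * d)
      ct≡ : c * t ≡ - d
      ct≡ = trans (solve 3 (λ c i d → c :* :- (i :* d) := :- (c :* (i :* d))) refl c (inv₀ c) d) (cong -_ (x*i*y d c≢0))
      ct+d≡0 : c * t + d ≡ 0#
      ct+d≡0 = trans (cong (_+ d) ct≡) (-‿inverseˡ d)
      t²≡ : t * t ≡ a * t + b
      t²≡ = x-y≡0⇒x≡y (zero⇒ (*≢0 c≢0 c≢0) (trans (solve 5 (λ a b c d t → c :* c :* (t :* t :+ :- (a :* t :+ b))
          := I :* (d :* d :+ a :* c :* d :+ :- (b :* (c :* c))) :+ (c :* t :+ :- d :+ :- (a :* c)) :* (c :* t :+ d)) refl a b c d t)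
        (comb0 _ _ res≡0 ct+d≡0)))
    go (yes c≡0) = none (search order (λ t → t * t ≟ a * t + b))
      where
      d≡0 : d ≡ 0#
      d≡0 = square≡0 (trans (solve 3 (λ d a b → d :* d := d :* d :+ a :* O :* d :+ :- (b :* (O :* O))) refl d a b) (trans (cong (λ c → resultant (c , d , a , b)) (sym c≡0)) res≡0))
      ct+d≡0 : ∀ t → c * t + d ≡ 0#
      ct+d≡0 t = zero-sum (*-zeroˡ t c≡0) d≡0
      none : Dec (∃[ t ] (t * t ≡ a * t + b)) → ⊥
      none (yes (t , e)) = rational t e (ct+d≡0 t)
      -- The irreducible g divides all forms of the pencil, so the extended line joins the points at
      -- its two conjugate roots.
      none (no n) = no-chord (σ , irrational , on σ σ-root , on (σ KF.^ q) conj-root)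
        where
        irreducible : ¬ HasRoot (a , - b)
        irreducible (t , e) = n (t , trans e (cong (λ y → a * t + y) (solve 1 (λ b → :- (:- b) := b) refl b)))
        open Conjugates (conjugates a (- b) irreducible)
        cancel-neg : KF.- ι (- b) ≡ ι b
        cancel-neg = trans (sym (ι-neg (- b))) (cong ι (solve 1 (λ b → :- (:- b) := b) refl b))
        σ-root : σ KF.* σ ≡ ι a KF.* σ KF.+ ι b
        σ-root = trans equation (cong (λ y → ι a KF.* σ KF.+ y) cancel-neg)
        conj-root : (σ KF.^ q) KF.* (σ KF.^ q) ≡ ι a KF.* (σ KF.^ q) KF.+ ι b
        conj-root = trans (KP.solve 2 (λ s t → t KP.:* t KP.:= (s KP.:+ t) KP.:* t KP.:+ KP.:- (s KP.:* t)) refl σ (σ KF.^ q))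
          (cong₂ KF._+_ (cong (KF._* (σ KF.^ q)) sum) (trans (cong KF.-_ product) cancel-neg))
        on : ∀ s → s KF.* s ≡ ι a KF.* s KF.+ ι b → KF.InSpan (KF.Pt (just s)) (ιV (quadP x)) (ιV (quadY x))
        on s e = subst₂ (KF.InSpan (KF.Pt (just s))) (sym (ι-quadP x)) (sym (ι-quadY x)) (CK.root⇒point∈quad (ι c) (ι d) (ι a) (ι b) s e
          (trans (cong (KF._+ ι d) (sym (ι-0s s))) (trans (KP.+-identityˡ _) (trans (cong ι d≡0) ι-0))))
          where
          ι-0s : ∀ s → KF.0# ≡ ι c KF.* s
          ι-0s s = sym (GK.*-zeroˡ s (trans (cong ι c≡0) ι-0))

  module _ (3≢0 : 3# ≢ 0#) where

    3K≢0 : KF.3# ≢ KF.0#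
    3K≢0 e = 3≢0 (ι-nonzero (trans ι-3 e))

    ι-inv3 : ι (inv₀ 3#) ≡ PK.inv₀ KF.3#
    ι-inv3 = KP.*-cancelˡ 3K≢0 (trans (cong (KF._* ι (inv₀ 3#)) (sym ι-3)) (trans (sym (ι-* 3# _)) (trans (cong ι (*-inv₀ 3≢0)) (trans ι-1 (sym (PK.*-inv₀ 3K≢0))))))

    ι-axis : ∀ A B → ιQ (axis A B) ≡ CK.axis (ι A) (ι B)
    ι-axis A B = cong₂ _,_
        (trans (ι-sub _ _) (cong₂ (λ x y → x KF.+ KF.- y) (trans (ι-+ _ _) (cong₂ KF._+_ (ι-* A A) b≡)) (trans (ι-* 3# B) (cong (KF._* ι B) ι-3))))
        (cong₂ _,_ (trans (ι-+ _ _) (cong₂ KF._+_ (trans (ι-* A _) (cong (ι A KF.*_) b≡)) (ι-* A B))) (cong (ι A ,_) b≡))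
      where
      b≡ : ι (- (inv₀ 3# * (A * A + - B))) ≡ KF.- (PK.inv₀ KF.3# KF.* (ι A KF.* ι A KF.+ KF.- ι B))
      b≡ = trans (ι-neg _) (cong KF.-_ (trans (ι-* _ _) (cong₂ KF._*_ ι-inv3 (trans (ι-sub _ B) (cong (KF._+ KF.- ι B) (ι-* A A))))))

    -- Over K the pencil becomes the axis of the distinct conjugate roots, so `resultant-axis`
    -- applies there, and the resultant commutes with base change.
    imaginary-valid : ∀ x → Imaginary x → Valid x
    imaginary-valid x ((A , B) , irr , refl) e = CK.resultant-axis 3K≢0 σ (σ KF.^ q) distinct
        (trans (cong₂ (λ A B → CK.resultant (CK.axis A B)) sum product) (trans (cong CK.resultant (sym (ι-axis A B))) (trans (sym (ι-resultant (axis A B))) (trans (cong ι e) ι-0))))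
      where open Conjugates (conjugates A B irr)

    imaginary⇒imagAxis : ∀ x → Imaginary x → IsImagAxis (lineOf x)
    imaginary⇒imagAxis x ((A , B) , irr , refl) = σ , irrational , proj₁ k , proj₂ k , proj₁ k′ , proj₂ k′
      where
      open Conjugates (conjugates A B irr)
      kills : ∀ s → s KF.* s ≡ ι A KF.* s KF.+ KF.- ι B → GK.Kills (KF.oscV s) (ιV (quadP (axis A B))) (ιV (quadY (axis A B)))
      kills s e = subst₂ (GK.Kills (KF.oscV s)) (sym (trans (ι-quadP (axis A B)) (cong CK.quadP (ι-axis A B)))) (sym (trans (ι-quadY (axis A B)) (cong CK.quadY (ι-axis A B))))
        (CK.root⇒osc-kills-axis 3K≢0 (ι A) (ι B) s e)
      k = kills σ equation
      k′ = kills (σ KF.^ q) (trans (KP.solve 2 (λ s t → t KP.:* t KP.:= (s KP.:+ t) KP.:* t KP.:+ KP.:- (s KP.:* t)) refl σ (σ KF.^ q))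
        (cong₂ (λ a b → a KF.* (σ KF.^ q) KF.+ KF.- b) sum product))

    -- Over K the line is the axis of σ and σ^q, so their sum and product can be read off from its
    -- coordinates, which lie in F. A rational root of the resulting quadratic would be σ or its
    -- conjugate and make σ rational.
    imagAxis⇒imaginary : ∀ x → IsImagAxis (lineOf x) → Imaginary x
    imagAxis⇒imaginary (inj₂ x) (σ , irr , e₁ , e₂ , e₃ , e₄) = ⊥-elim (irrational⇒^q≢ σ irr (sym (CK.two-kills-lin 3K≢0 {ιL x}
      (subst₂ (GK.Kills (KF.oscV σ)) (ι-linP x) (ι-linY x) (e₁ , e₂)) (subst₂ (GK.Kills (KF.oscV (σ KF.^ q))) (ι-linP x) (ι-linY x) (e₃ , e₄)))))
    imagAxis⇒imaginary (inj₁ x@(c , d , a , b)) (σ , irr , e₁ , e₂ , e₃ , e₄) = (a , B) , no-root , cong inj₁ (ιQ-injective x (axis a B) (trans x≡ (sym (trans (ι-axis a B) (cong₂ CK.axis a≡ B≡)))))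
      where
      σ̄ : KF.Carrier
      σ̄ = σ KF.^ q
      x≡ : ιQ x ≡ CK.axis (σ KF.+ σ̄) (σ KF.* σ̄)
      x≡ = CK.two-kills⇒axis 3K≢0 (λ e → irrational⇒^q≢ σ irr (sym e)) (subst₂ (GK.Kills (KF.oscV σ)) (ι-quadP x) (ι-quadY x) (e₁ , e₂))
        (subst₂ (GK.Kills (KF.oscV σ̄)) (ι-quadP x) (ι-quadY x) (e₃ , e₄))
      a≡ : ι a ≡ σ KF.+ σ̄
      a≡ = cong (λ v → proj₁ (proj₂ (proj₂ v))) x≡
      b≡ : ι b ≡ proj₂ (proj₂ (proj₂ (CK.axis (σ KF.+ σ̄) (σ KF.* σ̄))))
      b≡ = cong (λ v → proj₂ (proj₂ (proj₂ v))) x≡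
      -- Solved from c = a² + b - 3 B, the first coordinate of `axis a B`.
      B : Carrier
      B = inv₀ 3# * (a * a + b + - c)
      B≡ : ι B ≡ σ KF.* σ̄
      B≡ = KP.*-cancelˡ 3K≢0 (begin
        KF.3# KF.* ι B                         ≡⟨ cong (KF._* ι B) (sym ι-3) ⟩
        ι 3# KF.* ι B                          ≡⟨ sym (ι-* 3# B) ⟩
        ι (3# * B)                             ≡⟨ cong ι (x*i*y _ 3≢0) ⟩
        ι (a * a + b + - c)                    ≡⟨ trans (ι-sub _ c) (cong (KF._+ KF.- ι c) (trans (ι-+ _ b) (cong (KF._+ ι b) (ι-* a a)))) ⟩
        ι a KF.* ι a KF.+ ι b KF.+ KF.- ι c    ≡⟨ cong₂ (λ y z → y KF.+ KF.- z) (cong₂ (λ y z → y KF.* y KF.+ z) a≡ b≡) (cong proj₁ x≡) ⟩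
        _                                      ≡⟨ KP.solve 2 (λ y z → y KP.:+ KP.:- (y KP.:+ KP.:- z) KP.:= z) refl _ _ ⟩
        KF.3# KF.* (σ KF.* σ̄)                  ∎)
        where open ≡-Reasoning
      no-root : ¬ HasRoot (a , B)
      no-root (z , e) = [ (λ f → irr (z , KP.x-y≡0⇒x≡y f)) , (λ f → irr (a + - z , σ≡ (KP.x-y≡0⇒x≡y f))) ]
          (KP.noZeroDivisors (ι z KF.+ KF.- σ) (ι z KF.+ KF.- σ̄) (trans (KP.solve 3 (λ z s t → (z KP.:+ KP.:- s) KP.:* (z KP.:+ KP.:- t)
            KP.:= z KP.:* z KP.:+ KP.:- ((s KP.:+ t) KP.:* z KP.:+ KP.:- (s KP.:* t))) refl (ι z) σ σ̄) (KP.x≡y⇒x-y≡0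
              (trans (sym (ι-* z z)) (trans (cong ι e) (trans (ι-sub _ B) (cong₂ (λ y w → y KF.+ KF.- w) (trans (ι-* a z) (cong (KF._* ι z) a≡)) B≡)))))))
        where
        σ≡ : ι z ≡ σ̄ → ι (a + - z) ≡ σ
        σ≡ f = trans (ι-sub a z) (trans (cong₂ (λ y w → y KF.+ KF.- w) a≡ f) (KP.solve 2 (λ s t → s KP.:+ t KP.:+ KP.:- t KP.:= s) refl σ σ̄))

  -- The last two coordinates separate the vectors of a quadratic line, but both vanish on the
  -- nonzero vector `linP y`; so the two charts are disjoint.
  lin∉quad : ∀ x y → ¬ InSpan (linP y) (quadP x) (quadY x)
  lin∉quad x y@(_ , p , _) p∈ = 0≢1 (sym (trans (cong (λ v → proj₁ (proj₂ v)) (trans (Chart.DualBasis.expand (quad-dual x) p∈)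
      (cong₂ (λ α β → (α ⊙ quadP x) ⊕ (β ⊙ quadY x)) (e₂· p 1# 0# 0#) (e₃· p 1# 0# 0#))))
    (solve 2 (λ u v → O :* u :+ O :* v := O) refl (proj₁ (proj₂ (quadP x))) (proj₁ (proj₂ (quadY x))))))

  lineOf-injective : ∀ x y → SameLine (lineOf x) (lineOf y) → x ≡ y
  lineOf-injective (inj₁ x@(c , d , a , b)) (inj₁ y@(c′ , d′ , a′ , b′)) (p∈ , y∈ , _) = cong inj₁ (cong₂ _,_ (shift c c′ c≡) (cong₂ _,_ (shift d d′ d≡) (cong₂ _,_ (sym a≡) (sym b≡))))
    where
    open Chart.DualBasis
    same : ∀ {z} α β → e₂ · z ≡ α → e₃ · z ≡ β → InSpan z (quadP x) (quadY x) → z ≡ (α ⊙ quadP x) ⊕ (β ⊙ quadY x)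
    same {z} α β f g z∈ = trans (expand (quad-dual x) z∈) (cong₂ (λ α β → (α ⊙ quadP x) ⊕ (β ⊙ quadY x)) f g)
    p≡ : quadP y ≡ (1# ⊙ quadP x) ⊕ (0# ⊙ quadY x)
    p≡ = same 1# 0# (φp (quad-dual y)) (ψp (quad-dual y)) p∈
    y≡ : quadY y ≡ (0# ⊙ quadP x) ⊕ (1# ⊙ quadY x)
    y≡ = same 0# 1# (φy (quad-dual y)) (ψy (quad-dual y)) y∈
    left : ∀ u v → 1# * u + 0# * v ≡ u
    left = solve 2 (λ u v → I :* u :+ O :* v := u) refl
    right : ∀ u v → 0# * u + 1# * v ≡ v
    right = solve 2 (λ u v → O :* u :+ I :* v := v) refl
    a≡ : a′ ≡ a
    a≡ = trans (cong (λ v → proj₁ (proj₂ v)) p≡) (left _ _)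
    b≡ : b′ ≡ b
    b≡ = trans (cong (λ v → proj₁ (proj₂ v)) y≡) (right _ _)
    c≡ : (a * a + b) + - c ≡ (a * a + b) + - c′
    c≡ = trans (sym (trans (cong proj₁ p≡) (left _ _))) (cong₂ (λ a b → a * a + b + - c′) a≡ b≡)
    d≡ : a * b + - d ≡ a * b + - d′
    d≡ = trans (sym (trans (cong proj₁ y≡) (right _ _))) (cong₂ (λ a b → a * b + - d′) a≡ b≡)
    shift : ∀ {m} u v → m + - u ≡ m + - v → u ≡ v
    shift {m} u v e = trans (solve 2 (λ m u → u := m :+ :- (m :+ :- u)) refl m u) (trans (cong (λ w → m + - w) e) (solve 2 (λ m u → m :+ :- (m :+ :- u) := u) refl m v))
  lineOf-injective (inj₂ x@(e , p , k)) (inj₂ y@(e′ , p′ , k′)) (p∈ , y∈ , _) = cong inj₂ (cong₂ _,_ (sym e≡) (cong₂ _,_ (sym p≡′) k≡))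
    where
    open Chart.DualBasis
    same : ∀ {z} α β → e₁ · z ≡ α → e₃ · z ≡ β → InSpan z (linP x) (linY x) → z ≡ (α ⊙ linP x) ⊕ (β ⊙ linY x)
    same {z} α β f g z∈ = trans (expand (lin-dual x) z∈) (cong₂ (λ α β → (α ⊙ linP x) ⊕ (β ⊙ linY x)) f g)
    p≡ : linP y ≡ (1# ⊙ linP x) ⊕ (0# ⊙ linY x)
    p≡ = same 1# 0# (φp (lin-dual y)) (ψp (lin-dual y)) p∈
    y≡ : linY y ≡ (0# ⊙ linP x) ⊕ (1# ⊙ linY x)
    y≡ = same 0# 1# (φy (lin-dual y)) (ψy (lin-dual y)) y∈
    left : ∀ u v → 1# * u + 0# * v ≡ u
    left = solve 2 (λ u v → I :* u :+ O :* v := u) refl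
    right : ∀ u v → 0# * u + 1# * v ≡ v
    right = solve 2 (λ u v → O :* u :+ I :* v := v) refl
    p≡′ : p′ ≡ p
    p≡′ = trans (cong proj₁ p≡) (left _ _)
    e≡ : e′ ≡ e
    e≡ = trans (cong (λ v → proj₁ (proj₂ (proj₂ v))) y≡) (right _ _)
    k≡ : k ≡ k′
    k≡ = trans (solve 2 (λ m u → u := m :+ :- (m :+ :- u)) refl (e * e * e + - (p * (e * e))) k)
      (trans (cong (λ w → e * e * e + - (p * (e * e)) + - w) (trans (sym (trans (cong proj₁ y≡) (right _ _))) (cong₂ (λ e p → e * e * e + - (p * (e * e)) + - k′) e≡ p≡′)))
        (solve 2 (λ m u → m :+ :- (m :+ :- u) := u) refl (e * e * e + - (p * (e * e))) k′))
  lineOf-injective (inj₁ x) (inj₂ y) (p∈ , _) = ⊥-elim (lin∉quad x y p∈)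
  lineOf-injective (inj₂ y) (inj₁ x) (_ , _ , p∈ , _) = ⊥-elim (lin∉quad x y p∈)

  -- The last coordinate is paired with the third one if possible and otherwise with the second. If
  -- both charts fail, the line lies in the plane x₃ = 0 or passes through P(∞).
  parameter : ∀ L → IsEnΓ L → ∃[ x ] SameLine L (lineOf x)
  parameter L@((u@(u₀ , u₁ , u₂ , u₃) , v@(v₀ , v₁ , v₂ , v₃)) , ind) (no-pt , no-Γ , _) = go (Q.minor u v ≟ 0#) (N.minor u v ≟ 0#)
    where
    module Q = Chart e₂ e₃
    module N = Chart e₁ e₃
    Result : Set
    Result = ∃[ x ] SameLine L (lineOf x)
    go : Dec (Q.minor u v ≡ 0#) → Dec (N.minor u v ≡ 0#) → Result
    go (no m≢0) _ = inj₁ x , subst (λ z → InSpan z u v) P≡ p∈ , subst (λ z → InSpan z u v) Y≡ y∈ , subst₂ (InSpan u) P≡ Y≡ u∈ , subst₂ (InSpan v) P≡ Y≡ v∈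
      where
      open Q.Normalized (Q.normalize {u} {v} m≢0)
      open Q.DualBasis dual
      p₀ a y₀ b : Carrier
      p₀ = proj₁ p
      a = proj₁ (proj₂ p)
      y₀ = proj₁ y
      b = proj₁ (proj₂ y)
      x : Quadratic
      x = a * a + b + - p₀ , a * b + - y₀ , a , b
      P≡ : p ≡ quadP x
      P≡ = ≡V4 (solve 2 (λ m p → p := m :+ :- (m :+ :- p)) refl (a * a + b) p₀) refl (trans (sym (e₂· _ _ _ _)) φp) (trans (sym (e₃· _ _ _ _)) ψp)
      Y≡ : y ≡ quadY x
      Y≡ = ≡V4 (solve 2 (λ m p → p := m :+ :- (m :+ :- p)) refl (a * b) y₀) refl (trans (sym (e₂· _ _ _ _)) φy) (trans (sym (e₃· _ _ _ _)) ψy)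
    go (yes m≡0) (no n≢0) = inj₂ x , subst (λ z → InSpan z u v) P≡ p∈ , subst (λ z → InSpan z u v) Y≡ y∈ , subst₂ (InSpan u) P≡ Y≡ u∈ , subst₂ (InSpan v) P≡ Y≡ v∈
      where
      open N.Normalized (N.normalize {u} {v} n≢0)
      open N.DualBasis dual
      p₀ e y₀ : Carrier
      p₀ = proj₁ p
      e = proj₁ (proj₂ (proj₂ y))
      y₀ = proj₁ y
      x : Linear
      x = e , p₀ , e * e * e + - (p₀ * (e * e)) + - y₀
      minor-span : ∀ {p y} → InSpan p u v → InSpan y u v → Q.minor p y ≡ 0#
      minor-span {p} {y} (α , β , refl) (γ , δ , refl) = trans (cong₂ (λ s t → s + - t) (cong₂ _*_ (·-comb e₂ α β u v) (·-comb e₃ γ δ u v)) (cong₂ _*_ (·-comb e₂ γ δ u v) (·-comb e₃ α β u v)))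
        (trans (solve 8 (λ α β γ δ s t w z → (α :* s :+ β :* t) :* (γ :* w :+ δ :* z) :+ :- ((γ :* s :+ δ :* t) :* (α :* w :+ β :* z)) := (α :* δ :+ :- (β :* γ)) :* (s :* z :+ :- (t :* w)))
          refl α β γ δ (e₂ · u) (e₂ · v) (e₃ · u) (e₃ · v)) (*-zeroʳ _ m≡0))
      -- On the dual basis p, y the functional `e₃` takes the values 0 and 1, so `Q.minor p y` is
      -- just the third coordinate of p.
      p₂≡0 : proj₁ (proj₂ (proj₂ p)) ≡ 0#
      p₂≡0 = trans (sym (e₂· _ _ _ _)) (trans (solve 2 (λ s t → s := s :* I :+ :- (t :* O)) refl (e₂ · p) (e₂ · y))
        (trans (cong₂ (λ s t → e₂ · p * s + - (e₂ · y * t)) (sym ψy) (sym ψp)) (minor-span p∈ y∈)))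
      P≡ : p ≡ linP x
      P≡ = ≡V4 refl (trans (sym (e₁· _ _ _ _)) φp) p₂≡0 (trans (sym (e₃· _ _ _ _)) ψp)
      Y≡ : y ≡ linY x
      Y≡ = ≡V4 (solve 2 (λ m p → p := m :+ :- (m :+ :- p)) refl (e * e * e + - (p₀ * (e * e))) y₀) (trans (sym (e₁· _ _ _ _)) φy) refl (trans (sym (e₃· _ _ _ _)) ψy)
    go (yes m≡0) (yes n≡0) = ⊥-elim (no-pt nothing (subst (λ z → InSpan z u v) z≡ (i * v₃ , i * - u₃ , refl)))
      where
      -- If both last coordinates vanished, the line would lie in the osculating plane at infinity.
      -- So v₃ u - u₃ v is a genuine vector of the line, and only its first coordinate is nonzero.
      u₃v₃ : ¬ (v₃ ≡ 0# × - u₃ ≡ 0#)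
      u₃v₃ (f , g) = no-Γ (ΓPlane nothing) (ΓPlane-isΓ nothing) (trans (e₃· _ _ _ _) (trans (solve 1 (λ x → x := :- (:- x)) refl u₃) (trans (cong -_ g) (solve 0 (:- O := O) refl))) , trans (e₃· _ _ _ _) f)
      m≡0′ : u₂ * v₃ + - (v₂ * u₃) ≡ 0#
      m≡0′ = trans (sym (cong₂ (λ s t → s + - t) (cong₂ _*_ (e₂· _ _ _ _) (e₃· _ _ _ _)) (cong₂ _*_ (e₂· _ _ _ _) (e₃· _ _ _ _)))) m≡0
      n≡0′ : u₁ * v₃ + - (v₁ * u₃) ≡ 0#
      n≡0′ = trans (sym (cong₂ (λ s t → s + - t) (cong₂ _*_ (e₁· _ _ _ _) (e₃· _ _ _ _)) (cong₂ _*_ (e₁· _ _ _ _) (e₃· _ _ _ _)))) n≡0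
      z₀ i : Carrier
      z₀ = v₃ * u₀ + - u₃ * v₀
      i = inv₀ z₀
      swap : ∀ s t → v₃ * s + - u₃ * t ≡ s * v₃ + - (t * u₃)
      swap s t = solve 4 (λ v₃ u₃ s t → v₃ :* s :+ :- u₃ :* t := s :* v₃ :+ :- (t :* u₃)) refl v₃ u₃ s t
      z₃≡0 : v₃ * u₃ + - u₃ * v₃ ≡ 0#
      z₃≡0 = solve 2 (λ v₃ u₃ → v₃ :* u₃ :+ :- u₃ :* v₃ := O) refl v₃ u₃
      z₀≢0 : z₀ ≢ 0#
      z₀≢0 e = u₃v₃ (ind v₃ (- u₃) (≡V4 e (trans (swap u₁ v₁) n≡0′) (trans (swap u₂ v₂) m≡0′) z₃≡0))
      scaled : ∀ s t → i * v₃ * s + i * - u₃ * t ≡ i * (v₃ * s + - u₃ * t)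
      scaled s t = solve 5 (λ i v₃ u₃ s t → i :* v₃ :* s :+ i :* :- u₃ :* t := i :* (v₃ :* s :+ :- u₃ :* t)) refl i v₃ u₃ s t
      z≡ : ((i * v₃) ⊙ u) ⊕ ((i * - u₃) ⊙ v) ≡ Pt nothing
      z≡ = ≡V4 (trans (scaled u₀ v₀) (trans (*-comm i z₀) (*-inv₀ z₀≢0))) (trans (scaled u₁ v₁) (*-zeroʳ i (trans (swap u₁ v₁) n≡0′)))
        (trans (scaled u₂ v₂) (*-zeroʳ i (trans (swap u₂ v₂) m≡0′))) (trans (scaled u₃ v₃) (*-zeroʳ i z₃≡0))

  count-enΓ-lines : IsPrimePower q → CountIs SameLine IsEnΓ #enΓ
  count-enΓ-lines q-prime-power = go (3# ≟ 0#)
    where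
    open Characteristic F
    go : Dec (3# ≡ 0#) → CountIs SameLine IsEnΓ #enΓ
    -- In characteristic 3 the axis clause of `IsEnΓ` is vacuous, since 3 divides q.
    go (yes 3≡0) = count-map SameLine {Q = IsEnΓ} (CharacteristicThree.count-enΓ 3≡0) lineOf
        (λ x (v , ¬Γ) → valid⇒enΓ x v (λ k → ¬Γ (v , k)) (λ n → ⊥-elim (n (3≡0⇒3∣q 3≡0))))
        (λ x y _ _ → lineOf-injective x y) surj
      where
      surj : ∀ L → IsEnΓ L → ∃[ x ] ((Valid x × ¬ InΓ x) × SameLine L (lineOf x))
      surj L enΓ = x , (valid-of-enΓ x enΓ′ , λ { (_ , k) → enΓ⇒not-oscKills x enΓ′ k }) , same
        where
        x : Parameter
        x = proj₁ (parameter L enΓ)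
        same : SameLine L (lineOf x)
        same = proj₂ (parameter L enΓ)
        enΓ′ : IsEnΓ (lineOf x)
        enΓ′ = enΓ-resp L (lineOf x) same enΓ
    go (no 3≢0) = count-map SameLine {Q = IsEnΓ} (CharacteristicNotThree.count-enΓ 3≢0 (imaginary-valid 3≢0)) lineOf
        (λ x (v , ¬bad) → valid⇒enΓ x v (λ k → ¬bad (inj₁ (v , k))) (λ _ axis → ¬bad (inj₂ (imagAxis⇒imaginary 3≢0 x axis))))
        (λ x y _ _ → lineOf-injective x y) surj
      where
      surj : ∀ L → IsEnΓ L → ∃[ x ] ((Valid x × ¬ (InΓ x ⊎ Imaginary x)) × SameLine L (lineOf x))
      surj L enΓ = x , (valid-of-enΓ x enΓ′ , [ (λ { (_ , k) → enΓ⇒not-oscKills x enΓ′ k }) ,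
          (λ i → proj₂ (proj₂ (proj₂ enΓ′)) (λ 3∣q → 3≢0 (3∣q⇒3≡0 q-prime-power 3∣q)) (imaginary⇒imagAxis 3≢0 x i)) ]) , same
        where
        x : Parameter
        x = proj₁ (parameter L enΓ)
        same : SameLine L (lineOf x)
        same = proj₂ (parameter L enΓ)
        enΓ′ : IsEnΓ (lineOf x)
        enΓ′ = enΓ-resp L (lineOf x) same enΓ

open import Data.Nat using (_≥_; _<_; _*_; _%_)
open FiniteField using (Is2CPlane; IsRealAxis; _⊆π_; SameLine; SameFlag)
open QuadExt using (IsImagAxis; IsEnΓ; EnΓ2CFlag)

theorem5p6 : (q : ℕ) → q ≥ 5 → IsPrimePower q →
    (F : FiniteField q) → (E : QuadExt F) →
    (¬ (q % 3 ≡ 0) → ∀ π → Is2CPlane F π → ∀ L →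
    (IsRealAxis F L → ¬ (_⊆π_ F L π)) × (IsImagAxis E L → ¬ (_⊆π_ F L π)))
    × (∀ π → Is2CPlane F π →
    CountIs (SameLine F) (λ L → IsEnΓ E L × _⊆π_ F L π) ((q ∸ 1) * (q ∸ 1)))
    × (∃[ m ] (0 < m × CountIs (SameLine F) (IsEnΓ E) m
    × CountIs (SameFlag F) (EnΓ2CFlag E) m))
theorem5p6 q q≥5 q-prime-power F E =
    (λ _ π two L → Extension.2C-plane∌realAxis 2≤q E π two L , Extension.2C-plane∌imagAxis 2≤q E π two L) ,
    PlaneCount.count-enΓ-in-2C 2≤q E ,
    -- The common value of the two counts says that the average number of 2_C-planes through an
    -- EnΓ-line is 1; its positivity makes this average meaningful.
    ParameterCount.#enΓ F , positive q q≥5 , Parametrization.count-enΓ-lines 2≤q E q-prime-power , PlaneCount.count-flags 2≤q E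
  where
  2≤q : 2 ℕ.≤ q
  2≤q = ℕₚ.≤-trans (s≤s (s≤s z≤n)) q≥5
  positive : ∀ n → n ≥ 5 → 0 < suc n * n * ((n ∸ 1) * (n ∸ 1))
  positive (suc (suc n)) _ = s≤s z≤n
  positive 1 (s≤s ())
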